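{- There is an absolute constant $\delta''>0$ such that for every integer $k\ge 2$, the online $k$-matroid intersection problem in the random arrival model admits a randomized online algorithm that is $\left(\frac1k+\frac{\delta''}{k^4}\right)$-competitive.
   Context: Online $k$-matroid intersection in the random arrival model: $k\ge2$ matroids $\mathcal{M}_1,\dots,\mathcal{M}_k$ are given on a common finite ground set $E$ with $m=|E|$. The elements of $E$ are revealed one at a time in a uniformly random order. The algorithm knows $m$ and can query independence oracles of all $k$ matroids on sets of already-arrived elements. Upon arrival of an element it must immediately and irrevocably decide whether to pick it, and the picked set must at all times be independent in all $k$ matroids. $\textsc{OPT}$ is a maximum-cardinality set independent in all $k$ matroids. An algorithm is $c$-competitive if on every instance the expected number of picked elements (over the random order and its coins) is at least $c\,|\textsc{OPT}|$. -}

module Defs where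

open import Data.Bool using (Bool; T; _∧_)
open import Data.Fin using (Fin; zero; suc; toℕ; inject≤; punchIn)
open import Data.Fin.Permutation
  using (Permutation′; _⟨$⟩ʳ_; _⟨$⟩ˡ_; id; insert; remove; _≈_; insert-punchIn; insert-remove)
open import Data.Fin.Properties using (any?; punchIn-injective; toℕ<n; _≟_)
open import Data.Fin.Subset using (Subset; ⊥; ⁅_⁆; ∣_∣; _∈_; _∉_; _⊆_; _∪_)
open import Data.Fin.Subset.Properties using (_∈?_)
open import Data.Integer using (+_)
open import Data.List
  using (List; []; _∷_; [_]; length; map; allFin; cartesianProduct; cartesianProductWith)
import Data.List.Properties as List
open import Data.List.Relation.Unary.Any using (Any; here)
import Data.List.Relation.Unary.Any.Properties as Any
open import Data.List.Membership.Propositional.Properties using (∈-allFin)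
open import Data.List.Relation.Unary.AllPairs using ([]; _∷_)
open import Data.List.Relation.Unary.All using ([])
import Data.List.Relation.Unary.Unique.Propositional.Properties as Unique
import Data.List.Relation.Unary.Unique.Setoid.Properties as UniqueS
open import Data.List.Relation.Unary.Unique.Setoid using (Unique)
open import Data.Nat
  using (ℕ; zero; suc; _<_; _≤_; _+_; _*_; _<ᵇ_; _!; NonZero)
open import Data.Nat.ListAction using (sum)
open import Data.Nat.Properties using (_!≢0; m*n≢0)
open import Data.Product using (∃-syntax; _×_; _,_)
open import Data.Rational using (ℚ; _/_)
import Data.Rational as ℚ
open import Data.Vec using (tabulate)
open import Relation.Binary.Bundles using (Setoid)
open import Relation.Binary.PropositionalEquality
  using (_≡_; refl; sym; trans; cong; cong₂)
import Relation.Binary.PropositionalEquality as ≡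
open import Relation.Nullary using (does)
open import Relation.Nullary.Decidable using (_×-dec_)
open import Level using (0ℓ)

-- Independence is Boolean-valued: `indep` is the independence oracle.
record Matroid (m : ℕ) : Set where
  field
    indep : Subset m → Bool

  Independent : Subset m → Set
  Independent S = T (indep S)

  field
    ⊥-independent : Independent ⊥
    hereditary    : ∀ {S U} → S ⊆ U → Independent U → Independent S
    augmentation  : ∀ {S U} → Independent S → Independent U → ∣ S ∣ < ∣ U ∣ →
                    ∃[ e ] e ∈ U × e ∉ S × Independent (S ∪ ⁅ e ⁆)

open Matroid public using (indep; Independent)

Instance : ℕ → ℕ → Set
Instance k m = Fin k → Matroid m

CommonIndependent : ∀ {k m} → Instance k m → Subset m → Set
CommonIndependent I S = ∀ i → Independent (I i) S

IsOPT : ∀ {k m} → Instance k m → Subset m → Set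
IsOPT I O = CommonIndependent I O × (∀ S → CommonIndependent I S → ∣ S ∣ ≤ ∣ O ∣)

-- `σ ⟨$⟩ʳ t` is the element arriving at time `t`.
Order : ℕ → Set
Order = Permutation′

-- Every permutation exactly once, by choosing the image of `zero` first.
orders : ∀ m → List (Order m)
orders zero    = [ id ]
orders (suc m) = cartesianProductWith (insert zero) (allFin (suc m)) (orders m)

length-cartesianProductWith :
  ∀ {A B C : Set} (f : A → B → C) xs ys →
  length (cartesianProductWith f xs ys) ≡ length xs * length ys
length-cartesianProductWith f []       ys = refl
length-cartesianProductWith f (x ∷ xs) ys =
  trans (List.length-++ (map (f x) ys))
        (cong₂ _+_ (List.length-map (f x) ys) (length-cartesianProductWith f xs ys))

length-orders : ∀ m → length (orders m) ≡ m !
length-orders zero    = refl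
length-orders (suc m) =
  trans (length-cartesianProductWith (insert zero) (allFin (suc m)) (orders m))
        (cong₂ _*_ (List.length-tabulate {n = suc m} (λ i → i)) (length-orders m))

insert-cong : ∀ {m} (i : Fin (suc m)) {π ρ : Order m} → π ≈ ρ → insert zero i π ≈ insert zero i ρ
insert-cong i π≈ρ zero    = refl
insert-cong i π≈ρ (suc t) = cong (punchIn i) (π≈ρ t)

insert-injective : ∀ {m} {i j : Fin (suc m)} {π ρ : Order m} →
                   insert zero i π ≈ insert zero j ρ → i ≡ j × π ≈ ρ
insert-injective {i = i} {π = π} {ρ} eq with eq zero
... | refl = refl , λ t → punchIn-injective i _ _
  (trans (sym (insert-punchIn zero i π t)) (trans (eq (suc t)) (insert-punchIn zero i ρ t)))

orders-complete : ∀ m (σ : Order m) → Any (σ ≈_) (orders m)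
orders-complete zero    σ = here (λ ())
orders-complete (suc m) σ =
  Any.cartesianProductWith⁺ (insert zero)
    (λ { {i} {π} refl rest t →
         trans (sym (insert-remove zero σ t)) (insert-cong i rest t) })
    (∈-allFin (σ ⟨$⟩ʳ zero)) (orders-complete m (remove zero σ))

Order-setoid : ℕ → Setoid 0ℓ 0ℓ
Order-setoid m = record
  { Carrier       = Order m
  ; _≈_           = _≈_
  ; isEquivalence = record
    { refl  = λ _ → refl
    ; sym   = λ p t → sym (p t)
    ; trans = λ p q t → trans (p t) (q t)
    }
  }

orders-unique : ∀ m → Unique (Order-setoid m) (orders m)
orders-unique zero    = [] ∷ []
orders-unique (suc m) =
  UniqueS.cartesianProductWith⁺ (≡.setoid _) (Order-setoid m) (Order-setoid (suc m))
    (insert zero) insert-injective (Unique.allFin⁺ (suc m)) (orders-unique m)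

image : ∀ {n m} → (Fin n → Fin m) → Subset n → Subset m
image f S = tabulate λ e → does (any? λ t → (t ∈? S) ×-dec (f t ≟ e))

-- The independence oracles after `n` arrivals. Arrived elements are addressed
-- by arrival time, so nothing about unseen elements leaks through names.
View : ℕ → ℕ → Set
View k n = Fin k → Subset n → Bool

view : ∀ {k m} → Instance k m → Order m → (t : Fin m) → View k (suc (toℕ t))
view I σ t i S = indep (I i) (image (λ j → σ ⟨$⟩ʳ inject≤ j (toℕ<n t)) S)

-- The decision at time `t`, given the coins. Views are cumulative and the coins
-- are retained, so earlier decisions need not be passed as a further argument.
Strategy : ℕ → ℕ → ℕ → Set
Strategy k m seeds = Fin seeds → (t : Fin m) → View k (suc (toℕ t)) → Bool

-- The set of elements picked among the first `n` arrivals.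
picked : ∀ {k m seeds} → Strategy k m seeds → Instance k m → Order m → Fin seeds →
         ℕ → Subset m
picked decide I σ s n = tabulate λ e →
  let t = σ ⟨$⟩ˡ e in
  (toℕ t <ᵇ n) ∧ decide s t (view I σ t)

-- All coins are drawn at the outset, as one uniform element of `Fin seeds`
-- independent of the arrival order. For fixed `k` and `m` only finitely many
-- strategies differ in behaviour, so finite uniform coins approximate arbitrary
-- randomness to any precision.
record OnlineAlgorithm (k m : ℕ) : Set where
  field
    seeds          : ℕ
    .{{seeds≢0}}   : NonZero seeds
    decide         : Strategy k m seeds
    feasible       : ∀ I σ s n → CommonIndependent I (picked decide I σ s n)

expectedPicks : ∀ {k m} → OnlineAlgorithm k m → Instance k m → ℚ
expectedPicks {m = m} A I =
  + sum (map outcome (cartesianProduct (orders m) (allFin seeds))) / (m ! * seeds)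
  where
  open OnlineAlgorithm A
  outcome : Order m × Fin seeds → ℕ
  outcome (σ , s) = ∣ picked decide I σ s m ∣
  instance
    _ = m*n≢0 (m !) seeds {{m !≢0}}

Competitive : ∀ {k} → ℚ → (∀ m → OnlineAlgorithm k m) → Set
Competitive c A = ∀ {m} (I : Instance _ m) (O : Subset m) → IsOPT I O →
  c ℚ.* (+ ∣ O ∣ / 1) ℚ.≤ expectedPicks (A m) I

{-# OPTIONS --safe #-}
-- The coins put every arrival into one of 6k windows, so that the elements are labelled
-- independently and uniformly. Window 0 yields a greedy solution T. For ℓ = 1, …, k − 1, window ℓ
-- yields a set V of replacements: elements spanned by T in the matroid `zero`, independent there,
-- and compatible with T and all earlier replacements in the other matroids. The algorithm
-- finally uses one random level: it drops each element of T with probability 1/2, fills the freed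
-- slots from the V of that level, and ends greedily with the windows from k on. Level 0 means T
-- itself.
--
-- Charge every element of a common independent set O to a matroid in which the solution S spans
-- it. Then k |S| + |unspanned elements of O| = |O| + waste, where the waste is the sum of
-- rk i (S ∪ P i) − |P i| over the matroids i and the sets P i charged to them. So it suffices that
-- the expected waste exceeds the expected number of unspanned elements by order |O| / k³:
--
--  * Giving another window to a single element of O shows that few elements remain unspanned, as
--    compared with |S ∩ O|, which is at most waste / (k − 1).
--  * The waste is submodular in (S, P). Let T₀ ⊆ T complete V to a basis of V ∪ T in `zero`, and
--    T₁ = T ∖ T₀. Uncrossing the solutions for the coin sets d, d ⊕ T₀, d ⊕ T₁ and d ⊕ T, which
--    are equally likely, shows: if their waste is small, then V ∪ T is nearly tight in the other
--    matroids with elements of O that T does not span in `zero`. The k − 1 levels together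
--    exhaust the room that O leaves in the matroid `suc zero`. Hence |T|, and with it |O| / k,
--    is bounded by multiples of the wastes.
--
-- The online algorithm reruns this process at each arrival with the oracles that are available:
-- the decision on an element depends only on queries to sets of elements scheduled up to it.
module Submission where

open import Defs

-- Greedy alone stops at 1/k because its waste can vanish: then `T` spans |T| elements of O in every
-- matroid, and these k sets partition O. Random dropping excludes this. Were all wastes zero,
-- uncrossing would confine every `T ∪ˢ V`, in the matroid `suc zero`, to the span of those (k - 1)
-- |T| elements of O that `T` does not span in `zero`. On the other hand, the |T| elements of O that
-- `T` spans in `zero` would not be blocked elsewhere, so each `V` would grow to |T| elements; and
-- `T` with k - 1 such sets is independent in `suc zero` and has k |T| elements. Hence the number of
-- levels. Several levels have a price: an element of O that an earlier window put into `T` or into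
-- its replacements is not offered again to a level that discards it. Such losses are bounded by the
-- wastes of earlier levels. So the levels are used with slowly decreasing probabilities, each one
-- paying for the harm that it does to later ones, and level 0, whose waste enters all these bounds,
-- is by far the likeliest.

module Development where

  import Algebra.Properties.CommutativeMonoid.Sum as MonoidSum
  open import Data.Bool as Bool using (Bool; true; false; _∧_; _∨_; _xor_; not; if_then_else_)
  open import Data.Bool.Properties using (T-≡; ∨-comm)
  open import Data.Empty using (⊥-elim)
  open import Data.Fin using (Fin; zero; suc; toℕ; fromℕ<; inject≤; punchOut)
  open import Data.Fin.Permutation
    using (Permutation′; permutation; _⟨$⟩ʳ_; _⟨$⟩ˡ_; flip; _∘ₚ_; inverseˡ; inverseʳ; _≈_)
  open import Data.Fin.Properties
    using (_≟_; any?; suc-injective; punchOut-injective; <⇒notInjective; fromℕ<-injective;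
           toℕ-fromℕ<; toℕ-injective; toℕ-inject≤; toℕ<n)
  open import Data.Fin.Subset using (Subset; ⁅_⁆; ∣_∣; _⊆_; _∪_) renaming (_∈_ to _∈ˢ_)
  open import Data.Fin.Subset.Properties using (_∈?_; x∈⁅x⁆; x∈p∪q⁺)
  open import Data.List as List
    using (List; []; _∷_; _++_; allFin; cartesianProduct; cartesianProductWith; length; map; replicate; tabulate)
  import Data.List.Properties as List
  open import Data.List.Membership.Propositional using (_∈_; _∉_)
  open import Data.List.Membership.Propositional.Properties
    using (∈-allFin; ∈-cartesianProduct⁻; ∈-lookup; ∈-tabulate⁻)
  open import Data.List.Relation.Unary.All as All using (All; []; _∷_)
  import Data.List.Relation.Unary.All.Properties as All
  open import Data.List.Relation.Unary.AllPairs using (AllPairs; []; _∷_)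
  open import Data.List.Relation.Unary.Any as Any using (Any; here; there; _─_)
  import Data.List.Relation.Unary.Any.Properties as Any
  open import Data.Nat
    using (ℕ; zero; suc; _+_; _*_; _∸_; _^_; _!; _⊓_; ⌊_/2⌋; ⌈_/2⌉; _≤_; _<_; z≤n; s≤s; _≡ᵇ_; _≤ᵇ_; _<ᵇ_; _≤?_;
           NonZero; >-nonZero; >-nonZero⁻¹)
    renaming (_≟_ to _≟ℕ_)
  import Data.Nat.ListAction as ℕ
  open import Data.Nat.Properties hiding (_≟_; suc-injective)
  open import Data.Nat.Tactic.RingSolver using (solve-∀)
  open import Data.Product using (∃-syntax; Σ-syntax; _×_; _,_; proj₁; proj₂)
  open import Data.Sum using (_⊎_; inj₁; inj₂; [_,_]′)
  open import Data.Vec as Vec using (Vec; []; _∷_; lookup; _[_]≔_)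
  open import Data.Vec.Properties as Vec using (lookup∘update; lookup∘update′)
  open import Function using (_∘_; const; id; it; Equivalence)
  open import Relation.Binary.Definitions using (tri<; tri≈; tri>)
  open import Relation.Binary.PropositionalEquality hiding (J)
  open import Relation.Nullary using (¬_; Dec; does; yes; no)
  open import Relation.Nullary.Decidable using (_×-dec_; dec-true; dec-false)
  module Σ = MonoidSum +-0-commutativeMonoid

  -- Finite sums and Boolean subsets

  opaque
    sum : ∀ {n} → (Fin n → ℕ) → ℕ
    sum {zero}  f = 0
    sum {suc n} f = f zero + sum (f ∘ suc)

    sum-zero : (f : Fin 0 → ℕ) → sum f ≡ 0
    sum-zero f = refl

    sum-suc : ∀ {n} (f : Fin (suc n) → ℕ) → sum f ≡ f zero + sum (f ∘ suc)
    sum-suc f = refl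

    private
      sum-Σ : ∀ {n} (f : Fin n → ℕ) → sum f ≡ Σ.sum f
      sum-Σ {zero}  f = refl
      sum-Σ {suc n} f = cong (f zero +_) (sum-Σ (f ∘ suc))

    sum-cong-≗ : ∀ {n} {f g : Fin n → ℕ} → f ≗ g → sum f ≡ sum g
    sum-cong-≗ {zero}  p = refl
    sum-cong-≗ {suc n} p = cong₂ _+_ (p zero) (sum-cong-≗ (p ∘ suc))

    ∑-distrib-+ : ∀ {n} (f g : Fin n → ℕ) → sum (λ i → f i + g i) ≡ sum f + sum g
    ∑-distrib-+ f g = trans (sum-Σ (λ i → f i + g i)) (trans (Σ.∑-distrib-+ f g) (sym (cong₂ _+_ (sum-Σ f) (sum-Σ g))))

    ∑-comm : ∀ {m n} (f : Fin m → Fin n → ℕ) → sum (λ i → sum (f i)) ≡ sum (λ j → sum (λ i → f i j))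
    ∑-comm {m} {n} f = trans (double f) (trans (Σ.∑-comm f) (sym (double λ j i → f i j)))
      where
      double : ∀ {m n} (f : Fin m → Fin n → ℕ) → sum (λ i → sum (f i)) ≡ Σ.sum (λ i → Σ.sum (f i))
      double f = trans (sum-cong-≗ λ i → sum-Σ (f i)) (sum-Σ (λ i → Σ.sum (f i)))

    sum-permute : ∀ {n} (f : Fin n → ℕ) (π : Permutation′ n) → sum f ≡ sum (λ i → f (π ⟨$⟩ʳ i))
    sum-permute f π = trans (sum-Σ f) (trans (Σ.sum-permute f π) (sym (sum-Σ (λ i → f (π ⟨$⟩ʳ i)))))

    sum-mono : ∀ {n} {f g : Fin n → ℕ} → (∀ i → f i ≤ g i) → sum f ≤ sum g
    sum-mono {zero}  h = z≤n
    sum-mono {suc n} h = +-mono-≤ (h zero) (sum-mono (h ∘ suc))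

    sum-const : ∀ n c → sum {n} (const c) ≡ n * c
    sum-const zero    c = refl
    sum-const (suc n) c = cong (c +_) (sum-const n c)

    sum-*ˡ : ∀ {n} c (f : Fin n → ℕ) → sum (λ i → c * f i) ≡ c * sum f
    sum-*ˡ {zero}  c f = sym (*-zeroʳ c)
    sum-*ˡ {suc n} c f = trans (cong (c * f zero +_) (sum-*ˡ c (f ∘ suc))) (sym (*-distribˡ-+ c (f zero) _))

    sum-term : ∀ {n} (f : Fin n → ℕ) i → f i ≤ sum f
    sum-term f zero    = m≤m+n _ _
    sum-term f (suc i) = ≤-trans (sum-term (f ∘ suc) i) (m≤n+m _ _)

  sum-tail : ∀ {n} (f : Fin (suc n) → ℕ) → sum (f ∘ suc) ≤ sum f
  sum-tail f = ≤-trans (m≤n+m _ (f zero)) (≤-reflexive (sym (sum-suc f)))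

  sum≤⇒ : ∀ {n} {f g h : Fin n → ℕ} → (∀ i → f i ≤ g i + h i) → sum f ≤ sum g + sum h
  sum≤⇒ {g = g} {h} p = ≤-trans (sum-mono p) (≤-reflexive (∑-distrib-+ g h))

  Sub : ℕ → Set
  Sub m = Fin m → Bool

  infix 4 _⊑_
  infixr 6 _∪ˢ_
  infixr 7 _∩ˢ_ _∖ˢ_

  _∪ˢ_ _∩ˢ_ _∖ˢ_ : ∀ {m} → Sub m → Sub m → Sub m
  (f ∪ˢ g) e = f e ∨ g e
  (f ∩ˢ g) e = f e ∧ g e
  (f ∖ˢ g) e = f e ∧ not (g e)

  ∅ˢ : ∀ {m} → Sub m
  ∅ˢ _ = false

  [_]ˢ : ∀ {m} → Fin m → Sub m
  [ e ]ˢ x = does (e ≟ x)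

  add : ∀ {m} → Sub m → Fin m → Sub m
  add S e = S ∪ˢ [ e ]ˢ

  _⊑_ : ∀ {m} → Sub m → Sub m → Set
  f ⊑ g = ∀ e → f e ≡ true → g e ≡ true

  bit : Bool → ℕ
  bit true  = 1
  bit false = 0

  card : ∀ {m} → Sub m → ℕ
  card f = sum (bit ∘ f)

  ⊑-refl : ∀ {m} {f : Sub m} → f ⊑ f
  ⊑-refl _ p = p

  ⊑-trans : ∀ {m} {f g h : Sub m} → f ⊑ g → g ⊑ h → f ⊑ h
  ⊑-trans p q e = q e ∘ p e

  ∨-introˡ : ∀ {a} b → a ≡ true → a ∨ b ≡ true
  ∨-introˡ b refl = refl

  ∨-introʳ : ∀ a {b} → b ≡ true → a ∨ b ≡ true
  ∨-introʳ true  refl = refl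
  ∨-introʳ false refl = refl

  ∨-elim : ∀ a {b} → a ∨ b ≡ true → a ≡ true ⊎ b ≡ true
  ∨-elim true  p = inj₁ refl
  ∨-elim false p = inj₂ p

  ∧-intro : ∀ {a b} → a ≡ true → b ≡ true → a ∧ b ≡ true
  ∧-intro refl refl = refl

  ∧-elimˡ : ∀ a {b} → a ∧ b ≡ true → a ≡ true
  ∧-elimˡ true p = refl

  ∧-elimʳ : ∀ a {b} → a ∧ b ≡ true → b ≡ true
  ∧-elimʳ true p = p

  not-false : ∀ {a} → a ≡ false → not a ≡ true
  not-false refl = refl

  not-true : ∀ {a} → not a ≡ true → a ≡ false
  not-true {false} p = refl

  true≢false : ∀ {a} → a ≡ true → a ≡ false → ∀ {ℓ} {X : Set ℓ} → X
  true≢false refl ()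

  bool? : ∀ a → a ≡ true ⊎ a ≡ false
  bool? true  = inj₁ refl
  bool? false = inj₂ refl

  ≢true : ∀ {a} → (a ≡ true → ∀ {X : Set} → X) → a ≡ false
  ≢true {true}  h = h refl
  ≢true {false} h = refl

  bit-mono : ∀ {a b} → (a ≡ true → b ≡ true) → bit a ≤ bit b
  bit-mono {true}  h rewrite h refl = ≤-refl
  bit-mono {false} h = z≤n

  bit≤1 : ∀ a → bit a ≤ 1
  bit≤1 true  = ≤-refl
  bit≤1 false = z≤n

  card-mono : ∀ {m} {f g : Sub m} → f ⊑ g → card f ≤ card g
  card-mono p = sum-mono λ e → bit-mono (p e)

  card-cong : ∀ {m} {f g : Sub m} → f ≗ g → card f ≡ card g
  card-cong p = sum-cong-≗ (cong bit ∘ p)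

  card-∅ : ∀ m → card (∅ˢ {m}) ≡ 0
  card-∅ m = trans (sum-const m 0) (*-zeroʳ m)

  card-∪∩ : ∀ {m} (f g : Sub m) → card (f ∪ˢ g) + card (f ∩ˢ g) ≡ card f + card g
  card-∪∩ f g = trans (sym (∑-distrib-+ (bit ∘ (f ∪ˢ g)) (bit ∘ (f ∩ˢ g))))
    (trans (sum-cong-≗ λ e → lem (f e) (g e)) (∑-distrib-+ (bit ∘ f) (bit ∘ g)))
    where
    lem : ∀ a b → bit (a ∨ b) + bit (a ∧ b) ≡ bit a + bit b
    lem true  true  = refl
    lem true  false = refl
    lem false true  = refl
    lem false false = refl

  card-∪≤ : ∀ {m} (f g : Sub m) → card (f ∪ˢ g) ≤ card f + card g
  card-∪≤ f g = ≤-trans (m≤m+n _ _) (≤-reflexive (card-∪∩ f g))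

  card-cover : ∀ {m} {f g h : Sub m} → (∀ e → f e ≡ true → g e ≡ true ⊎ h e ≡ true) → card f ≤ card g + card h
  card-cover {f = f} {g} {h} p = ≤-trans (card-mono λ e q → lem e (p e q)) (card-∪≤ g h)
    where
    lem : ∀ e → g e ≡ true ⊎ h e ≡ true → g e ∨ h e ≡ true
    lem e (inj₁ x) = ∨-introˡ (h e) x
    lem e (inj₂ y) = ∨-introʳ (g e) y

  card-disjoint : ∀ {m} {f g : Sub m} → (∀ e → f e ≡ true → g e ≡ true → ∀ {X : Set} → X) →
                  card (f ∪ˢ g) ≡ card f + card g
  card-disjoint {m} {f} {g} p = trans (sym (+-identityʳ _))
    (trans (cong (card (f ∪ˢ g) +_) (sym zero-card)) (card-∪∩ f g))
    where
    lem : ∀ e → (f ∩ˢ g) e ≡ false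
    lem e = ≢true λ q → p e (∧-elimˡ (f e) q) (∧-elimʳ (f e) q)
    zero-card : card (f ∩ˢ g) ≡ 0
    zero-card = trans (card-cong lem) (card-∅ m)

  card-split : ∀ {m} (f g : Sub m) → card f ≡ card (f ∩ˢ g) + card (f ∖ˢ g)
  card-split f g = trans (sum-cong-≗ λ e → lem (f e) (g e))
                         (∑-distrib-+ (bit ∘ (f ∩ˢ g)) (bit ∘ (f ∖ˢ g)))
    where
    lem : ∀ a b → bit a ≡ bit (a ∧ b) + bit (a ∧ not b)
    lem true  true  = refl
    lem true  false = refl
    lem false b     = refl

  does-elim : ∀ {P : Set} (d : Dec P) → does d ≡ true → P
  does-elim (yes p) _ = p

  []-refl : ∀ {m} (e : Fin m) → [ e ]ˢ e ≡ true
  []-refl e = dec-true (e ≟ e) refl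

  []-elim : ∀ {m} (e x : Fin m) → [ e ]ˢ x ≡ true → e ≡ x
  []-elim e x p = does-elim (e ≟ x) p

  []-≢ : ∀ {m} {e x : Fin m} → e ≢ x → [ e ]ˢ x ≡ false
  []-≢ {e = e} {x} p = dec-false (e ≟ x) p

  card-[] : ∀ {m} (e : Fin m) → card [ e ]ˢ ≡ 1
  card-[] {suc m} zero    = trans (sum-suc _) (cong suc (card-∅ m))
  card-[] {suc m} (suc e) = trans (sum-suc _) (card-[] e)

  ∈-add : ∀ {m} (S : Sub m) e → add S e e ≡ true
  ∈-add S e = ∨-introʳ (S e) ([]-refl e)

  ⊑-add : ∀ {m} (S : Sub m) e → S ⊑ add S e
  ⊑-add S e x p = ∨-introˡ _ p

  add-elim : ∀ {m} (S : Sub m) e x → add S e x ≡ true → S x ≡ true ⊎ e ≡ x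
  add-elim S e x p with ∨-elim (S x) p
  ... | inj₁ q = inj₁ q
  ... | inj₂ q = inj₂ ([]-elim e x q)

  add-≢ : ∀ {m} (S : Sub m) {e x} → e ≢ x → add S e x ≡ S x
  add-≢ S {e} {x} p rewrite []-≢ p with S x
  ... | true  = refl
  ... | false = refl

  add-mono : ∀ {m} {S R : Sub m} e → S ⊑ R → add S e ⊑ add R e
  add-mono {S = S} {R} e p x q with add-elim S e x q
  ... | inj₁ r    = ∨-introˡ _ (p x r)
  ... | inj₂ refl = ∈-add R e

  add-⊑ : ∀ {m} {S R : Sub m} {e} → S ⊑ R → R e ≡ true → add S e ⊑ R
  add-⊑ {S = S} {e = e} p q x r with add-elim S e x r
  ... | inj₁ s    = p x s
  ... | inj₂ refl = q

  add-∈ : ∀ {m} {S : Sub m} {e} → S e ≡ true → add S e ⊑ S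
  add-∈ p = add-⊑ ⊑-refl p

  card-add : ∀ {m} (S : Sub m) e → S e ≡ false → card (add S e) ≡ suc (card S)
  card-add S e p = trans (card-disjoint {f = S} {[ e ]ˢ} λ x q r → true≢false (trans (cong S ([]-elim e x r)) q) p)
                         (trans (cong (card S +_) (card-[] e)) (+-comm _ 1))

  card-add≤ : ∀ {m} (S : Sub m) e → card (add S e) ≤ suc (card S)
  card-add≤ S e = ≤-trans (card-∪≤ S [ e ]ˢ) (≤-reflexive (trans (cong (card S +_) (card-[] e)) (+-comm _ 1)))

  ∪-⊑ : ∀ {m} {S R Q : Sub m} → S ⊑ Q → R ⊑ Q → S ∪ˢ R ⊑ Q
  ∪-⊑ {S = S} p q e r with ∨-elim (S e) r
  ... | inj₁ s = p e s
  ... | inj₂ s = q e s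

  ∪-mono : ∀ {m} {S R S′ R′ : Sub m} → S ⊑ S′ → R ⊑ R′ → S ∪ˢ R ⊑ S′ ∪ˢ R′
  ∪-mono {S = S} {R} {S′} {R′} p q e r with ∨-elim (S e) r
  ... | inj₁ s = ∨-introˡ _ (p e s)
  ... | inj₂ s = ∨-introʳ (S′ e) (q e s)

  ∪-l : ∀ {m} {S R : Sub m} → S ⊑ S ∪ˢ R
  ∪-l e = ∨-introˡ _

  ∪-r : ∀ {m} {S R : Sub m} → R ⊑ S ∪ˢ R
  ∪-r {S = S} e = ∨-introʳ (S e)

  ∩-l : ∀ {m} {S R : Sub m} → S ∩ˢ R ⊑ S
  ∩-l {S = S} e = ∧-elimˡ (S e)

  ∩-r : ∀ {m} {S R : Sub m} → S ∩ˢ R ⊑ R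
  ∩-r {S = S} e = ∧-elimʳ (S e)

  ∖-l : ∀ {m} {S R : Sub m} → S ∖ˢ R ⊑ S
  ∖-l {S = S} e = ∧-elimˡ (S e)

  greedy : ∀ {m} → (Sub m → Fin m → Bool) → List (Fin m) → Sub m → Sub m
  greedy ok []       S = S
  greedy ok (x ∷ xs) S = greedy ok xs (if ok S x then add S x else S)

  Antitone : ∀ {m} → (Sub m → Fin m → Bool) → Set
  Antitone ok = ∀ {S R} e → S ⊑ R → ok R e ≡ true → ok S e ≡ true

  module _ {m} (ok : Sub m → Fin m → Bool) where

    step-⊒ : ∀ S x → S ⊑ (if ok S x then add S x else S)
    step-⊒ S x with ok S x
    ... | true  = ⊑-add S x
    ... | false = ⊑-refl

    greedy-⊒ : ∀ xs S → S ⊑ greedy ok xs S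
    greedy-⊒ []       S = ⊑-refl
    greedy-⊒ (x ∷ xs) S = ⊑-trans (step-⊒ S x) (greedy-⊒ xs _)

    greedy-inv : ∀ (P : Sub m → Set) → (∀ S e → P S → ok S e ≡ true → P (add S e)) →
                 ∀ xs S → P S → P (greedy ok xs S)
    greedy-inv P h []       S p = p
    greedy-inv P h (x ∷ xs) S p with ok S x in eq
    ... | true  = greedy-inv P h xs _ (h S x p eq)
    ... | false = greedy-inv P h xs _ p

    -- By antitonicity, an element that the final set would still admit was admissible when the scan
    -- reached it, and so it was added then.
    greedy-max : Antitone ok → ∀ {xs S e} → e ∈ xs → ok (greedy ok xs S) e ≡ true → greedy ok xs S e ≡ true
    greedy-max anti {x ∷ xs} {S} (here refl) p
      with ok S x | anti x (⊑-trans (step-⊒ S x) (greedy-⊒ xs _)) p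
    ... | true  | _ = greedy-⊒ xs _ x (∈-add S x)
    greedy-max anti {x ∷ xs} {S} (there i) p = greedy-max anti i p

  -- Rank and closure

  card-⊑-≡ : ∀ {m} {f g : Sub m} → f ⊑ g → card g ≤ card f → g ⊑ f
  card-⊑-≡ {f = f} {g} p q e ge with bool? (f e)
  ... | inj₁ fe = fe
  ... | inj₂ fe = ⊥-elim (1+n≰n (≤-trans
    (≤-trans (≤-reflexive (sym (card-add f e fe))) (card-mono (add-⊑ {S = f} {g} p ge))) q))

  -- Subsets are Boolean functions, for which pointwise equality does not yield propositional
  -- equality; `ind-sub`, applied in both directions, makes `ind` respect it.
  record Mat (m : ℕ) : Set where
    field
      ind     : Sub m → Bool
      ind-∅   : ind ∅ˢ ≡ true
      ind-sub : ∀ {S R} → S ⊑ R → ind R ≡ true → ind S ≡ true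
      ind-aug : ∀ {S R} → ind S ≡ true → ind R ≡ true → card S < card R →
                ∃[ e ] R e ≡ true × S e ≡ false × ind (add S e) ≡ true

  module Rank {m} (M : Mat m) where
    open Mat M public

    extend : Sub m → Sub m → Sub m
    extend I S = greedy (λ B e → S e ∧ ind (add B e)) (allFin m) I

    extend-⊒ : ∀ I S → I ⊑ extend I S
    extend-⊒ I S = greedy-⊒ _ (allFin m) I

    extend-⊑ : ∀ {I S} → I ⊑ S → extend I S ⊑ S
    extend-⊑ {I} {S} p = greedy-inv _ (_⊑ S) (λ B e q r → add-⊑ {S = B} {S} q (∧-elimˡ (S e) r)) (allFin m) I p

    extend-ind : ∀ {I S} → ind I ≡ true → ind (extend I S) ≡ true
    extend-ind {I} {S} p = greedy-inv _ (λ B → ind B ≡ true) (λ B e q r → ∧-elimʳ (S e) r) (allFin m) I p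

    -- Otherwise augmentation finds an element of `K` that could still be added, and the scan would
    -- have taken it. So every independent starting set yields the same rank.
    extend-max : ∀ {I S K} → ind I ≡ true → ind K ≡ true → K ⊑ S → card K ≤ card (extend I S)
    extend-max {I} {S} {K} i k p = ≮⇒≥ λ lt → bad (ind-aug (extend-ind {I} {S} i) k lt)
      where
      bad : ¬ (∃[ e ] K e ≡ true × extend I S e ≡ false × ind (add (extend I S) e) ≡ true)
      bad (e , ke , je , a) = true≢false
        (greedy-max (λ B e → S e ∧ ind (add B e))
          (λ {B} {C} e q r → ∧-intro (∧-elimˡ (S e) r) (ind-sub (add-mono {S = B} {C} e q) (∧-elimʳ (S e) r)))
          (∈-allFin e) (∧-intro (p e ke) a)) je

    rk : Sub m → ℕ
    rk S = card (extend ∅ˢ S)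

    rk-≥ : ∀ {K S} → ind K ≡ true → K ⊑ S → card K ≤ rk S
    rk-≥ k p = extend-max ind-∅ k p

    extend-card : ∀ {I S} → ind I ≡ true → I ⊑ S → card (extend I S) ≡ rk S
    extend-card {I} {S} i p = ≤-antisym (rk-≥ (extend-ind {I} {S} i) (extend-⊑ p))
      (extend-max i (extend-ind {∅ˢ} {S} ind-∅) (extend-⊑ {∅ˢ} {S} λ _ ()))

    rk-mono : ∀ {S R} → S ⊑ R → rk S ≤ rk R
    rk-mono {S} p = rk-≥ (extend-ind {∅ˢ} {S} ind-∅) (⊑-trans (extend-⊑ {∅ˢ} {S} λ _ ()) p)

    rk≤card : ∀ S → rk S ≤ card S
    rk≤card S = card-mono (extend-⊑ {∅ˢ} {S} λ _ ())

    rk-ind : ∀ {S} → ind S ≡ true → rk S ≡ card S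
    rk-ind {S} i = ≤-antisym (rk≤card S) (rk-≥ i ⊑-refl)

    ind-rk : ∀ {S} → card S ≤ rk S → ind S ≡ true
    ind-rk {S} p = ind-sub (card-⊑-≡ (extend-⊑ {∅ˢ} {S} λ _ ()) p) (extend-ind {∅ˢ} {S} ind-∅)

    -- Extend a basis `I` of the intersection to a basis `J` of the union: the parts of `J` in `A`
    -- and in `B` are independent, cover `J` and both contain `I`.
    rk-submod : ∀ A B → rk (A ∪ˢ B) + rk (A ∩ˢ B) ≤ rk A + rk B
    rk-submod A B = begin
      rk (A ∪ˢ B) + rk (A ∩ˢ B)                ≡⟨ cong (_+ card I) (sym (extend-card iI I⊑)) ⟩
      card J + card I                          ≤⟨ +-monoʳ-≤ _ (card-mono λ e p → ∧-intro (I⊑J e p) (extend-⊑ {∅ˢ} {A ∩ˢ B} (λ _ ()) e p)) ⟩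
      card J + card (J ∩ˢ (A ∩ˢ B))            ≤⟨ +-mono-≤ (card-mono j∪) (card-mono j∩) ⟩
      card ((J ∩ˢ A) ∪ˢ (J ∩ˢ B)) + card ((J ∩ˢ A) ∩ˢ (J ∩ˢ B)) ≡⟨ card-∪∩ (J ∩ˢ A) (J ∩ˢ B) ⟩
      card (J ∩ˢ A) + card (J ∩ˢ B)            ≤⟨ +-mono-≤ (rk-≥ (ind-sub (∩-l {S = J} {A}) iJ) (∩-r {S = J} {A}))
                                                           (rk-≥ (ind-sub (∩-l {S = J} {B}) iJ) (∩-r {S = J} {B})) ⟩
      rk A + rk B                              ∎
      where
      open ≤-Reasoning
      I = extend ∅ˢ (A ∩ˢ B)
      iI : ind I ≡ true
      iI = extend-ind {∅ˢ} {A ∩ˢ B} ind-∅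
      I⊑ : I ⊑ A ∪ˢ B
      I⊑ e p = ∨-introˡ _ (∧-elimˡ (A e) (extend-⊑ {∅ˢ} {A ∩ˢ B} (λ _ ()) e p))
      J = extend I (A ∪ˢ B)
      iJ : ind J ≡ true
      iJ = extend-ind {I} {A ∪ˢ B} iI
      I⊑J : I ⊑ J
      I⊑J = extend-⊒ I (A ∪ˢ B)
      j∪ : J ⊑ (J ∩ˢ A) ∪ˢ (J ∩ˢ B)
      j∪ e p with ∨-elim (A e) (extend-⊑ {I} {A ∪ˢ B} I⊑ e p)
      ... | inj₁ a = ∨-introˡ _ (∧-intro p a)
      ... | inj₂ b = ∨-introʳ (J e ∧ A e) (∧-intro p b)
      j∩ : J ∩ˢ (A ∩ˢ B) ⊑ (J ∩ˢ A) ∩ˢ (J ∩ˢ B)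
      j∩ e p = ∧-intro (∧-intro (∧-elimˡ (J e) p) (∧-elimˡ (A e) (∧-elimʳ (J e) p)))
                       (∧-intro (∧-elimˡ (J e) p) (∧-elimʳ (A e) (∧-elimʳ (J e) p)))

    rk-∪≤ : ∀ A B → rk (A ∪ˢ B) ≤ rk A + card B
    rk-∪≤ A B = ≤-trans (m≤m+n _ _) (≤-trans (rk-submod A B) (+-monoʳ-≤ (rk A) (rk≤card B)))

    cl : Sub m → Sub m
    cl S e = does (rk (add S e) ≤? rk S)

    cl-intro : ∀ {S e} → rk (add S e) ≤ rk S → cl S e ≡ true
    cl-intro {S} {e} p = dec-true (rk (add S e) ≤? rk S) p

    cl-elim : ∀ S e → cl S e ≡ true → rk (add S e) ≤ rk S
    cl-elim S e p = does-elim (rk (add S e) ≤? rk S) p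

    cl-⊒ : ∀ S → S ⊑ cl S
    cl-⊒ S e p = cl-intro {S} {e} (rk-mono (add-∈ {S = S} p))

    cl-mono : ∀ {S R} → S ⊑ R → cl S ⊑ cl R
    cl-mono {S} {R} p e q = cl-intro {R} {e} (+-cancelʳ-≤ (rk S) _ _ (begin
      rk (add R e) + rk S                      ≤⟨ +-mono-≤ (rk-mono (λ x r → r1 x (add-elim R e x r))) (rk-mono λ x r → ∧-intro (p x r) (⊑-add S e x r)) ⟩
      rk (R ∪ˢ add S e) + rk (R ∩ˢ add S e)    ≤⟨ rk-submod R (add S e) ⟩
      rk R + rk (add S e)                      ≤⟨ +-monoʳ-≤ _ (cl-elim S e q) ⟩
      rk R + rk S                              ∎))
      where
      open ≤-Reasoning
      r1 : ∀ x → R x ≡ true ⊎ e ≡ x → (R ∪ˢ add S e) x ≡ true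
      r1 x (inj₁ s)    = ∨-introˡ _ s
      r1 x (inj₂ refl) = ∨-introʳ (R x) (∈-add S e)

    -- A larger rank would let a basis of `S` be augmented from `S ∪ˢ X`. An element of `S`
    -- contradicts maximality, one of `X` the definition of `cl`.
    cl-rk : ∀ {S X} → X ⊑ cl S → rk (S ∪ˢ X) ≤ rk S
    cl-rk {S} {X} p = ≮⇒≥ λ lt → bad (ind-aug iI iJ (≤-trans lt (≤-refl)))
      where
      I = extend ∅ˢ S
      J = extend ∅ˢ (S ∪ˢ X)
      iI : ind I ≡ true
      iI = extend-ind {∅ˢ} {S} ind-∅
      iJ : ind J ≡ true
      iJ = extend-ind {∅ˢ} {S ∪ˢ X} ind-∅
      I⊑S : I ⊑ S
      I⊑S = extend-⊑ {∅ˢ} {S} λ _ ()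
      big : ∀ {e R} → I e ≡ false → ind (add I e) ≡ true → add I e ⊑ R → suc (rk S) ≤ rk R
      big {e} i a q = ≤-trans (≤-reflexive (sym (card-add I e i))) (rk-≥ a q)
      bad : ¬ (∃[ e ] J e ≡ true × I e ≡ false × ind (add I e) ≡ true)
      bad (e , je , ie , a) with ∨-elim (S e) (extend-⊑ {∅ˢ} {S ∪ˢ X} (λ _ ()) e je)
      ... | inj₁ s = 1+n≰n (big ie a (add-⊑ {S = I} {S} I⊑S s))
      ... | inj₂ x = 1+n≰n (≤-trans (big ie a (add-mono {S = I} {S} e I⊑S)) (cl-elim S e (p e x)))

    cl-trans : ∀ {S R} → R ⊑ cl S → cl R ⊑ cl S
    cl-trans {S} {R} p e q = cl-intro {S} {e} (begin
      rk (add S e)          ≤⟨ rk-mono (add-mono {S = S} {S ∪ˢ R} e (∪-l {S = S} {R})) ⟩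
      rk (add (S ∪ˢ R) e)   ≤⟨ cl-elim (S ∪ˢ R) e (cl-mono (∪-r {S = S} {R}) e q) ⟩
      rk (S ∪ˢ R)           ≤⟨ cl-rk p ⟩
      rk S                  ∎)
      where open ≤-Reasoning

    ∉cl⇒ind : ∀ {S e} → ind S ≡ true → cl S e ≡ false → ind (add S e) ≡ true
    ∉cl⇒ind {S} {e} i c = ind-rk (≤-trans (card-add≤ S e)
      (≰⇒> λ p → true≢false (cl-intro {S} {e} (≤-trans p (≤-reflexive (sym (rk-ind i))))) c))

    dep⇒∈cl : ∀ {S e} → ind S ≡ true → ind (add S e) ≡ false → cl S e ≡ true
    dep⇒∈cl {S} {e} i d with bool? (cl S e)
    ... | inj₁ c = c
    ... | inj₂ c = true≢false (∉cl⇒ind {S} {e} i c) d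

    ind∧∈cl⇒∈ : ∀ {S e} → ind (add S e) ≡ true → cl S e ≡ true → S e ≡ true
    ind∧∈cl⇒∈ {S} {e} i c with bool? (S e)
    ... | inj₁ s = s
    ... | inj₂ s = ⊥-elim (1+n≰n (begin
      suc (card S)   ≡⟨ sym (card-add S e s) ⟩
      card (add S e) ≡⟨ sym (rk-ind i) ⟩
      rk (add S e)   ≤⟨ cl-elim S e c ⟩
      rk S           ≤⟨ rk≤card S ⟩
      card S         ∎))
      where open ≤-Reasoning

    -- Meant for independent Q, where the subtraction does not truncate.
    exc : Sub m → Sub m → ℕ
    exc S Q = rk (S ∪ˢ Q) ∸ card Q

    exc-eq : ∀ {S Q} → ind Q ≡ true → card Q + exc S Q ≡ rk (S ∪ˢ Q)
    exc-eq {S} {Q} i = m+[n∸m]≡n (rk-≥ i (∪-r {S = S} {Q}))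

    exc-mono : ∀ {S R} Q → S ⊑ R → exc S Q ≤ exc R Q
    exc-mono {S} {R} Q p = ∸-monoˡ-≤ (card Q) (rk-mono (∪-mono {S = S} {Q} p ⊑-refl))

    -- For independent `Q`, `exc S Q` is the rank of `S` after contracting `Q`. The rank of `S ∪ˢ Q`
    -- is submodular and the cardinality of `Q` modular.
    exc-submod : ∀ {S Q S′ Q′} → ind Q ≡ true → ind Q′ ≡ true → ind (Q ∪ˢ Q′) ≡ true →
      exc (S ∪ˢ S′) (Q ∪ˢ Q′) + exc (S ∩ˢ S′) (Q ∩ˢ Q′) ≤ exc S Q + exc S′ Q′
    exc-submod {S} {Q} {S′} {Q′} i i′ iu = +-cancelˡ-≤ (card Q + card Q′) _ _ (begin
      (card Q + card Q′) + (u + n)                ≡⟨ cong (_+ (u + n)) (sym (card-∪∩ Q Q′)) ⟩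
      (card (Q ∪ˢ Q′) + card (Q ∩ˢ Q′)) + (u + n) ≡⟨ swap (card (Q ∪ˢ Q′)) _ u n ⟩
      (card (Q ∪ˢ Q′) + u) + (card (Q ∩ˢ Q′) + n) ≡⟨ cong₂ _+_ (exc-eq {S ∪ˢ S′} iu) (exc-eq {S ∩ˢ S′} (ind-sub (∩-l {S = Q} {Q′}) i)) ⟩
      rk ((S ∪ˢ S′) ∪ˢ (Q ∪ˢ Q′)) + rk ((S ∩ˢ S′) ∪ˢ (Q ∩ˢ Q′)) ≤⟨ +-mono-≤ (rk-mono λ e → u1 (S e) (S′ e) (Q e) (Q′ e)) (rk-mono λ e → u2 (S e) (S′ e) (Q e) (Q′ e)) ⟩
      rk ((S ∪ˢ Q) ∪ˢ (S′ ∪ˢ Q′)) + rk ((S ∪ˢ Q) ∩ˢ (S′ ∪ˢ Q′)) ≤⟨ rk-submod (S ∪ˢ Q) (S′ ∪ˢ Q′) ⟩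
      rk (S ∪ˢ Q) + rk (S′ ∪ˢ Q′)                 ≡⟨ sym (cong₂ _+_ (exc-eq {S} i) (exc-eq {S′} i′)) ⟩
      (card Q + exc S Q) + (card Q′ + exc S′ Q′)  ≡⟨ swap (card Q) (exc S Q) (card Q′) (exc S′ Q′) ⟩
      (card Q + card Q′) + (exc S Q + exc S′ Q′)  ∎)
      where
      open ≤-Reasoning
      u = exc (S ∪ˢ S′) (Q ∪ˢ Q′)
      n = exc (S ∩ˢ S′) (Q ∩ˢ Q′)
      swap : ∀ a b c d → (a + b) + (c + d) ≡ (a + c) + (b + d)
      swap a b c d = trans (+-assoc a b _) (trans (cong (a +_) (trans (sym (+-assoc b c d)) (trans (cong (_+ d) (+-comm b c)) (+-assoc c b d)))) (sym (+-assoc a c _)))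
      u1 : ∀ a b c d → (a ∨ b) ∨ (c ∨ d) ≡ true → (a ∨ c) ∨ (b ∨ d) ≡ true
      u1 true  b     c     d p = refl
      u1 false b     true  d p = refl
      u1 false true  false d p = refl
      u1 false false false d p = p
      u2 : ∀ a b c d → (a ∧ b) ∨ (c ∧ d) ≡ true → (a ∨ c) ∧ (b ∨ d) ≡ true
      u2 true  true  c     d p = refl
      u2 true  false true  d p = p
      u2 false b     true  true p = ∨-introʳ b refl

    exc-∪ : ∀ {S Q S′ Q′} → ind Q ≡ true → ind Q′ ≡ true → ind (Q ∪ˢ Q′) ≡ true →
      exc (S ∪ˢ S′) (Q ∪ˢ Q′) ≤ exc S Q + exc S′ Q′
    exc-∪ {S} {Q} {S′} {Q′} i i′ iu = ≤-trans (m≤m+n _ _) (exc-submod {S} {Q} {S′} {Q′} i i′ iu)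

    exc-∩ : ∀ {S Q S′ Q′} → ind Q ≡ true → ind Q′ ≡ true → ind (Q ∪ˢ Q′) ≡ true →
      exc (S ∩ˢ S′) (Q ∩ˢ Q′) ≤ exc S Q + exc S′ Q′
    exc-∩ {S} {Q} {S′} {Q′} i i′ iu = ≤-trans (m≤n+m _ _) (exc-submod {S} {Q} {S′} {Q′} i i′ iu)

    -- The part of `X` outside `Q` is independent of `Q` yet spanned by `S ∪ˢ Q`, so `S` must supply
    -- that rank. This is how small waste forces nearly all of `X` into `Q`.
    exc-span : ∀ {S Q X} → ind (Q ∪ˢ X) ≡ true → X ⊑ cl (S ∪ˢ Q) → card (X ∖ˢ Q) ≤ exc S Q
    exc-span {S} {Q} {X} i p = +-cancelˡ-≤ (card Q) _ _ (begin
      card Q + card (X ∖ˢ Q)    ≡⟨ sym (card-disjoint {f = Q} {X ∖ˢ Q} λ e q r → true≢false q (not-true (∧-elimʳ (X e) r))) ⟩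
      card (Q ∪ˢ (X ∖ˢ Q))      ≤⟨ card-mono (∪-mono {S = Q} {X ∖ˢ Q} ⊑-refl (∖-l {S = X} {Q})) ⟩
      card (Q ∪ˢ X)             ≤⟨ rk-≥ i (∪-mono {S = Q} {X} (∪-r {S = S} {Q}) ⊑-refl) ⟩
      rk ((S ∪ˢ Q) ∪ˢ X)        ≤⟨ cl-rk p ⟩
      rk (S ∪ˢ Q)               ≡⟨ sym (exc-eq {S} (ind-sub (∪-l {S = Q} {X}) i)) ⟩
      card Q + exc S Q          ∎)
      where open ≤-Reasoning

  -- One level of replacements

  anyF : ∀ {n} → (Fin n → Bool) → Bool
  anyF {zero}  f = false
  anyF {suc n} f = f zero ∨ anyF (f ∘ suc)

  anyF-intro : ∀ {n} (f : Fin n → Bool) i → f i ≡ true → anyF f ≡ true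
  anyF-intro f zero    p = ∨-introˡ _ p
  anyF-intro f (suc i) p = ∨-introʳ (f zero) (anyF-intro (f ∘ suc) i p)

  anyF-elim : ∀ {n} (f : Fin n → Bool) → anyF f ≡ true → ∃[ i ] f i ≡ true
  anyF-elim {suc n} f p with ∨-elim (f zero) p
  ... | inj₁ q = zero , q
  ... | inj₂ q with anyF-elim (f ∘ suc) q
  ...   | i , r = suc i , r

  sum-bit≤ : ∀ {n} (f : Fin n → Bool) c → (∀ {i j} → f i ≡ true → f j ≡ true → i ≡ j) →
             (∀ i → f i ≡ true → 1 ≤ c) → sum (bit ∘ f) ≤ c
  sum-bit≤ {zero}  f c u p = ≤-trans (≤-reflexive (sum-zero (bit ∘ f))) z≤n
  sum-bit≤ {suc n} f c u p = ≤-trans (≤-reflexive (sum-suc (bit ∘ f))) (go (f zero) refl)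
    where
    go : ∀ b → f zero ≡ b → bit b + sum (bit ∘ f ∘ suc) ≤ c
    go false eq = sum-bit≤ (f ∘ suc) c (λ a b → suc-injective (u a b)) (p ∘ suc)
    go true  eq = ≤-trans (≤-reflexive (cong suc (trans (sum-cong-≗ {g = const 0} λ i → cong bit (none i)) (trans (sum-const n 0) (*-zeroʳ n))))) (p zero eq)
      where
      none : ∀ i → f (suc i) ≡ false
      none i with bool? (f (suc i))
      ... | inj₂ q = q
      ... | inj₁ q with u eq q
      ...   | ()

  sum-bit-not : ∀ {n} (f : Fin (suc n) → Bool) → (∀ {i j} → f i ≡ true → f j ≡ true → i ≡ j) →
                n ≤ sum (bit ∘ not ∘ f)
  sum-bit-not {n} f u = +-cancelˡ-≤ 1 _ _ (begin
    suc n                                     ≡⟨ sym (trans (sum-const (suc n) 1) (*-identityʳ _)) ⟩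
    sum {suc n} (const 1)                     ≡⟨ sum-cong-≗ (λ i → lem (f i)) ⟩
    sum (λ i → bit (f i) + bit (not (f i)))   ≡⟨ ∑-distrib-+ (bit ∘ f) (bit ∘ not ∘ f) ⟩
    sum (bit ∘ f) + sum (bit ∘ not ∘ f)       ≤⟨ +-monoˡ-≤ _ (sum-bit≤ f 1 u λ _ _ → ≤-refl) ⟩
    1 + sum (bit ∘ not ∘ f)                   ∎)
    where
    open ≤-Reasoning
    lem : ∀ a → 1 ≡ bit a + bit (not a)
    lem true  = refl
    lem false = refl

  card-sum : ∀ {n m} (f : Fin n → Sub m) → sum (λ i → card (f i)) ≡ sum (λ e → sum (λ i → bit (f i e)))
  card-sum {n} {m} f = ∑-comm {n} {m} (λ i e → bit (f i e))

  private
    xor1 : ∀ {d t} → d ≡ true → t ≡ false → d xor t ≡ true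
    xor1 refl refl = refl

    xor2 : ∀ {d t} → d ≡ false → t ≡ true → d xor t ≡ true
    xor2 refl refl = refl

    xor3 : ∀ {d t} → d ≡ true → t ≡ true → d xor t ≡ false
    xor3 refl refl = refl

  _⊕_ : ∀ {m} → Sub m → Sub m → Sub m
  (f ⊕ g) e = f e xor g e

  module Family {m q} (Ms : Fin (suc q) → Mat m) (O : Sub m) (Oind : ∀ i → Mat.ind (Ms i) O ≡ true) where

    module R (i : Fin (suc q)) = Rank (Ms i)
    open R public

    O-ind : ∀ i {Q} → Q ⊑ O → ind i Q ≡ true
    O-ind i p = ind-sub i p (Oind i)

    spanned : Sub m → Fin (suc q) → Sub m
    spanned T i = O ∩ˢ cl i T

    unspanned : Sub m → Sub m
    unspanned T e = O e ∧ not (anyF λ i → cl i T e)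

    record Partial (P : Fin (suc q) → Sub m) : Set where
      field
        P⊑O  : ∀ i → P i ⊑ O
        disj : ∀ {i j} e → P i e ≡ true → P j e ≡ true → i ≡ j

    excess : Sub m → (Fin (suc q) → Sub m) → ℕ
    excess S P = sum λ i → exc i S (P i)

    -- An element of `S ∩ˢ O` lies in at most one `P i`. In each of the `q` or more other matroids
    -- it is spanned without being charged, and `exc-span` counts it.
    excess-∩O : ∀ {S P} → Partial P → q * card (S ∩ˢ O) ≤ excess S P
    excess-∩O {S} {P} pp = begin
      q * card (S ∩ˢ O)                                ≡⟨ sym (sum-*ˡ q (bit ∘ (S ∩ˢ O))) ⟩
      sum (λ e → q * bit ((S ∩ˢ O) e))                 ≤⟨ sum-mono (λ e → point e) ⟩
      sum (λ e → sum (λ i → bit (((S ∩ˢ O) ∖ˢ P i) e))) ≡⟨ sym (card-sum λ i → (S ∩ˢ O) ∖ˢ P i) ⟩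
      sum (λ i → card ((S ∩ˢ O) ∖ˢ P i))               ≤⟨ sum-mono (λ i → exc-span i {S} {P i} {S ∩ˢ O} (O-ind i (∪-⊑ {S = P i} {S ∩ˢ O} (P⊑O i) (∩-r {S = S} {O})))
                                                          λ e x → cl-⊒ i (S ∪ˢ P i) e (∨-introˡ _ (∧-elimˡ (S e) x))) ⟩
      excess S P                                       ∎
      where
      open ≤-Reasoning
      open Partial pp
      point : ∀ e → q * bit ((S ∩ˢ O) e) ≤ sum (λ i → bit (((S ∩ˢ O) ∖ˢ P i) e))
      point e with (S ∩ˢ O) e
      ... | true  = ≤-trans (≤-reflexive (*-identityʳ q)) (sum-bit-not (λ i → P i e) (disj e))
      ... | false = ≤-trans (≤-reflexive (*-zeroʳ q)) z≤n

    -- For independent `T` it vanishes exactly if O contains a basis of the span of `T` in every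
    -- matroid.
    deficit : Sub m → ℕ
    deficit T = sum λ i → card T ∸ card (spanned T i)

    spanned-card : ∀ {T} i → card (spanned T i) ≤ card T
    spanned-card {T} i = begin
      card (spanned T i)         ≤⟨ rk-≥ i (O-ind i (∩-l {S = O} {cl i T})) (∪-r {S = T} {spanned T i}) ⟩
      rk i (T ∪ˢ spanned T i)    ≤⟨ cl-rk i (∩-r {S = O} {cl i T}) ⟩
      rk i T                     ≤⟨ rk≤card i T ⟩
      card T                     ∎
      where open ≤-Reasoning

    exc-spanned : ∀ T i → exc i T (spanned T i) ≤ card T ∸ card (spanned T i)
    exc-spanned T i = ∸-monoˡ-≤ (card (spanned T i)) (≤-trans (cl-rk i (∩-r {S = O} {cl i T})) (rk≤card i T))

    exc-more : ∀ i {S S′ X} Q → S ⊑ S′ ∪ˢ X → ind i Q ≡ true → exc i S Q ≤ exc i S′ Q + card X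
    exc-more i {S} {S′} {X} Q p iq = +-cancelˡ-≤ (card Q) _ _ (begin
      card Q + exc i S Q              ≡⟨ exc-eq i {S} iq ⟩
      rk i (S ∪ˢ Q)                   ≤⟨ rk-mono i (λ e r → lem e (∨-elim (S e) r)) ⟩
      rk i ((S′ ∪ˢ Q) ∪ˢ X)           ≤⟨ rk-∪≤ i (S′ ∪ˢ Q) X ⟩
      rk i (S′ ∪ˢ Q) + card X         ≡⟨ cong (_+ card X) (sym (exc-eq i {S′} iq)) ⟩
      card Q + exc i S′ Q + card X    ≡⟨ +-assoc (card Q) _ _ ⟩
      card Q + (exc i S′ Q + card X)  ∎)
      where
      open ≤-Reasoning
      lem : ∀ e → S e ≡ true ⊎ Q e ≡ true → ((S′ ∪ˢ Q) ∪ˢ X) e ≡ true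
      lem e (inj₂ y) = ∨-introˡ _ (∨-introʳ (S′ e) y)
      lem e (inj₁ y) with ∨-elim (S′ e) (p e y)
      ... | inj₁ z = ∨-introˡ _ (∨-introˡ _ z)
      ... | inj₂ z = ∨-introʳ ((S′ ∪ˢ Q) e) z

  -- The replacement V of T is filled into the slots of matroid `zero` freed by
  -- the coin set d; `S d` is the resulting solution and `P d` any assignment of
  -- part of O to the matroids.
  module Level {m q} (Ms : Fin (suc q) → Mat m) (O : Sub m) (Oind : ∀ i → Mat.ind (Ms i) O ≡ true)
    (T V : Sub m)
    (T-ind : ∀ i → Mat.ind (Ms i) T ≡ true)
    (V-ind : Mat.ind (Ms zero) V ≡ true)
    (V⊑cl  : V ⊑ Rank.cl (Ms zero) T)
    (TV-ind : ∀ j → Mat.ind (Ms (suc j)) (T ∪ˢ V) ≡ true)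
    (TV-disj : ∀ e → T e ≡ true → V e ≡ true → ∀ {X : Set} → X)
    (S : Sub m → Sub m)
    (S-kept : ∀ d → T ∖ˢ d ⊑ S d)
    (S-sub : ∀ d → S d ⊑ (T ∖ˢ d) ∪ˢ V)
    (S-ind : ∀ d → Mat.ind (Ms zero) (S d) ≡ true)
    (S-span : ∀ d → V ⊑ Rank.cl (Ms zero) (S d))
    (S-mono : ∀ {d d′} → T ∖ˢ d ⊑ T ∖ˢ d′ → S d′ ∩ˢ V ⊑ S d)
    (P : Sub m → Fin (suc q) → Sub m)
    (P-part : ∀ d → Family.Partial Ms O Oind (P d))
    where

    open Family Ms O Oind
    module Pt d = Partial (P-part d)

    B T₀ T₁ : Sub m
    B  = extend zero V (V ∪ˢ T)
    T₀ = B ∩ˢ T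
    T₁ = T ∖ˢ T₀

    B⊑ : B ⊑ V ∪ˢ T
    B⊑ = extend-⊑ zero {V} {V ∪ˢ T} (∪-l {S = V} {T})

    card-B : card B ≡ card T
    card-B = ≤-antisym
      (≤-trans (≤-reflexive (extend-card zero V-ind (∪-l {S = V} {T})))
        (≤-trans (rk-mono zero λ e p → subst (_≡ true) (∨-comm (V e) (T e)) p)
          (≤-trans (cl-rk zero V⊑cl) (rk≤card zero T))))
      (extend-max zero V-ind (T-ind zero) (∪-r {S = V} {T}))

    card-V≤ : card V ≤ card T₁
    card-V≤ = +-cancelʳ-≤ (card T₀) _ _ (begin
      card V + card T₀       ≡⟨ sym (card-disjoint {f = V} {T₀} λ e p r → TV-disj e (∧-elimʳ (B e) r) p) ⟩
      card (V ∪ˢ T₀)         ≤⟨ card-mono (∪-⊑ {S = V} {T₀} (extend-⊒ zero V (V ∪ˢ T)) (∩-l {S = B} {T})) ⟩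
      card B                 ≡⟨ card-B ⟩
      card T                 ≡⟨ card-split T T₀ ⟩
      card (T ∩ˢ T₀) + card T₁ ≤⟨ +-monoˡ-≤ _ (card-mono (∩-r {S = T} {T₀})) ⟩
      card T₀ + card T₁      ≡⟨ +-comm (card T₀) _ ⟩
      card T₁ + card T₀      ∎)
      where open ≤-Reasoning

    T⊑clB : T ⊑ cl zero (V ∪ˢ T₀)
    T⊑clB e p = cl-mono zero lem e (cl-intro zero {B} {e} (≤-trans (rk-mono zero (add-⊑ {S = B} {V ∪ˢ T} B⊑ (∨-introʳ (V e) p)))
      (≤-reflexive (trans (sym (extend-card zero V-ind (∪-l {S = V} {T}))) (sym (rk-ind zero (extend-ind zero {V} {V ∪ˢ T} V-ind)))))))
      where
      lem : B ⊑ V ∪ˢ T₀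
      lem x r with ∨-elim (V x) (B⊑ x r)
      ... | inj₁ v = ∨-introˡ _ v
      ... | inj₂ t = ∨-introʳ (V x) (∧-intro r t)

    spans-T : ∀ {R} → V ⊑ cl zero R → T₀ ⊑ R → T ⊑ cl zero R
    spans-T {R} p r e t = cl-trans zero (∪-⊑ {S = V} {T₀} p (⊑-trans r (cl-⊒ zero R))) e (T⊑clB e t)

    -- V ∪ (T ∖ d) still spans T in matroid `zero`, as T₀ is kept.
    refill : ∀ d → d ⊑ T₁ → card d ≤ card (S d ∩ˢ V)
    refill d p = +-cancelˡ-≤ (card (T ∖ˢ d)) _ _ (begin
      card (T ∖ˢ d) + card d            ≤⟨ +-monoʳ-≤ _ (card-mono λ e r → ∧-intro (∖-l {S = T} {T₀} e (p e r)) r) ⟩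
      card (T ∖ˢ d) + card (T ∩ˢ d)     ≡⟨ trans (+-comm (card (T ∖ˢ d)) _) (sym (card-split T d)) ⟩
      card T                            ≡⟨ sym (rk-ind zero (T-ind zero)) ⟩
      rk zero T                         ≤⟨ rk-mono zero (∪-r {S = S d} {T}) ⟩
      rk zero (S d ∪ˢ T)                ≤⟨ cl-rk zero (spans-T (S-span d) λ e r → S-kept d e (∧-intro (∧-elimʳ (B e) r) (not-false (out e r)))) ⟩
      rk zero (S d)                     ≤⟨ rk≤card zero (S d) ⟩
      card (S d)                        ≤⟨ card-cover {g = T ∖ˢ d} {S d ∩ˢ V} (λ e r → cov e r (∨-elim ((T ∖ˢ d) e) (S-sub d e r))) ⟩
      card (T ∖ˢ d) + card (S d ∩ˢ V)   ∎)
      where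
      open ≤-Reasoning
      out : ∀ e → T₀ e ≡ true → d e ≡ false
      out e r = ≢true λ s → true≢false r (not-true (∧-elimʳ (T e) (p e s)))
      cov : ∀ e → S d e ≡ true → (T ∖ˢ d) e ≡ true ⊎ V e ≡ true → (T ∖ˢ d) e ≡ true ⊎ (S d ∩ˢ V) e ≡ true
      cov e r (inj₁ x) = inj₁ x
      cov e r (inj₂ x) = inj₂ (∧-intro r x)

    -- `c` is contained in `d₁` and `d₂`, and `c′` in `d₃` and `d₄`. As dropping more never refills
    -- less, `N` lies in both solutions of the first pair and `N′` in both of the second. So
    -- intersections of solutions retain the replacements, while unions recover `T₀` or all of `T`.
    module Four (d : Sub m) where

      d₁ d₂ d₃ d₄ c c′ N N′ : Sub m
      d₁ = d
      d₂ = d ⊕ T₀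
      d₃ = d ⊕ T₁
      d₄ = d ⊕ T
      c  = d ∩ˢ T₁
      c′ = T₁ ∖ˢ d
      N  = S c ∩ˢ V
      N′ = S c′ ∩ˢ V

      ω : Sub m → ℕ
      ω x = excess (S x) (P x)

      s η α : ℕ
      s = ω d₁ + ω d₂ + (ω d₃ + ω d₄)
      η = card (N ∩ˢ N′)
      α = card (unspanned T)

      private
        less : ∀ {x y} → x ⊑ y → T ∖ˢ y ⊑ T ∖ˢ x
        less {x} {y} p e r = ∧-intro (∧-elimˡ (T e) r)
          (not-false (≢true λ t → true≢false (p e t) (not-true (∧-elimʳ (T e) r))))

        T₁∌T₀ : ∀ e → T₁ e ≡ true → T₀ e ≡ false
        T₁∌T₀ e p = not-true (∧-elimʳ (T e) p)

        c⊑d₁ : c ⊑ d₁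
        c⊑d₁ e p = ∧-elimˡ (d e) p
        c⊑d₂ : c ⊑ d₂
        c⊑d₂ e p = xor1 (∧-elimˡ (d e) p) (T₁∌T₀ e (∧-elimʳ (d e) p))
        c′⊑d₃ : c′ ⊑ d₃
        c′⊑d₃ e p = xor2 (not-true (∧-elimʳ (T₁ e) p)) (∧-elimˡ (T₁ e) p)
        c′⊑d₄ : c′ ⊑ d₄
        c′⊑d₄ e p = xor2 (not-true (∧-elimʳ (T₁ e) p)) (∧-elimˡ (T e) (∧-elimˡ (T₁ e) p))

        N⊑ : N ⊑ S d₁ ∩ˢ S d₂
        N⊑ e p = ∧-intro (S-mono (less c⊑d₁) e p) (S-mono (less c⊑d₂) e p)
        N′⊑ : N′ ⊑ S d₃ ∩ˢ S d₄
        N′⊑ e p = ∧-intro (S-mono (less c′⊑d₃) e p) (S-mono (less c′⊑d₄) e p)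

        T₀-in : ∀ x y → (∀ e → T₀ e ≡ true → x e ≡ true → y e ≡ false) → T₀ ⊑ S x ∪ˢ S y
        T₀-in x y h e t with bool? (x e)
        ... | inj₂ r = ∨-introˡ _ (S-kept x e (∧-intro (∧-elimʳ (B e) t) (not-false r)))
        ... | inj₁ r = ∨-introʳ (S x e) (S-kept y e (∧-intro (∧-elimʳ (B e) t) (not-false (h e t r))))

        T₀∌T₁ : ∀ e → T₀ e ≡ true → T₁ e ≡ false
        T₀∌T₁ e t = ≢true λ r → true≢false t (T₁∌T₀ e r)

        h₁₂ : T₀ ⊑ S d₁ ∪ˢ S d₂
        h₁₂ = T₀-in d₁ d₂ λ e t x → xor3 x t
        h₃₄ : T₀ ⊑ S d₃ ∪ˢ S d₄
        h₃₄ = T₀-in d₃ d₄ λ e t x → xor3 (back (d e) x (T₀∌T₁ e t)) (∧-elimʳ (B e) t)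
          where
          back : ∀ a {b} → a xor b ≡ true → b ≡ false → a ≡ true
          back true  p q = refl
          back false p q = true≢false p q

        T⊑₁₄ : T ⊑ S d₁ ∪ˢ S d₄
        T⊑₁₄ e t with bool? (d e)
        ... | inj₂ r = ∨-introˡ _ (S-kept d₁ e (∧-intro t (not-false r)))
        ... | inj₁ r = ∨-introʳ (S d₁ e) (S-kept d₄ e (∧-intro t (not-false (xor3 r t))))

        P∪⊑ : ∀ x y i → P x i ∪ˢ P y i ⊑ O
        P∪⊑ x y i = ∪-⊑ {S = P x i} {P y i} (Pt.P⊑O x i) (Pt.P⊑O y i)

        P∩⊑ : ∀ x y i → P x i ∩ˢ P y i ⊑ O
        P∩⊑ x y i = ⊑-trans (∩-l {S = P x i} {P y i}) (Pt.P⊑O x i)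

        pair-∪ : ∀ x y i → exc i (S x ∪ˢ S y) (P x i ∪ˢ P y i) ≤ exc i (S x) (P x i) + exc i (S y) (P y i)
        pair-∪ x y i = exc-∪ i {S x} {P x i} {S y} {P y i} (O-ind i (Pt.P⊑O x i)) (O-ind i (Pt.P⊑O y i)) (O-ind i (P∪⊑ x y i))

        pair-∩ : ∀ x y i → exc i (S x ∩ˢ S y) (P x i ∩ˢ P y i) ≤ exc i (S x) (P x i) + exc i (S y) (P y i)
        pair-∩ x y i = exc-∩ i {S x} {P x i} {S y} {P y i} (O-ind i (Pt.P⊑O x i)) (O-ind i (Pt.P⊑O y i)) (O-ind i (P∪⊑ x y i))

        sum-pair : ∀ x y → sum (λ i → exc i (S x) (P x i) + exc i (S y) (P y i)) ≡ ω x + ω y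
        sum-pair x y = ∑-distrib-+ (λ i → exc i (S x) (P x i)) (λ i → exc i (S y) (P y i))

        -- The united solutions span `T`, hence all of `spanned T i`; what the two assignments leave
        -- uncharged of it is paid for by their waste.
        missed : ∀ x y i → T ⊑ cl i (S x ∪ˢ S y) →
                 card (spanned T i ∖ˢ (P x i ∪ˢ P y i)) ≤ exc i (S x) (P x i) + exc i (S y) (P y i)
        missed x y i h = ≤-trans
          (exc-span i {S x ∪ˢ S y} {P x i ∪ˢ P y i} {spanned T i}
            (O-ind i (∪-⊑ {S = P x i ∪ˢ P y i} {spanned T i} (P∪⊑ x y i) (∩-l {S = O} {cl i T})))
            (λ e p → cl-mono i (∪-l {S = S x ∪ˢ S y}) e (cl-trans i h e (∧-elimʳ (O e) p))))
          (pair-∪ x y i)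

      H K : Fin (suc q) → Sub m
      H i = (P d₁ i ∩ˢ P d₂ i) ∪ˢ (P d₃ i ∩ˢ P d₄ i)
      K i = P d₁ i ∩ˢ P d₄ i

      H⊑O : ∀ i → H i ⊑ O
      H⊑O i = ∪-⊑ {S = P d₁ i ∩ˢ P d₂ i} (P∩⊑ d₁ d₂ i) (P∩⊑ d₃ d₄ i)

      ⋃H : Sub m
      ⋃H e = anyF λ j → H (suc j) e

      private
        nf : ∀ x y j e → (P x (suc j) ∩ˢ P y (suc j)) e ≡ true → spanned T zero e ≡ true →
             (spanned T zero ∖ˢ (P x zero ∪ˢ P y zero)) e ≡ true
        nf x y j e p o = ∧-intro o (not-false (≢true λ r → bad (∨-elim (P x zero e) r)))
          where
          bad : P x zero e ≡ true ⊎ P y zero e ≡ true → ∀ {X : Set} → X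
          bad (inj₁ u) with Pt.disj x e u (∧-elimˡ (P x (suc j) e) p)
          ... | ()
          bad (inj₂ u) with Pt.disj y e u (∧-elimʳ (P x (suc j) e) p)
          ... | ()

      -- `d₁` and `d₂` differ on all of `T₀`, so their solutions together contain `T₀` and span `V`,
      -- hence `T`, in `zero`; likewise `d₃` and `d₄`. An element that both assignments of a pair
      -- charge to the same `suc j` is charged to `zero` by neither, and `missed` pays for it.
      H-avoids : card (spanned T zero ∩ˢ ⋃H) ≤ s
      H-avoids = ≤-trans (card-cover {g = spanned T zero ∖ˢ (P d₁ zero ∪ˢ P d₂ zero)}
                                     {spanned T zero ∖ˢ (P d₃ zero ∪ˢ P d₄ zero)} cov)
        (+-mono-≤ (≤-trans (missed d₁ d₂ zero (spans-T (⊑-trans (S-span d₁) (cl-mono zero (∪-l {S = S d₁}))) h₁₂)) (part d₁ d₂))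
                  (≤-trans (missed d₃ d₄ zero (spans-T (⊑-trans (S-span d₃) (cl-mono zero (∪-l {S = S d₃}))) h₃₄)) (part d₃ d₄)))
        where
        part : ∀ x y → exc zero (S x) (P x zero) + exc zero (S y) (P y zero) ≤ ω x + ω y
        part x y = +-mono-≤ (sum-term (λ i → exc i (S x) (P x i)) zero) (sum-term (λ i → exc i (S y) (P y i)) zero)
        cov : ∀ e → (spanned T zero ∩ˢ ⋃H) e ≡ true →
              (spanned T zero ∖ˢ (P d₁ zero ∪ˢ P d₂ zero)) e ≡ true ⊎ (spanned T zero ∖ˢ (P d₃ zero ∪ˢ P d₄ zero)) e ≡ true
        cov e p with anyF-elim (λ j → H (suc j) e) (∧-elimʳ (spanned T zero e) p)
        ... | j , r with ∨-elim ((P d₁ (suc j) ∩ˢ P d₂ (suc j)) e) r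
        ...   | inj₁ u = inj₁ (nf d₁ d₂ j e u (∧-elimˡ (spanned T zero e) p))
        ...   | inj₂ u = inj₂ (nf d₃ d₄ j e u (∧-elimˡ (spanned T zero e) p))

      private
        disj-NN : card V ≤ card N + card N′
        disj-NN = begin
          card V                       ≤⟨ card-V≤ ⟩
          card T₁                      ≡⟨ card-split T₁ d ⟩
          card (T₁ ∩ˢ d) + card c′     ≤⟨ +-monoˡ-≤ _ (card-mono λ e p → ∧-intro (∧-elimʳ (T₁ e) p) (∧-elimˡ (T₁ e) p)) ⟩
          card c + card c′             ≤⟨ +-mono-≤ (refill c (∩-r {S = d} {T₁})) (refill c′ (∖-l {S = T₁} {d})) ⟩
          card N + card N′             ∎
          where open ≤-Reasoning

      -- `N` and `N′` refill in total at least as many slots as `T₁` has, and `V` is no larger than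
      -- `T₁`. So what they miss of `V` is made up for by their overlap.
      leftover : card (V ∖ˢ (N ∪ˢ N′)) ≤ η
      leftover = +-cancelˡ-≤ (card (N ∪ˢ N′)) _ _ (begin
        card (N ∪ˢ N′) + card (V ∖ˢ (N ∪ˢ N′))        ≤⟨ +-monoˡ-≤ _ (card-mono λ e p → ∧-intro (NN⊑V e p) p) ⟩
        card (V ∩ˢ (N ∪ˢ N′)) + card (V ∖ˢ (N ∪ˢ N′)) ≡⟨ sym (card-split V (N ∪ˢ N′)) ⟩
        card V                                        ≤⟨ disj-NN ⟩
        card N + card N′                              ≡⟨ sym (card-∪∩ N N′) ⟩
        card (N ∪ˢ N′) + η                            ∎)
        where
        open ≤-Reasoning
        NN⊑V : N ∪ˢ N′ ⊑ V
        NN⊑V = ∪-⊑ {S = N} {N′} (∩-r {S = S c} {V}) (∩-r {S = S c′} {V})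

      private
        -- `T ∪ˢ (N ∩ˢ N′)` is independent in `suc j`, so its rank exceeds |T| by `η`. Contracting
        -- `spanned T` and `K` leaves only the part of |T| beyond `spanned T` and the waste of `d₁`
        -- and `d₄`; the surplus must come from elements of `K` outside `spanned T`.
        overlap-one : ∀ j → η ≤ card (K (suc j) ∖ˢ spanned T (suc j)) + (exc (suc j) (S d₁) (P d₁ (suc j)) + exc (suc j) (S d₄) (P d₄ (suc j)))
        overlap-one j = +-cancelˡ-≤ (card T) _ _ (begin
          card T + η                                ≡⟨ sym (card-disjoint {f = T} {N ∩ˢ N′} λ e t r → TV-disj e t (∧-elimʳ (S c e) (∧-elimˡ (N e) r))) ⟩
          card (T ∪ˢ (N ∩ˢ N′))                     ≤⟨ rk-≥ i (ind-sub i (∪-mono {S = T} {N ∩ˢ N′} ⊑-refl (λ e r → ∧-elimʳ (S c e) (∧-elimˡ (N e) r))) (TV-ind j)) (∪-l {S = T ∪ˢ (N ∩ˢ N′)}) ⟩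
          rk i ((T ∪ˢ (N ∩ˢ N′)) ∪ˢ (Oi ∪ˢ K i))    ≡⟨ sym (exc-eq i {T ∪ˢ (N ∩ˢ N′)} (O-ind i OK⊑)) ⟩
          card (Oi ∪ˢ K i) + exc i (T ∪ˢ (N ∩ˢ N′)) (Oi ∪ˢ K i)
            ≤⟨ +-mono-≤ (card-cover {g = Oi} {K i ∖ˢ Oi} (λ e r → sp e (∨-elim (Oi e) r)))
                 (≤-trans (exc-∪ i {T} {Oi} {N ∩ˢ N′} {K i} (O-ind i O⊑) (O-ind i (P∩⊑ d₁ d₄ i)) (O-ind i OK⊑))
                   (+-mono-≤ (exc-spanned T i) (≤-trans (exc-mono i (K i) NN⊑) (pair-∩ d₁ d₄ i)))) ⟩
          (card Oi + card (K i ∖ˢ Oi)) + ((card T ∸ card Oi) + w)  ≡⟨ rearr (card Oi) _ (card T ∸ card Oi) w ⟩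
          (card Oi + (card T ∸ card Oi)) + (card (K i ∖ˢ Oi) + w)  ≡⟨ cong (_+ (card (K i ∖ˢ Oi) + w)) (m+[n∸m]≡n (spanned-card {T} i)) ⟩
          card T + (card (K i ∖ˢ Oi) + w)           ∎)
          where
          open ≤-Reasoning
          i = suc j
          Oi = spanned T i
          w = exc i (S d₁) (P d₁ i) + exc i (S d₄) (P d₄ i)
          O⊑ : Oi ⊑ O
          O⊑ = ∩-l {S = O} {cl i T}
          OK⊑ : Oi ∪ˢ K i ⊑ O
          OK⊑ = ∪-⊑ {S = Oi} {K i} O⊑ (P∩⊑ d₁ d₄ i)
          NN⊑ : N ∩ˢ N′ ⊑ S d₁ ∩ˢ S d₄
          NN⊑ e r = ∧-intro (∧-elimˡ (S d₁ e) (N⊑ e (∧-elimˡ (N e) r))) (∧-elimʳ (S d₃ e) (N′⊑ e (∧-elimʳ (N e) r)))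
          sp : ∀ e → Oi e ≡ true ⊎ K i e ≡ true → Oi e ≡ true ⊎ (K i ∖ˢ Oi) e ≡ true
          sp e (inj₁ x) = inj₁ x
          sp e (inj₂ x) with bool? (Oi e)
          ... | inj₁ y = inj₁ y
          ... | inj₂ y = inj₂ (∧-intro x (not-false y))
          rearr : ∀ a b c d → (a + b) + (c + d) ≡ (a + c) + (b + d)
          rearr = solve-∀

        -- Both `d₁` and `d₄` charge an element of `K (suc j)` to `suc j`. If `T` spans it, but not
        -- there, then it does so in a matroid to which neither charges it. Since the two solutions
        -- together contain `T`, `missed` applies.
        stray : sum (λ j → card (K (suc j) ∖ˢ spanned T (suc j))) ≤ α + (ω d₁ + ω d₄)
        stray = begin
          sum (λ j → card (K (suc j) ∖ˢ spanned T (suc j)))                        ≡⟨ card-sum (λ j → K (suc j) ∖ˢ spanned T (suc j)) ⟩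
          sum (λ e → sum (λ j → bit ((K (suc j) ∖ˢ spanned T (suc j)) e)))         ≤⟨ sum-mono point ⟩
          sum (λ e → bit (unspanned T e) + sum (λ i → bit (L i e)))                ≡⟨ ∑-distrib-+ (bit ∘ unspanned T) (λ e → sum (λ i → bit (L i e))) ⟩
          α + sum (λ e → sum (λ i → bit (L i e)))                                  ≡⟨ cong (α +_) (sym (card-sum L)) ⟩
          α + sum (λ i → card (L i))                                               ≤⟨ +-monoʳ-≤ α (sum-mono λ i → missed d₁ d₄ i (⊑-trans T⊑₁₄ (cl-⊒ i _))) ⟩
          α + sum (λ i → exc i (S d₁) (P d₁ i) + exc i (S d₄) (P d₄ i))            ≡⟨ cong (α +_) (sum-pair d₁ d₄) ⟩
          α + (ω d₁ + ω d₄)                                                        ∎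
          where
          open ≤-Reasoning
          L : Fin (suc q) → Sub m
          L i = spanned T i ∖ˢ (P d₁ i ∪ˢ P d₄ i)
          point : ∀ e → sum (λ j → bit ((K (suc j) ∖ˢ spanned T (suc j)) e)) ≤ bit (unspanned T e) + sum (λ i → bit (L i e))
          point e = sum-bit≤ (λ j → (K (suc j) ∖ˢ spanned T (suc j)) e) _
            (λ {i} {j} x y → suc-injective (Pt.disj d₁ e (in₁ i x) (in₁ j y)))
            (λ j x → one j x (bool? (anyF λ i → cl i T e)))
            where
            in₁ : ∀ j → (K (suc j) ∖ˢ spanned T (suc j)) e ≡ true → P d₁ (suc j) e ≡ true
            in₁ j x = ∧-elimˡ (P d₁ (suc j) e) (∧-elimˡ (K (suc j) e) x)
            in₄ : ∀ j → (K (suc j) ∖ˢ spanned T (suc j)) e ≡ true → P d₄ (suc j) e ≡ true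
            in₄ j x = ∧-elimʳ (P d₁ (suc j) e) (∧-elimˡ (K (suc j) e) x)
            one : ∀ j → (K (suc j) ∖ˢ spanned T (suc j)) e ≡ true →
                  (anyF λ i → cl i T e) ≡ true ⊎ (anyF λ i → cl i T e) ≡ false →
                  1 ≤ bit (unspanned T e) + sum (λ i → bit (L i e))
            one j x (inj₂ f) = ≤-trans (≤-reflexive (cong bit (sym (∧-intro (Pt.P⊑O d₁ (suc j) e (in₁ j x)) (not-false f))))) (m≤m+n _ _)
            one j x (inj₁ t) with anyF-elim (λ i → cl i T e) t
            ... | i , ci = ≤-trans (≤-trans (≤-reflexive (cong bit (sym Li))) (sum-term (λ i → bit (L i e)) i)) (m≤n+m _ _)
              where
              Oi : spanned T i e ≡ true
              Oi = ∧-intro (Pt.P⊑O d₁ (suc j) e (in₁ j x)) ci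
              bad : P d₁ i e ≡ true ⊎ P d₄ i e ≡ true → ∀ {X : Set} → X
              bad (inj₁ u) with Pt.disj d₁ e u (in₁ j x)
              ... | refl = true≢false Oi (not-true (∧-elimʳ (K (suc j) e) x))
              bad (inj₂ u) with Pt.disj d₄ e u (in₄ j x)
              ... | refl = true≢false Oi (not-true (∧-elimʳ (K (suc j) e) x))
              Li : L i e ≡ true
              Li = ∧-intro Oi (not-false (≢true λ r → bad (∨-elim (P d₁ i e) r)))

        tail≤ : ∀ x → sum (λ j → exc (suc j) (S x) (P x (suc j))) ≤ ω x
        tail≤ x = sum-tail (λ i → exc i (S x) (P x i))

        ω₁₄≤s : ω d₁ + ω d₄ ≤ s
        ω₁₄≤s = ≤-trans (+-monoʳ-≤ (ω d₁) (m≤n+m (ω d₄) (ω d₂ + ω d₃)))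
          (≤-reflexive (lem (ω d₁) (ω d₂) (ω d₃) (ω d₄)))
          where
          lem : ∀ a b c d → a + (b + c + d) ≡ a + b + (c + d)
          lem = solve-∀

      overlaps : q * η ≤ 2 * s + α
      overlaps = begin
        q * η                              ≡⟨ sym (sum-const q η) ⟩
        sum {q} (const η)                  ≤⟨ sum≤⇒ {f = const η} {λ j → card (K (suc j) ∖ˢ spanned T (suc j))} overlap-one ⟩
        sum (λ j → card (K (suc j) ∖ˢ spanned T (suc j))) + sum (λ j → exc (suc j) (S d₁) (P d₁ (suc j)) + exc (suc j) (S d₄) (P d₄ (suc j)))
          ≤⟨ +-mono-≤ stray (≤-trans (≤-reflexive (∑-distrib-+ (λ j → exc (suc j) (S d₁) (P d₁ (suc j))) (λ j → exc (suc j) (S d₄) (P d₄ (suc j)))))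
                                     (+-mono-≤ (tail≤ d₁) (tail≤ d₄))) ⟩
        α + (ω d₁ + ω d₄) + (ω d₁ + ω d₄)  ≤⟨ +-mono-≤ (+-monoʳ-≤ α ω₁₄≤s) ω₁₄≤s ⟩
        α + s + s                          ≡⟨ lem α s ⟩
        2 * s + α                          ∎
        where
        open ≤-Reasoning
        lem : ∀ a s → a + s + s ≡ 2 * s + a
        lem = solve-∀

      -- This is the near tightness: outside `zero`, `T ∪ˢ V` has little rank beyond `spanned T` and
      -- `H`. Replacing `V` by `N ∪ˢ N′` costs `η` per matroid, and `N ∪ˢ N′` lies in the uncrossed
      -- solutions, whose excess over `H` is at most `s`.
      level-excess : sum (λ j → exc (suc j) (T ∪ˢ V) (spanned T (suc j) ∪ˢ H (suc j))) ≤ 3 * s + deficit T + α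
      level-excess = begin
        sum (λ j → exc (suc j) (T ∪ˢ V) (spanned T (suc j) ∪ˢ H (suc j)))
          ≤⟨ sum-mono one ⟩
        sum (λ j → (card T ∸ card (spanned T (suc j))) + (E (suc j) + η))
          ≡⟨ trans (∑-distrib-+ (λ j → card T ∸ card (spanned T (suc j))) (λ j → E (suc j) + η))
               (cong (sum (λ j → card T ∸ card (spanned T (suc j))) +_)
                 (trans (∑-distrib-+ (E ∘ suc) (const η)) (cong (sum (E ∘ suc) +_) (sum-const q η)))) ⟩
        sum (λ j → card T ∸ card (spanned T (suc j))) + (sum (E ∘ suc) + q * η)
          ≤⟨ +-mono-≤ (sum-tail (λ i → card T ∸ card (spanned T i))) (+-mono-≤ (≤-trans (sum-tail E) (≤-reflexive sumE)) overlaps) ⟩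
        deficit T + (s + (2 * s + α))
          ≡⟨ lem (deficit T) s α ⟩
        3 * s + deficit T + α ∎
        where
        open ≤-Reasoning
        E : Fin (suc q) → ℕ
        E i = (exc i (S d₁) (P d₁ i) + exc i (S d₂) (P d₂ i)) + (exc i (S d₃) (P d₃ i) + exc i (S d₄) (P d₄ i))
        sumE : sum E ≡ s
        sumE = trans (∑-distrib-+ (λ i → exc i (S d₁) (P d₁ i) + exc i (S d₂) (P d₂ i)) (λ i → exc i (S d₃) (P d₃ i) + exc i (S d₄) (P d₄ i)))
                     (cong₂ _+_ (sum-pair d₁ d₂) (sum-pair d₃ d₄))
        X : Sub m
        X = (S d₁ ∩ˢ S d₂) ∪ˢ (S d₃ ∩ˢ S d₄)
        NN⊑X : N ∪ˢ N′ ⊑ X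
        NN⊑X = ∪-mono {S = N} {N′} {S d₁ ∩ˢ S d₂} N⊑ N′⊑
        HO : ∀ i → spanned T i ∪ˢ H i ⊑ O
        HO i = ∪-⊑ {S = spanned T i} {H i} (∩-l {S = O} {cl i T}) (H⊑O i)
        excH : ∀ i → exc i X (H i) ≤ E i
        excH i = ≤-trans (exc-∪ i {S d₁ ∩ˢ S d₂} {P d₁ i ∩ˢ P d₂ i} {S d₃ ∩ˢ S d₄} {P d₃ i ∩ˢ P d₄ i}
                                (O-ind i (P∩⊑ d₁ d₂ i)) (O-ind i (P∩⊑ d₃ d₄ i)) (O-ind i (H⊑O i)))
                         (+-mono-≤ (pair-∩ d₁ d₂ i) (pair-∩ d₃ d₄ i))
        V⊑ : T ∪ˢ V ⊑ (T ∪ˢ (N ∪ˢ N′)) ∪ˢ (V ∖ˢ (N ∪ˢ N′))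
        V⊑ e r = lemV (T e) (V e) ((N ∪ˢ N′) e) r
          where
          lemV : ∀ t v n → t ∨ v ≡ true → (t ∨ n) ∨ (v ∧ not n) ≡ true
          lemV true  v     n     p = refl
          lemV false true  true  p = refl
          lemV false true  false p = refl
        one : ∀ j → exc (suc j) (T ∪ˢ V) (spanned T (suc j) ∪ˢ H (suc j)) ≤ (card T ∸ card (spanned T (suc j))) + (E (suc j) + η)
        one j = begin
          exc i (T ∪ˢ V) Q                                     ≤⟨ exc-more i {T ∪ˢ V} {T ∪ˢ (N ∪ˢ N′)} Q V⊑ (O-ind i (HO i)) ⟩
          exc i (T ∪ˢ (N ∪ˢ N′)) Q + card (V ∖ˢ (N ∪ˢ N′))     ≤⟨ +-mono-≤ (exc-mono i Q (∪-mono {S = T} {N ∪ˢ N′} ⊑-refl NN⊑X)) leftover ⟩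
          exc i (T ∪ˢ X) Q + η                                 ≤⟨ +-monoˡ-≤ η (exc-∪ i {T} {spanned T i} {X} {H i} (O-ind i (∩-l {S = O} {cl i T})) (O-ind i (H⊑O i)) (O-ind i (HO i))) ⟩
          exc i T (spanned T i) + exc i X (H i) + η            ≤⟨ +-monoˡ-≤ η (+-mono-≤ (exc-spanned T i) (excH i)) ⟩
          (card T ∸ card (spanned T i)) + E i + η              ≡⟨ +-assoc (card T ∸ card (spanned T i)) (E i) η ⟩
          (card T ∸ card (spanned T i)) + (E i + η)            ∎
          where
          i = suc j
          Q = spanned T i ∪ˢ H i
        lem : ∀ a s b → a + (s + (2 * s + b)) ≡ 3 * s + a + b
        lem = solve-∀

      -- Up to `leftover`, `V` is contained in two solutions, whose elements of O are bounded by
      -- `excess-∩O`.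
      level-∩O : q * card (V ∩ˢ O) ≤ 3 * s + α
      level-∩O = begin
        q * card (V ∩ˢ O)                                         ≤⟨ *-monoʳ-≤ q cov ⟩
        q * (card (S d₁ ∩ˢ O) + card (S d₄ ∩ˢ O) + η)             ≡⟨ dist q (card (S d₁ ∩ˢ O)) _ η ⟩
        q * card (S d₁ ∩ˢ O) + q * card (S d₄ ∩ˢ O) + q * η       ≤⟨ +-mono-≤ (≤-trans (+-mono-≤ (excess-∩O (P-part d₁)) (excess-∩O (P-part d₄))) ω₁₄≤s) overlaps ⟩
        s + (2 * s + α)                                           ≡⟨ lem s α ⟩
        3 * s + α                                                 ∎
        where
        open ≤-Reasoning
        dist : ∀ q a b c → q * (a + b + c) ≡ q * a + q * b + q * c
        dist = solve-∀
        lem : ∀ s b → s + (2 * s + b) ≡ 3 * s + b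
        lem = solve-∀
        split : ∀ e → (V ∩ˢ O) e ≡ true → ((S d₁ ∩ˢ O) ∪ˢ (S d₄ ∩ˢ O)) e ≡ true ⊎ (V ∖ˢ (N ∪ˢ N′)) e ≡ true
        split e r with bool? ((N ∪ˢ N′) e)
        ... | inj₂ n = inj₂ (∧-intro (∧-elimˡ (V e) r) (not-false n))
        ... | inj₁ n with ∨-elim (N e) n
        ...   | inj₁ x = inj₁ (∨-introˡ _ (∧-intro (∧-elimˡ (S d₁ e) (N⊑ e x)) (∧-elimʳ (V e) r)))
        ...   | inj₂ x = inj₁ (∨-introʳ ((S d₁ ∩ˢ O) e) (∧-intro (∧-elimʳ (S d₃ e) (N′⊑ e x)) (∧-elimʳ (V e) r)))
        cov : card (V ∩ˢ O) ≤ card (S d₁ ∩ˢ O) + card (S d₄ ∩ˢ O) + η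
        cov = ≤-trans (card-cover {g = (S d₁ ∩ˢ O) ∪ˢ (S d₄ ∩ˢ O)} {V ∖ˢ (N ∪ˢ N′)} split)
                      (+-mono-≤ (card-∪≤ (S d₁ ∩ˢ O) (S d₄ ∩ˢ O)) leftover)

  -- All levels together

  ⋃ˢ : ∀ {L m} → (Fin L → Sub m) → Sub m
  ⋃ˢ f e = anyF λ i → f i e

  ⋃-⊑ : ∀ {L m} {f : Fin L → Sub m} {S} → (∀ i → f i ⊑ S) → ⋃ˢ f ⊑ S
  ⋃-⊑ {f = f} p e q with anyF-elim (λ i → f i e) q
  ... | i , r = p i e r

  card-⋃ : ∀ {L m} (f : Fin L → Sub m) → card (⋃ˢ f) ≤ sum (λ i → card (f i))
  card-⋃ {zero}  {m} f = ≤-trans (≤-reflexive (card-∅ m)) z≤n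
  card-⋃ {suc L} f = ≤-trans (card-∪≤ (f zero) (⋃ˢ (f ∘ suc)))
    (≤-trans (+-monoʳ-≤ _ (card-⋃ (f ∘ suc))) (≤-reflexive (sym (sum-suc (λ i → card (f i))))))

  module Multi {m q} (Ms : Fin (suc (suc q)) → Mat m) (O : Sub m) (Oind : ∀ i → Mat.ind (Ms i) O ≡ true) where

    open Family Ms O Oind

    module _ (T : Sub m) where

      exc-⋃ : ∀ {L} i (V H : Fin L → Sub m) → (∀ ℓ → H ℓ ⊑ O) →
        exc i (T ∪ˢ ⋃ˢ V) (spanned T i ∪ˢ ⋃ˢ H) ≤ (card T ∸ card (spanned T i)) + sum (λ ℓ → exc i (T ∪ˢ V ℓ) (spanned T i ∪ˢ H ℓ))
      exc-⋃ {zero}  i V H p = ≤-trans (exc-cong (λ e x → drop (T e) x) λ e → or-false (spanned T i e))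
        (≤-trans (exc-spanned T i) (m≤m+n _ _))
        where
        or-false : ∀ a → a ∨ false ≡ a
        or-false true  = refl
        or-false false = refl
        drop : ∀ a → a ∨ false ≡ true → a ≡ true
        drop true x = refl
        exc-cong : ∀ {S S′ Q Q′} → S ⊑ S′ → Q ≗ Q′ → exc i S Q ≤ exc i S′ Q′
        exc-cong {S} {S′} {Q} {Q′} a b = ≤-trans (∸-monoʳ-≤ (rk i (S ∪ˢ Q)) (≤-reflexive (sym (card-cong b))))
          (∸-monoˡ-≤ (card Q′) (rk-mono i (∪-mono {S = S} {Q} a λ e → subst (_≡ true) (b e))))
      exc-⋃ {suc L} i V H p = begin
        exc i (T ∪ˢ ⋃ˢ V) (A ∪ˢ ⋃ˢ H)
          ≤⟨ exc-cong (λ e → l1 (T e) (V zero e) (⋃ˢ (V ∘ suc) e)) (λ e → l2 (A e) (H zero e) (⋃ˢ (H ∘ suc) e)) ⟩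
        exc i ((T ∪ˢ V zero) ∪ˢ (T ∪ˢ ⋃ˢ (V ∘ suc))) ((A ∪ˢ H zero) ∪ˢ (A ∪ˢ ⋃ˢ (H ∘ suc)))
          ≤⟨ exc-∪ i {T ∪ˢ V zero} {A ∪ˢ H zero} {T ∪ˢ ⋃ˢ (V ∘ suc)} {A ∪ˢ ⋃ˢ (H ∘ suc)} (O-ind i q0) (O-ind i qs) (O-ind i (∪-⊑ {S = A ∪ˢ H zero} q0 qs)) ⟩
        exc i (T ∪ˢ V zero) (A ∪ˢ H zero) + exc i (T ∪ˢ ⋃ˢ (V ∘ suc)) (A ∪ˢ ⋃ˢ (H ∘ suc))
          ≤⟨ +-monoʳ-≤ _ (exc-⋃ i (V ∘ suc) (H ∘ suc) (p ∘ suc)) ⟩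
        exc i (T ∪ˢ V zero) (A ∪ˢ H zero) + ((card T ∸ card A) + sum (g ∘ suc))
          ≡⟨ lem (g zero) (card T ∸ card A) (sum (g ∘ suc)) ⟩
        (card T ∸ card A) + (g zero + sum (g ∘ suc))
          ≡⟨ cong ((card T ∸ card A) +_) (sym (sum-suc g)) ⟩
        (card T ∸ card A) + sum g ∎
        where
        open ≤-Reasoning
        A = spanned T i
        g : Fin (suc L) → ℕ
        g ℓ = exc i (T ∪ˢ V ℓ) (A ∪ˢ H ℓ)
        A⊑ : A ⊑ O
        A⊑ = ∩-l {S = O} {cl i T}
        q0 : A ∪ˢ H zero ⊑ O
        q0 = ∪-⊑ {S = A} {H zero} A⊑ (p zero)
        qs : A ∪ˢ ⋃ˢ (H ∘ suc) ⊑ O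
        qs = ∪-⊑ {S = A} {⋃ˢ (H ∘ suc)} A⊑ (⋃-⊑ {f = H ∘ suc} (p ∘ suc))
        l1 : ∀ t v w → t ∨ (v ∨ w) ≡ true → (t ∨ v) ∨ (t ∨ w) ≡ true
        l1 true  v    w r = refl
        l1 false true w r = refl
        l1 false false w r = r
        l2 : ∀ t v w → t ∨ (v ∨ w) ≡ (t ∨ v) ∨ (t ∨ w)
        l2 true  v    w = refl
        l2 false v    w = refl
        lem : ∀ a b c → a + (b + c) ≡ b + (a + c)
        lem = solve-∀
        exc-cong : ∀ {S S′ Q Q′} → S ⊑ S′ → Q ≗ Q′ → exc i S Q ≤ exc i S′ Q′
        exc-cong {S} {S′} {Q} {Q′} a b = ≤-trans (∸-monoʳ-≤ (rk i (S ∪ˢ Q)) (≤-reflexive (sym (card-cong b))))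
          (∸-monoˡ-≤ (card Q′) (rk-mono i (∪-mono {S = S} {Q} a λ e → subst (_≡ true) (b e))))

      doubly : Sub m
      doubly = spanned T zero ∩ˢ ⋃ˢ λ j → spanned T (suc j)

      private
        α k : ℕ
        α = card (unspanned T)
        k = suc (suc q)

      sum-spanned : sum (λ i → card (spanned T i)) + deficit T ≡ k * card T
      sum-spanned = trans (sym (∑-distrib-+ (λ i → card (spanned T i)) (λ i → card T ∸ card (spanned T i))))
        (trans (sum-cong-≗ λ i → m+[n∸m]≡n (spanned-card {T} i)) (sum-const k (card T)))

      private
        some : ∀ e → O e ≡ true → unspanned T e ≡ true ⊎ ∃[ i ] spanned T i e ≡ true
        some e o with bool? (anyF λ i → cl i T e)
        ... | inj₂ f = inj₁ (∧-intro o (not-false f))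
        ... | inj₁ t with anyF-elim (λ i → cl i T e) t
        ...   | i , c = inj₂ (i , ∧-intro o c)

      -- The sets `spanned T i` have total size `k * card T` minus the deficit. They cover O up to
      -- unspanned elements, and those of `doubly` at least twice. So if |T| is not much more than
      -- |O| / k, both deficit and `doubly` are small.
      doubly-bound : deficit T + card doubly + card O ≤ k * card T + α
      doubly-bound = begin
        deficit T + card doubly + card O                   ≡⟨ +-assoc (deficit T) _ _ ⟩
        deficit T + (card doubly + card O)                 ≤⟨ +-monoʳ-≤ (deficit T) main ⟩
        deficit T + (sum (λ i → card (spanned T i)) + α)   ≡⟨ lem (deficit T) _ α ⟩
        sum (λ i → card (spanned T i)) + deficit T + α     ≡⟨ cong (_+ α) sum-spanned ⟩
        k * card T + α                                     ∎
        where
        open ≤-Reasoning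
        lem : ∀ a b c → a + (b + c) ≡ b + a + c
        lem = solve-∀
        A : Fin k → Sub m
        A = spanned T
        point : ∀ e → bit (doubly e) + bit (O e) ≤ sum (λ i → bit (A i e)) + bit (unspanned T e)
        point e with bool? (O e)
        ... | inj₂ o rewrite o = z≤n
        ... | inj₁ o with bool? (doubly e)
        ...   | inj₂ d rewrite d with some e o
        ...     | inj₁ u = ≤-trans (≤-trans (bit≤1 (O e)) (≤-reflexive (cong bit (sym u)))) (m≤n+m _ _)
        ...     | inj₂ (i , a) = ≤-trans (≤-trans (bit≤1 (O e)) (≤-trans (≤-reflexive (cong bit (sym a))) (sum-term (λ i → bit (A i e)) i))) (m≤m+n _ _)
        point e | inj₁ o | inj₁ d with anyF-elim (λ j → A (suc j) e) (∧-elimʳ (A zero e) d)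
        ... | j , a = ≤-trans (+-mono-≤ (≤-trans (bit≤1 (doubly e)) (≤-reflexive (cong bit (sym (∧-elimˡ (A zero e) d)))))
                                        (≤-trans (bit≤1 (O e)) (≤-trans (≤-reflexive (cong bit (sym a))) (sum-term (λ j → bit (A (suc j) e)) j))))
                              (≤-trans (≤-reflexive (sym (sum-suc (λ i → bit (A i e))))) (m≤m+n _ _))
        main : card doubly + card O ≤ sum (λ i → card (spanned T i)) + α
        main = begin
          card doubly + card O                                       ≡⟨ sym (∑-distrib-+ (bit ∘ doubly) (bit ∘ O)) ⟩
          sum (λ e → bit (doubly e) + bit (O e))                     ≤⟨ sum-mono point ⟩
          sum (λ e → sum (λ i → bit (A i e)) + bit (unspanned T e))  ≡⟨ ∑-distrib-+ (λ e → sum (λ i → bit (A i e))) (bit ∘ unspanned T) ⟩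
          sum (λ e → sum (λ i → bit (A i e))) + α                    ≡⟨ cong (_+ α) (sym (card-sum A)) ⟩
          sum (λ i → card (A i)) + α                                 ∎

      -- `trichotomy` tells why a replacement set stopped growing: an element spanned by `T` in
      -- `zero` is spanned there by `V ℓ` too, or blocked by `U` in another matroid, or merely came
      -- in a wrong window.
      module Levels
        (V : Fin (suc q) → Sub m) (U : Sub m)
        (U⊑ : U ⊑ T ∪ˢ ⋃ˢ V) (U-ind : ind (suc zero) U ≡ true)
        (U-card : card T + sum (λ ℓ → card (V ℓ)) ≤ card U)
        (H : Fin (suc q) → Fin (suc (suc q)) → Sub m) (H⊑O : ∀ ℓ i → H ℓ i ⊑ O)
        (s : Fin (suc q) → ℕ)
        (H-excess : ∀ ℓ → sum (λ j → exc (suc j) (T ∪ˢ V ℓ) (spanned T (suc j) ∪ˢ H ℓ (suc j))) ≤ 3 * s ℓ + deficit T + α)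
        (H-avoid : ∀ ℓ → card (spanned T zero ∩ˢ ⋃ˢ λ j → H ℓ (suc j)) ≤ s ℓ)
        (Av : Fin (suc q) → Sub m)
        (trichotomy : ∀ ℓ o → spanned T zero o ≡ true →
          cl zero (V ℓ) o ≡ true ⊎ (∃[ j ] cl (suc j) U o ≡ true) ⊎ Av ℓ o ≡ true)
        where

        private
          ⋃H : Fin k → Sub m
          ⋃H i = ⋃ˢ λ ℓ → H ℓ i
          ⋃H⊑O : ∀ i → ⋃H i ⊑ O
          ⋃H⊑O i = ⋃-⊑ {f = λ ℓ → H ℓ i} λ ℓ → H⊑O ℓ i
          Q : Fin k → Sub m
          Q i = spanned T i ∪ˢ ⋃H i
          Q⊑O : ∀ i → Q i ⊑ O
          Q⊑O i = ∪-⊑ {S = spanned T i} (∩-l {S = O} {cl i T}) (⋃H⊑O i)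
          δ E Σs : ℕ
          δ = deficit T
          e : Fin (suc q) → Fin (suc q) → ℕ
          e ℓ j = exc (suc j) (T ∪ˢ V ℓ) (spanned T (suc j) ∪ˢ H ℓ (suc j))
          E = sum λ ℓ → sum (e ℓ)
          hit : Sub m
          hit = spanned T zero ∩ˢ ⋃ˢ λ j → ⋃H (suc j)
          Σs = sum s

          U-exc : ∀ j → exc (suc j) U (Q (suc j)) ≤ (card T ∸ card (spanned T (suc j))) + sum (λ ℓ → e ℓ j)
          U-exc j = ≤-trans (exc-mono (suc j) (Q (suc j)) U⊑) (exc-⋃ (suc j) V (λ ℓ → H ℓ (suc j)) (λ ℓ → H⊑O ℓ (suc j)))

          hit≤ : card hit ≤ Σs
          hit≤ = ≤-trans (card-mono sw) (≤-trans (card-⋃ (λ ℓ → spanned T zero ∩ˢ ⋃ˢ λ j → H ℓ (suc j))) (sum-mono H-avoid))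
            where
            sw : hit ⊑ ⋃ˢ λ ℓ → spanned T zero ∩ˢ ⋃ˢ λ j → H ℓ (suc j)
            sw o p with anyF-elim (λ j → ⋃H (suc j) o) (∧-elimʳ (spanned T zero o) p)
            ... | j , r with anyF-elim (λ ℓ → H ℓ (suc j) o) r
            ...   | ℓ , h = anyF-intro (λ ℓ → spanned T zero o ∧ anyF λ j → H ℓ (suc j) o) ℓ
                              (∧-intro (∧-elimˡ (spanned T zero o) p) (anyF-intro (λ j → H ℓ (suc j) o) j h))

          sum-U : sum (λ j → exc (suc j) U (Q (suc j))) ≤ δ + E
          sum-U = ≤-trans (sum≤⇒ {g = λ j → card T ∸ card (spanned T (suc j))} U-exc)
            (+-mono-≤ (sum-tail (λ i → card T ∸ card (spanned T i))) (≤-reflexive (∑-comm (λ j ℓ → e ℓ j))))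

          E≤ : E ≤ 3 * Σs + suc q * (δ + α)
          E≤ = begin
            E                                           ≤⟨ sum≤⇒ {g = λ ℓ → 3 * s ℓ} {const (δ + α)} (λ ℓ → ≤-trans (H-excess ℓ) (≤-reflexive (+-assoc (3 * s ℓ) δ α))) ⟩
            sum (λ ℓ → 3 * s ℓ) + sum {suc q} (const (δ + α)) ≡⟨ cong₂ _+_ (sum-*ˡ 3 s) (sum-const (suc q) (δ + α)) ⟩
            3 * Σs + suc q * (δ + α)                    ∎
            where open ≤-Reasoning

          -- `U` is independent in `suc zero`, and by near tightness its size hardly exceeds that of
          -- `Q (suc zero)`. Up to `hit` and unspanned elements, that set contains only what `T`
          -- spans in matroids other than `zero`, at most (k - 1) |T| elements.
          total : card T + sum (λ ℓ → card (V ℓ)) ≤ suc q * card T + α + Σs + (δ + E)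
          total = begin
            card T + sum (λ ℓ → card (V ℓ))              ≤⟨ U-card ⟩
            card U                                       ≤⟨ rk-≥ (suc zero) U-ind (∪-l {S = U} {Q (suc zero)}) ⟩
            rk (suc zero) (U ∪ˢ Q (suc zero))            ≡⟨ sym (exc-eq (suc zero) {U} (O-ind (suc zero) (Q⊑O (suc zero)))) ⟩
            card (Q (suc zero)) + exc (suc zero) U (Q (suc zero))
              ≤⟨ +-mono-≤ cardQ (≤-trans (sum-term (λ j → exc (suc j) U (Q (suc j))) zero) sum-U) ⟩
            suc q * card T + α + Σs + (δ + E) ∎
            where
            open ≤-Reasoning
            rest : Sub m
            rest = Q (suc zero) ∖ˢ hit
            point : ∀ o → bit (rest o) ≤ sum (λ j → bit (spanned T (suc j) o)) + bit (unspanned T o)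
            point o with bool? (rest o)
            ... | inj₂ r rewrite r = z≤n
            ... | inj₁ r with some o (Q⊑O (suc zero) o (∧-elimˡ (Q (suc zero) o) r))
            ...   | inj₁ u = ≤-trans (≤-trans (bit≤1 (rest o)) (≤-reflexive (cong bit (sym u)))) (m≤n+m _ _)
            ...   | inj₂ (i , a) = ≤-trans (≤-trans (bit≤1 (rest o)) (which i a)) (m≤m+n _ _)
              where
              at : ∀ j → spanned T (suc j) o ≡ true → 1 ≤ sum (λ j → bit (spanned T (suc j) o))
              at j x = ≤-trans (≤-reflexive (cong bit (sym x))) (sum-term (λ j → bit (spanned T (suc j) o)) j)
              which : ∀ i → spanned T i o ≡ true → 1 ≤ sum (λ j → bit (spanned T (suc j) o))
              which (suc j) x = at j x
              which zero x with ∨-elim (spanned T (suc zero) o) (∧-elimˡ (Q (suc zero) o) r)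
              ... | inj₁ y = at zero y
              ... | inj₂ y = true≢false (∧-intro x (anyF-intro (λ j → ⋃H (suc j) o) zero y)) (not-true (∧-elimʳ (Q (suc zero) o) r))
            cardQ : card (Q (suc zero)) ≤ suc q * card T + α + Σs
            cardQ = begin
              card (Q (suc zero))                          ≤⟨ card-cover {g = rest} {hit} (λ o x → sp o x (bool? (hit o))) ⟩
              card rest + card hit                         ≤⟨ +-mono-≤ (sum-mono point) hit≤ ⟩
              sum (λ o → sum (λ j → bit (spanned T (suc j) o)) + bit (unspanned T o)) + Σs
                ≡⟨ cong (_+ Σs) (trans (∑-distrib-+ (λ o → sum (λ j → bit (spanned T (suc j) o))) (bit ∘ unspanned T)) (cong (_+ α) (sym (card-sum (spanned T ∘ suc))))) ⟩
              sum (λ j → card (spanned T (suc j))) + α + Σs ≤⟨ +-monoˡ-≤ Σs (+-monoˡ-≤ α (≤-trans (sum-mono λ j → spanned-card {T} (suc j)) (≤-reflexive (sum-const (suc q) (card T))))) ⟩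
              suc q * card T + α + Σs                      ∎
              where
              sp : ∀ o → Q (suc zero) o ≡ true → hit o ≡ true ⊎ hit o ≡ false → rest o ≡ true ⊎ hit o ≡ true
              sp o x (inj₁ y) = inj₂ y
              sp o x (inj₂ y) = inj₁ (∧-intro x (not-false y))

          -- Up to the deficit, `T` spans |T| elements of O in `zero`. One that `U` blocks elsewhere
          -- lies in `Q`, hence in `doubly` or `hit`, or it adds to the excess of `U`; the others
          -- are spanned by `V ℓ` or available. Summed over the k - 1 levels and compared with
          -- `total`, this leaves one copy of |T| to be covered by the errors.
          full : ∀ ℓ → card T ≤ card (V ℓ) + (2 * δ + E + card doubly + Σs) + card (Av ℓ)
          full ℓ = begin
            card T                                               ≡⟨ sym (m+[n∸m]≡n (spanned-card {T} zero)) ⟩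
            card (spanned T zero) + (card T ∸ card (spanned T zero)) ≤⟨ +-mono-≤ cover (sum-term (λ i → card T ∸ card (spanned T i)) zero) ⟩
            (card (V ℓ) + (δ + E + (card doubly + Σs) + card (Av ℓ))) + δ  ≡⟨ lem (card (V ℓ)) δ E (card doubly) Σs (card (Av ℓ)) ⟩
            card (V ℓ) + (2 * δ + E + card doubly + Σs) + card (Av ℓ) ∎
            where
            open ≤-Reasoning
            lem : ∀ v d e x s a → (v + (d + e + (x + s) + a)) + d ≡ v + (2 * d + e + x + s) + a
            lem = solve-∀
            new : Fin (suc q) → Sub m
            new j = (O ∩ˢ cl (suc j) U) ∖ˢ Q (suc j)
            Vpart : Sub m
            Vpart = O ∩ˢ cl zero (V ℓ)
            c3 : spanned T zero ⊑ Vpart ∪ˢ ((⋃ˢ new ∪ˢ (doubly ∪ˢ hit)) ∪ˢ Av ℓ)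
            c3 o p with trichotomy ℓ o p
            ... | inj₁ v = ∨-introˡ _ (∧-intro (∧-elimˡ (O o) p) v)
            ... | inj₂ (inj₂ a) = ∨-introʳ (Vpart o) (∨-introʳ ((⋃ˢ new ∪ˢ (doubly ∪ˢ hit)) o) a)
            ... | inj₂ (inj₁ (j , c)) = ∨-introʳ (Vpart o) (∨-introˡ _ (sub (bool? (Q (suc j) o))))
              where
              sub : Q (suc j) o ≡ true ⊎ Q (suc j) o ≡ false → (⋃ˢ new ∪ˢ (doubly ∪ˢ hit)) o ≡ true
              sub (inj₂ f) = ∨-introˡ _ (anyF-intro (λ j → new j o) j (∧-intro (∧-intro (∧-elimˡ (O o) p) c) (not-false f)))
              sub (inj₁ t) with ∨-elim (spanned T (suc j) o) t
              ... | inj₁ x = ∨-introʳ (⋃ˢ new o) (∨-introˡ _ (∧-intro p (anyF-intro (λ j → spanned T (suc j) o) j x)))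
              ... | inj₂ x = ∨-introʳ (⋃ˢ new o) (∨-introʳ (doubly o) (∧-intro p (anyF-intro (λ j → ⋃H (suc j) o) j x)))
            cardV : card Vpart ≤ card (V ℓ)
            cardV = spanned-card {V ℓ} zero
            card-new : card (⋃ˢ new) ≤ δ + E
            card-new = ≤-trans (card-⋃ new) (≤-trans (sum-mono λ j → exc-span (suc j) {U} {Q (suc j)} {O ∩ˢ cl (suc j) U}
                (O-ind (suc j) (∪-⊑ {S = Q (suc j)} (Q⊑O (suc j)) (∩-l {S = O})))
                λ o x → cl-mono (suc j) (∪-l {S = U} {Q (suc j)}) o (∧-elimʳ (O o) x)) sum-U)
            cover : card (spanned T zero) ≤ card (V ℓ) + (δ + E + (card doubly + Σs) + card (Av ℓ))
            cover = ≤-trans (card-mono c3) (≤-trans (card-∪≤ Vpart _) (+-mono-≤ cardV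
              (≤-trans (card-∪≤ _ (Av ℓ)) (+-monoˡ-≤ (card (Av ℓ))
                (≤-trans (card-∪≤ (⋃ˢ new) _) (+-mono-≤ card-new (≤-trans (card-∪≤ doubly hit) (+-monoʳ-≤ _ hit≤))))))))

        -- In matroid `suc zero` the levels exhaust what O leaves room for.
        exhaustion : card T ≤ 4 * (k * Σs) + (k + k) * k * (δ + card doubly + α) + sum (λ ℓ → card (Av ℓ))
        exhaustion = +-cancelˡ-≤ (suc q * card T + v) _ _ (begin
          suc q * card T + v + card T                ≡⟨ l1 (suc q * card T) v (card T) ⟩
          suc q * card T + (card T + v)              ≤⟨ +-mono-≤ sum-full total ⟩
          v + suc q * Z + a + (suc q * card T + α + Σs + (δ + E))
            ≡⟨ l2 v (suc q * Z) a (suc q * card T) α Σs δ E ⟩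
          suc q * card T + v + (suc q * Z + (α + Σs + δ + E) + a)
            ≤⟨ +-monoʳ-≤ (suc q * card T + v) (+-monoˡ-≤ a bound) ⟩
          suc q * card T + v + (4 * (k * Σs) + (k + k) * k * (δ + card doubly + α) + a) ∎)
          where
          open ≤-Reasoning
          v a X Z : ℕ
          v = sum λ ℓ → card (V ℓ)
          a = sum λ ℓ → card (Av ℓ)
          X = card doubly
          Z = 2 * δ + E + X + Σs
          l1 : ∀ x y z → x + y + z ≡ x + (z + y)
          l1 = solve-∀
          l2 : ∀ v z a t α s d e → v + z + a + (t + α + s + (d + e)) ≡ t + v + (z + (α + s + d + e) + a)
          l2 = solve-∀
          sum-full : suc q * card T ≤ v + suc q * Z + a
          sum-full = begin
            suc q * card T                             ≡⟨ sym (sum-const (suc q) (card T)) ⟩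
            sum {suc q} (const (card T))               ≤⟨ sum-mono full ⟩
            sum (λ ℓ → card (V ℓ) + Z + card (Av ℓ))   ≡⟨ ∑-distrib-+ (λ ℓ → card (V ℓ) + Z) (λ ℓ → card (Av ℓ)) ⟩
            sum (λ ℓ → card (V ℓ) + Z) + a             ≡⟨ cong (_+ a) (trans (∑-distrib-+ (λ ℓ → card (V ℓ)) (const Z)) (cong (v +_) (sum-const (suc q) Z))) ⟩
            v + suc q * Z + a                          ∎
          kE : k * (Σs + E) ≤ 4 * (k * Σs) + k * (suc q * (δ + α))
          kE = ≤-trans (*-monoʳ-≤ k (+-monoʳ-≤ Σs E≤)) (≤-reflexive (l4 q δ Σs α))
            where
            l4 : ∀ q d s α → suc (suc q) * (s + (3 * s + suc q * (d + α))) ≡ 4 * (suc (suc q) * s) + suc (suc q) * (suc q * (d + α))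
            l4 = solve-∀
          bound : suc q * Z + (α + Σs + δ + E) ≤ 4 * (k * Σs) + (k + k) * k * (δ + X + α)
          bound = begin
            suc q * Z + (α + Σs + δ + E)                              ≡⟨ l3 q δ E X Σs α ⟩
            k * (Σs + E) + (suc (2 * suc q) * δ + suc q * X + α)      ≤⟨ +-monoˡ-≤ (suc (2 * suc q) * δ + suc q * X + α) kE ⟩
            4 * (k * Σs) + k * (suc q * (δ + α)) + (suc (2 * suc q) * δ + suc q * X + α)
              -- The difference of the two sides has nonnegative coefficients; adding it leaves a
              -- polynomial identity.
              ≤⟨ m≤m+n _ ((q * q + 3 * q + 3) * δ + (2 * (q * q) + 7 * q + 7) * X + (q * q + 5 * q + 5) * α) ⟩
            4 * (k * Σs) + k * (suc q * (δ + α)) + (suc (2 * suc q) * δ + suc q * X + α)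
              + ((q * q + 3 * q + 3) * δ + (2 * (q * q) + 7 * q + 7) * X + (q * q + 5 * q + 5) * α)
              ≡⟨ l5 q Σs δ X α ⟩
            4 * (k * Σs) + (k + k) * k * (δ + X + α) ∎
            where
            l3 : ∀ q d e x s α → suc q * (2 * d + e + x + s) + (α + s + d + e) ≡ suc (suc q) * (s + e) + (suc (2 * suc q) * d + suc q * x + α)
            l3 = solve-∀
            l5 : ∀ q s d x a → 4 * (suc (suc q) * s) + suc (suc q) * (suc q * (d + a)) + (suc (2 * suc q) * d + suc q * x + a)
              + ((q * q + 3 * q + 3) * d + (2 * (q * q) + 7 * q + 7) * x + (q * q + 5 * q + 5) * a)
              ≡ 4 * (suc (suc q) * s) + (suc (suc q) + suc (suc q)) * suc (suc q) * (d + x + a)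
            l5 = solve-∀

  -- The algorithm

  allF : ∀ {n} → (Fin n → Bool) → Bool
  allF {zero}  f = true
  allF {suc n} f = f zero ∧ allF (f ∘ suc)

  allF-intro : ∀ {n} (f : Fin n → Bool) → (∀ i → f i ≡ true) → allF f ≡ true
  allF-intro {zero}  f p = refl
  allF-intro {suc n} f p = ∧-intro (p zero) (allF-intro (f ∘ suc) (p ∘ suc))

  allF-elim : ∀ {n} (f : Fin n → Bool) → allF f ≡ true → ∀ i → f i ≡ true
  allF-elim f p zero    = ∧-elimˡ (f zero) p
  allF-elim f p (suc i) = allF-elim (f ∘ suc) (∧-elimʳ (f zero) p) i

  allF-cong : ∀ {n} {f g : Fin n → Bool} → f ≗ g → allF f ≡ allF g
  allF-cong {zero}  p = refl
  allF-cong {suc n} p = cong₂ _∧_ (p zero) (allF-cong (p ∘ suc))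

  firstF : ∀ {n} → (Fin n → Bool) → Fin n → Bool
  firstF f zero    = f zero
  firstF f (suc i) = not (f zero) ∧ firstF (f ∘ suc) i

  firstF-⊑ : ∀ {n} (f : Fin n → Bool) → firstF f ⊑ f
  firstF-⊑ f zero    p = p
  firstF-⊑ f (suc i) p = firstF-⊑ (f ∘ suc) i (∧-elimʳ (not (f zero)) p)

  firstF-unique : ∀ {n} (f : Fin n → Bool) {i j} → firstF f i ≡ true → firstF f j ≡ true → i ≡ j
  firstF-unique f {zero}  {zero}  p q = refl
  firstF-unique f {zero}  {suc j} p q = true≢false p (not-true (∧-elimˡ (not (f zero)) q))
  firstF-unique f {suc i} {zero}  p q = true≢false q (not-true (∧-elimˡ (not (f zero)) p))
  firstF-unique f {suc i} {suc j} p q =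
    cong suc (firstF-unique (f ∘ suc) (∧-elimʳ (not (f zero)) p) (∧-elimʳ (not (f zero)) q))

  firstF-sum : ∀ {n} (f : Fin n → Bool) → sum (bit ∘ firstF f) ≡ bit (anyF f)
  firstF-sum {zero}  f = sum-zero _
  firstF-sum {suc n} f = trans (sum-suc (bit ∘ firstF f)) (go (f zero) refl)
    where
    go : ∀ b → f zero ≡ b → bit (f zero) + sum (λ i → bit (firstF f (suc i))) ≡ bit (f zero ∨ anyF (f ∘ suc))
    go true  eq rewrite eq = cong suc (trans (sum-const n 0) (*-zeroʳ n))
    go false eq rewrite eq = firstF-sum (f ∘ suc)

  ≡ᵇ-refl : ∀ x → (x ≡ᵇ x) ≡ true
  ≡ᵇ-refl x = Equivalence.to T-≡ (≡⇒≡ᵇ x x refl)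

  ≡ᵇ-elim : ∀ x y → (x ≡ᵇ y) ≡ true → x ≡ y
  ≡ᵇ-elim x y p = ≡ᵇ⇒≡ x y (Equivalence.from T-≡ p)

  ≤ᵇ-intro : ∀ {x y} → x ≤ y → (x ≤ᵇ y) ≡ true
  ≤ᵇ-intro p = Equivalence.to T-≡ (≤⇒≤ᵇ p)

  ≤ᵇ-elim : ∀ x y → (x ≤ᵇ y) ≡ true → x ≤ y
  ≤ᵇ-elim x y p = ≤ᵇ⇒≤ x y (Equivalence.from T-≡ p)

  ≡ᵇ-≢ : ∀ {x y} → x ≢ y → (x ≡ᵇ y) ≡ false
  ≡ᵇ-≢ {x} {y} ne = ≢true λ p → ⊥-elim (ne (≡ᵇ-elim x y p))

  ≤ᵇ-≰ : ∀ {x y} → y < x → (x ≤ᵇ y) ≡ false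
  ≤ᵇ-≰ {x} {y} lt = ≢true λ p → ⊥-elim (<⇒≱ lt (≤ᵇ-elim x y p))

  module Refill {m} (M : Mat m) where
    open Rank M

    refillOk : Sub m → Sub m → Fin m → Bool
    refillOk V S e = V e ∧ ind (add S e)

    refill-anti : ∀ V → Antitone (refillOk V)
    refill-anti V {S} {R} e p q = ∧-intro (∧-elimˡ (V e) q) (ind-sub (add-mono {S = S} {R} e p) (∧-elimʳ (V e) q))

    -- Invariant of the parallel scans: `B` lies in `cl A` and contains the part of `A` in `V`. If
    -- `A` accepts `x` and `B` rejects it, then `x` is in `cl B`, hence in `cl A`, although `A` with
    -- `x` is independent. So `x` is already in `A`, thus in `B`, and `B` could not reject it.
    refill-mono : ∀ V xs A B → ind A ≡ true → ind B ≡ true → B ⊑ cl A → A ∩ˢ V ⊑ B →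
                  greedy (refillOk V) xs A ∩ˢ V ⊑ greedy (refillOk V) xs B
    refill-mono V []       A B iA iB c p = p
    refill-mono V (x ∷ xs) A B iA iB c p with V x in v | ind (add A x) in a | ind (add B x) in b
    ... | false | _     | _     = refill-mono V xs A B iA iB c p
    ... | true  | true  | true  = refill-mono V xs (add A x) (add B x) a b
          (add-⊑ {S = B} {cl (add A x)} {x} (⊑-trans {g = cl A} c (cl-mono {A} {add A x} (⊑-add A x))) (cl-⊒ (add A x) x (∈-add A x)))
          (λ e q → lem e (∧-elimʳ (add A x e) q) (add-elim A x e (∧-elimˡ (add A x e) q)))
          where
          lem : ∀ e → V e ≡ true → A e ≡ true ⊎ x ≡ e → add B x e ≡ true
          lem e w (inj₁ r)    = ⊑-add B x e (p e (∧-intro r w))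
          lem e w (inj₂ refl) = ∈-add B x
    ... | true  | true  | false = true≢false (ind-sub (add-∈ {S = B} {x} bx) iB) b
          where
          bx : B x ≡ true
          bx = p x (∧-intro (ind∧∈cl⇒∈ a (cl-trans c x (dep⇒∈cl {B} {x} iB b))) v)
    ... | true  | false | true  = refill-mono V xs A (add B x) iA b (add-⊑ {S = B} {cl A} {x} c (dep⇒∈cl {A} {x} iA a))
          (λ e q → ⊑-add B x e (p e q))
    ... | true  | false | false = refill-mono V xs A B iA iB c p

  module Online {m q} (orc : Fin (suc (suc q)) → Sub m → Bool) where

    okAll : Sub m → Fin m → Bool
    okAll S e = allF λ i → orc i (add S e)

    module Pass (lab : Fin m → ℕ) where

      okT : Sub m → Fin m → Bool
      okT S e = (lab e ≡ᵇ 0) ∧ okAll S e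

      T : Sub m
      T = greedy okT (allFin m) ∅ˢ

      -- Although only one level is used in the end, the replacements of all levels are kept jointly
      -- independent with `T` outside `zero`, because `total` measures their union `U`.
      okV : Sub m → ℕ → Sub m → Fin m → Bool
      okV U x V e = (lab e ≡ᵇ x) ∧ (not (orc zero (add T e)) ∧ (orc zero (add V e) ∧ allF λ j → orc (suc j) (add (U ∪ˢ V) e)))

      U : ℕ → Sub m
      V : ℕ → Sub m
      U zero    = T
      U (suc x) = U x ∪ˢ V x
      -- V x is built from the elements with label suc x.
      V x = greedy (okV (U x) (suc x)) (allFin m) ∅ˢ

      okR : ℕ → Sub m → Fin m → Bool
      okR x S e = V x e ∧ orc zero (add S e)

      S₀ : ℕ → Sub m → Sub m
      S₀ zero    d = T
      S₀ (suc x) d = greedy (okR x) (allFin m) (T ∖ˢ d)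

      okF : Sub m → Fin m → Bool
      okF S e = (suc (suc q) ≤ᵇ lab e) ∧ okAll S e

      S : ℕ → Sub m → Sub m
      S ℓ d = greedy okF (allFin m) (S₀ ℓ d)

  -- Invariants of the process and the charging identity

  module Process {m q} (Ms : Fin (suc (suc q)) → Mat m) (O : Sub m) (Oind : ∀ i → Mat.ind (Ms i) O ≡ true) where

    open Family Ms O Oind public

    k : ℕ
    k = suc (suc q)

    open Online {m} {q} (λ i → ind i) public using (okAll)

    okAll-anti : Antitone okAll
    okAll-anti {S} {R} e p r = allF-intro (λ i → ind i (add S e)) λ i →
      ind-sub i (add-mono {S = S} {R} e p) (allF-elim (λ i → ind i (add R e)) r i)

    module Run (lab : Fin m → ℕ) where

      open Online.Pass {m} {q} (λ i → ind i) lab public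

      okF-anti : Antitone okF
      okF-anti e p r = ∧-intro (∧-elimˡ (k ≤ᵇ lab e) r) (okAll-anti e p (∧-elimʳ (k ≤ᵇ lab e) r))

      T-ind : ∀ i → ind i T ≡ true
      T-ind i = greedy-inv okT (λ S → ind i S ≡ true)
        (λ S e _ r → allF-elim (λ i → ind i (add S e)) (∧-elimʳ (lab e ≡ᵇ 0) r) i) (allFin m) ∅ˢ (ind-∅ i)

      T-lab : ∀ e → T e ≡ true → lab e ≡ 0
      T-lab = greedy-inv okT (λ S → ∀ e → S e ≡ true → lab e ≡ 0)
        (λ S e p r x y → [ p x , (λ { refl → ≡ᵇ-elim _ _ (∧-elimˡ (lab e ≡ᵇ 0) r) }) ]′ (add-elim S e x y)) (allFin m) ∅ˢ (λ _ ())

      V-lab : ∀ x e → V x e ≡ true → lab e ≡ suc x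
      V-lab x = greedy-inv (okV (U x) (suc x)) (λ S → ∀ e → S e ≡ true → lab e ≡ suc x)
        (λ S e p r y z → [ p y , (λ { refl → ≡ᵇ-elim _ _ (∧-elimˡ (lab e ≡ᵇ suc x) r) }) ]′ (add-elim S e y z)) (allFin m) ∅ˢ (λ _ ())

      V⊑cl : ∀ x → V x ⊑ cl zero T
      V⊑cl x = greedy-inv (okV (U x) (suc x)) (λ S → S ⊑ cl zero T)
        (λ S e p r → add-⊑ {S = S} {cl zero T} {e} p (dep⇒∈cl zero {T} {e} (T-ind zero)
          (not-true (∧-elimˡ (not (ind zero (add T e))) (∧-elimʳ (lab e ≡ᵇ suc x) r))))) (allFin m) ∅ˢ (λ _ ())

      V-ind : ∀ x → ind zero (V x) ≡ true
      V-ind x = greedy-inv (okV (U x) (suc x)) (λ S → ind zero S ≡ true)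
        (λ S e _ r → ∧-elimˡ (ind zero (add S e)) (∧-elimʳ (not (ind zero (add T e))) (∧-elimʳ (lab e ≡ᵇ suc x) r)))
        (allFin m) ∅ˢ (ind-∅ zero)

      U-ind : ∀ x j → ind (suc j) (U x) ≡ true
      U-ind zero    j = T-ind (suc j)
      U-ind (suc x) j = greedy-inv (okV (U x) (suc x)) (λ S → ind (suc j) (U x ∪ˢ S) ≡ true)
        (λ S e _ r → ind-sub (suc j) (λ y → lem S e y)
          (allF-elim (λ j → ind (suc j) (add (U x ∪ˢ S) e)) (∧-elimʳ (ind zero (add S e))
            (∧-elimʳ (not (ind zero (add T e))) (∧-elimʳ (lab e ≡ᵇ suc x) r))) j))
        (allFin m) ∅ˢ (ind-sub (suc j) (∪-⊑ {S = U x} {∅ˢ} ⊑-refl (λ _ ())) (U-ind x j))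
        where
        lem : ∀ S e y → (U x ∪ˢ add S e) y ≡ true → add (U x ∪ˢ S) e y ≡ true
        lem S e y p = assoc (U x y) (S y) ([ e ]ˢ y) p
          where
          assoc : ∀ a b c → a ∨ (b ∨ c) ≡ true → (a ∨ b) ∨ c ≡ true
          assoc true  b c p = refl
          assoc false b c p = p

      U-mono : ∀ {x} y → U x ⊑ U (y + x)
      U-mono zero    = ⊑-refl
      U-mono {x} (suc y) = ⊑-trans (U-mono {x} y) (∪-l {S = U (y + x)} {V (y + x)})

      T⊑U : ∀ x → T ⊑ U x
      T⊑U zero    = ⊑-refl
      T⊑U (suc x) = ⊑-trans (T⊑U x) (∪-l {S = U x} {V x})

      U-lab : ∀ x e → U x e ≡ true → lab e ≤ x
      U-lab zero    e p = ≤-reflexive (T-lab e p)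
      U-lab (suc x) e p with ∨-elim (U x e) p
      ... | inj₁ r = m≤n⇒m≤1+n (U-lab x e r)
      ... | inj₂ r = ≤-reflexive (V-lab x e r)

      UV-disj : ∀ x e → U x e ≡ true → V x e ≡ true → ∀ {X : Set} → X
      UV-disj x e p r with U-lab x e p | V-lab x e r
      ... | a | b with 1+n≰n (subst (_≤ x) b a)
      ...   | ()

      TV-disj : ∀ x e → T e ≡ true → V x e ≡ true → ∀ {X : Set} → X
      TV-disj x e p = UV-disj x e (T⊑U x e p)

      TV-ind : ∀ x j → ind (suc j) (T ∪ˢ V x) ≡ true
      TV-ind x j = ind-sub (suc j) (∪-mono {S = T} {V x} {U x} (T⊑U x) ⊑-refl) (U-ind (suc x) j)

      S₀-kept : ∀ x d → T ∖ˢ d ⊑ S₀ (suc x) d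
      S₀-kept x d = greedy-⊒ _ (allFin m) (T ∖ˢ d)

      S₀-sub : ∀ x d → S₀ (suc x) d ⊑ (T ∖ˢ d) ∪ˢ V x
      S₀-sub x d = greedy-inv _ (_⊑ (T ∖ˢ d) ∪ˢ V x)
        (λ S e p r → add-⊑ {S = S} {(T ∖ˢ d) ∪ˢ V x} {e} p (∨-introʳ ((T ∖ˢ d) e) (∧-elimˡ (V x e) r))) (allFin m) _ (∪-l {S = T ∖ˢ d} {V x})

      S₀-ind₀ : ∀ x d → ind zero (S₀ (suc x) d) ≡ true
      S₀-ind₀ x d = greedy-inv _ (λ S → ind zero S ≡ true) (λ S e _ r → ∧-elimʳ (V x e) r) (allFin m) _
        (ind-sub zero (∖-l {S = T} {d}) (T-ind zero))

      S₀-span : ∀ x d → V x ⊑ cl zero (S₀ (suc x) d)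
      S₀-span x d e v with bool? (ind zero (add (S₀ (suc x) d) e))
      ... | inj₁ i = cl-⊒ zero _ e (greedy-max _ (Refill.refill-anti (Ms zero) (V x)) (∈-allFin e) (∧-intro v i))
      ... | inj₂ i = dep⇒∈cl zero {S₀ (suc x) d} {e} (S₀-ind₀ x d) i

      S₀-mono : ∀ x {d d′} → T ∖ˢ d ⊑ T ∖ˢ d′ → S₀ (suc x) d′ ∩ˢ V x ⊑ S₀ (suc x) d
      S₀-mono x {d} {d′} p = Refill.refill-mono (Ms zero) (V x) (allFin m) (T ∖ˢ d′) (T ∖ˢ d)
        (ind-sub zero (∖-l {S = T} {d′}) (T-ind zero)) (ind-sub zero (∖-l {S = T} {d}) (T-ind zero))
        (⊑-trans p (cl-⊒ zero _)) λ e r → TV-disj x e (∧-elimˡ (T e) (∧-elimˡ ((T ∖ˢ d′) e) r)) (∧-elimʳ ((T ∖ˢ d′) e) r)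

      S₀⊑TV : ∀ x d → S₀ (suc x) d ⊑ T ∪ˢ V x
      S₀⊑TV x d = ⊑-trans (S₀-sub x d) (∪-mono {S = T ∖ˢ d} {V x} (∖-l {S = T} {d}) ⊑-refl)

      S₀-ind : ∀ ℓ d i → ind i (S₀ ℓ d) ≡ true
      S₀-ind zero    d i       = T-ind i
      S₀-ind (suc x) d zero    = S₀-ind₀ x d
      S₀-ind (suc x) d (suc j) = ind-sub (suc j) (S₀⊑TV x d) (TV-ind x j)

      S-ind : ∀ ℓ d i → ind i (S ℓ d) ≡ true
      S-ind ℓ d i = greedy-inv okF (λ S → ind i S ≡ true)
        (λ S e _ r → allF-elim (λ i → ind i (add S e)) (∧-elimʳ (k ≤ᵇ lab e) r) i) (allFin m) _ (S₀-ind ℓ d i)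

      S₀⊑S : ∀ ℓ d → S₀ ℓ d ⊑ S ℓ d
      S₀⊑S ℓ d = greedy-⊒ okF (allFin m) _

      T⊑S : ∀ d → T ⊑ S 0 d
      T⊑S d = S₀⊑S 0 d

    assign : Sub m → Fin k → Sub m
    assign S i e = O e ∧ firstF (λ i → cl i S e) i

    assign-partial : ∀ S → Partial (assign S)
    assign-partial S = record
      { P⊑O  = λ i e p → ∧-elimˡ (O e) p
      ; disj = λ e p r → firstF-unique (λ i → cl i S e) (∧-elimʳ (O e) p) (∧-elimʳ (O e) r)
      }

    -- `assign S i` is spanned by the independent `S`, so its size and its excess add up to exactly
    -- |S|; these sets and the unspanned elements partition O.
    balance : ∀ {S} → (∀ i → ind i S ≡ true) → k * card S + card (unspanned S) ≡ card O + excess S (assign S)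
    balance {S} iS = begin
      k * card S + card (unspanned S)                                         ≡⟨ cong (_+ card (unspanned S)) (sym sum-P) ⟩
      sum (λ i → card (assign S i)) + excess S (assign S) + card (unspanned S) ≡⟨ lem (sum (λ i → card (assign S i))) (excess S (assign S)) (card (unspanned S)) ⟩
      sum (λ i → card (assign S i)) + card (unspanned S) + excess S (assign S) ≡⟨ cong (_+ excess S (assign S)) sum-O ⟩
      card O + excess S (assign S)                                            ∎
      where
      open ≡-Reasoning
      lem : ∀ a b c → a + b + c ≡ a + c + b
      lem = solve-∀
      one : ∀ i → card (assign S i) + exc i S (assign S i) ≡ card S
      one i = trans (exc-eq i {S} (O-ind i λ e p → ∧-elimˡ (O e) p))
        (≤-antisym (≤-trans (cl-rk i λ e p → firstF-⊑ (λ i → cl i S e) i (∧-elimʳ (O e) p)) (rk≤card i S))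
                   (rk-≥ i (iS i) (∪-l {S = S} {assign S i})))
      sum-P : sum (λ i → card (assign S i)) + excess S (assign S) ≡ k * card S
      sum-P = trans (sym (∑-distrib-+ (λ i → card (assign S i)) (λ i → exc i S (assign S i)))) (trans (sum-cong-≗ one) (sum-const k (card S)))
      point : ∀ e → sum (λ i → bit (assign S i e)) + bit (unspanned S e) ≡ bit (O e)
      point e with O e
      ... | false = trans (cong (_+ 0) (trans (sum-const k 0) (*-zeroʳ k))) refl
      ... | true  = trans (cong (_+ bit (not (anyF λ i → cl i S e))) (firstF-sum (λ i → cl i S e))) (compl (anyF λ i → cl i S e))
        where
        compl : ∀ b → bit b + bit (not b) ≡ 1
        compl true  = refl
        compl false = refl
      sum-O : sum (λ i → card (assign S i)) + card (unspanned S) ≡ card O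
      sum-O = trans (cong (_+ card (unspanned S)) (card-sum (assign S)))
        (trans (sym (∑-distrib-+ (λ e → sum (λ i → bit (assign S i e))) (bit ∘ unspanned S))) (sum-cong-≗ point))

  -- Changing the window of one element

  iff : ∀ {a b} → (a ≡ true → b ≡ true) → (b ≡ true → a ≡ true) → a ≡ b
  iff {true}  {b}     p q = sym (p refl)
  iff {false} {false} p q = refl
  iff {false} {true}  p q = q refl

  ≗⇒⊑ : ∀ {m} {S R : Sub m} → S ≗ R → S ⊑ R
  ≗⇒⊑ p e q = trans (sym (p e)) q

  ≗⇒⊒ : ∀ {m} {S R : Sub m} → S ≗ R → R ⊑ S
  ≗⇒⊒ p e q = trans (p e) q

  add-cong : ∀ {m} {S R : Sub m} e → S ≗ R → add S e ≗ add R e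
  add-cong e p x rewrite p x = refl

  module _ {m} {ok ok′ : Sub m → Fin m → Bool} where

    greedy-cong : (∀ {S S′} e → S ≗ S′ → ok S e ≡ ok′ S′ e) →
                  ∀ xs {S S′} → S ≗ S′ → greedy ok xs S ≗ greedy ok′ xs S′
    greedy-cong h []       p = p
    greedy-cong h (x ∷ xs) {S} {S′} p = greedy-cong h xs step
      where
      step : (if ok S x then add S x else S) ≗ (if ok′ S′ x then add S′ x else S′)
      step rewrite h x p with ok′ S′ x
      ... | true  = add-cong {S = S} x p
      ... | false = p

    module _ (o : Fin m) (sim : ∀ {S S′} e → o ≢ e → S ≗ S′ → ok S e ≡ ok′ S′ e) where

      greedy-absent : (∀ S → ok′ S o ≡ false) → ∀ xs {S S′} → S ≗ S′ → greedy ok xs S o ≡ false →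
                      greedy ok xs S ≗ greedy ok′ xs S′
      greedy-absent rej []       p q = p
      greedy-absent rej (x ∷ xs) {S} {S′} p q with o ≟ x
      ... | no ne rewrite sim x ne p with ok′ S′ x
      ...   | true  = greedy-absent rej xs (add-cong {S = S} x p) q
      ...   | false = greedy-absent rej xs p q
      greedy-absent rej (x ∷ xs) {S} {S′} p q | yes refl rewrite rej S′ with ok S o
      ... | true  = true≢false (greedy-⊒ ok xs _ o (∈-add S o)) q
      ... | false = greedy-absent rej xs p q

      -- The two scans coincide until they reach `o`, which only the second takes. They may diverge
      -- afterwards, but `o` stays.
      greedy-insert : ∀ {xs S S′} → o ∈ xs → S ≗ S′ → greedy ok xs S o ≡ false →
                      (∀ {R} → R ⊑ greedy ok xs S → ok′ R o ≡ true) → greedy ok′ xs S′ o ≡ true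
      greedy-insert {x ∷ xs} {S} {S′} i p q h with o ≟ x
      greedy-insert {x ∷ xs} {S} {S′} i p q h | yes refl with ok S o
      ... | true  = true≢false (greedy-⊒ ok xs _ o (∈-add S o)) q
      ... | false rewrite h (⊑-trans (≗⇒⊒ p) (greedy-⊒ ok xs S)) = greedy-⊒ ok′ xs _ o (∈-add S′ o)
      greedy-insert {x ∷ xs} {S} {S′} (here refl) p q h | no ne = ⊥-elim (ne refl)
      greedy-insert {x ∷ xs} {S} {S′} (there i) p q h | no ne rewrite sim x ne p with ok′ S′ x
      ... | true  = greedy-insert i (add-cong {S = S} x p) q h
      ... | false = greedy-insert i p q h

  module Exchange {m q} (Ms : Fin (suc (suc q)) → Mat m) (O : Sub m) (Oind : ∀ i → Mat.ind (Ms i) O ≡ true) where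

    open Process Ms O Oind

    ind-cong : ∀ i {S R} → S ≗ R → ind i S ≡ ind i R
    ind-cong i p = iff (ind-sub i (≗⇒⊒ p)) (ind-sub i (≗⇒⊑ p))

    okAll-cong : ∀ {S R} e → S ≗ R → okAll S e ≡ okAll R e
    okAll-cong {S} e p = allF-cong λ i → ind-cong i (add-cong {S = S} e p)

    okAll-unspanned : ∀ {S R o} → (∀ i → ind i S ≡ true) → unspanned S o ≡ true → R ⊑ S → okAll R o ≡ true
    okAll-unspanned {S} {R} {o} iS u p = okAll-anti {R} {S} o p (allF-intro (λ i → ind i (add S o)) λ i →
      ∉cl⇒ind i {S} {o} (iS i) (≢true λ c → true≢false (anyF-intro (λ i → cl i S o) i c) (not-true (∧-elimʳ (O o) u))))

    unspanned⇒∉ : ∀ {S o} → unspanned S o ≡ true → S o ≡ false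
    unspanned⇒∉ {S} {o} u = ≢true λ s → true≢false (anyF-intro (λ i → cl i S o) zero (cl-⊒ zero S o s)) (not-true (∧-elimʳ (O o) u))

    -- Elements of O that would have been accepted as replacements in window `suc x`, even at its
    -- very end.
    available : (Fin m → ℕ) → ℕ → Sub m
    available lab x e = spanned T zero e ∧ (not (cl zero (V x) e) ∧ allF λ j → not (cl (suc j) (U (suc x)) e))
      where open Run lab

    module _ {lab lab′ : Fin m → ℕ} (o : Fin m) (agree : ∀ e → o ≢ e → lab e ≡ lab′ e) where
      open Run lab
      module R′ = Run lab′

      private
        okT-sim : ∀ {S S′} e → o ≢ e → S ≗ S′ → okT S e ≡ R′.okT S′ e
        okT-sim {S} e ne p rewrite agree e ne | okAll-cong {S} e p = refl

        okF-sim : ∀ {S S′} e → o ≢ e → S ≗ S′ → okF S e ≡ R′.okF S′ e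
        okF-sim {S} e ne p rewrite agree e ne | okAll-cong {S} e p = refl

        okV-sim : T ≗ R′.T → ∀ {U U′} x → U ≗ U′ → ∀ {S S′} e → o ≢ e → S ≗ S′ → okV U x S e ≡ R′.okV U′ x S′ e
        okV-sim t {U} {U′} x u {S} {S′} e ne p
          rewrite agree e ne | ind-cong zero (add-cong {S = T} e t) | ind-cong zero (add-cong {S = S} e p)
                | allF-cong {f = λ j → ind (suc j) (add (U ∪ˢ S) e)} {λ j → ind (suc j) (add (U′ ∪ˢ S′) e)}
                    (λ j → ind-cong (suc j) (add-cong {S = U ∪ˢ S} {U′ ∪ˢ S′} e (λ y → cong₂ _∨_ (u y) (p y)))) = refl

      T-stable : T o ≡ false → lab′ o ≢ 0 → T ≗ R′.T
      T-stable t ne = greedy-absent o okT-sim (λ S → cong (_∧ okAll S o) (≡ᵇ-≢ ne)) (allFin m) (λ _ → refl) t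

      -- An element that the windows up to `x` did not pick had no influence on them, and under a
      -- later label it is not even considered there.
      UV-stable : ∀ x → U x o ≡ false → x < lab′ o → U x ≗ R′.U x
      V-stable : ∀ x → U (suc x) o ≡ false → suc x < lab′ o → V x ≗ R′.V x

      UV-stable zero    u lt = T-stable u (λ eq → <⇒≢ lt (sym eq))
      UV-stable (suc x) u lt e = cong₂ _∨_ (UV-stable x (≢true λ p → true≢false (∨-introˡ _ p) u) (≤-trans (n≤1+n _) lt) e) (V-stable x u lt e)

      V-stable x u lt = greedy-absent o (okV-sim t (suc x) us) (λ S → cong (_∧ (not (ind zero (add R′.T o)) ∧ (ind zero (add S o) ∧ allF λ j → ind (suc j) (add (R′.U x ∪ˢ S) o)))) (≡ᵇ-≢ (λ eq → <⇒≢ lt (sym eq))))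
        (allFin m) (λ _ → refl) (≢true λ p → true≢false (∨-introʳ (U x o) p) u)
        where
        ux : U x o ≡ false
        ux = ≢true λ p → true≢false (∨-introˡ _ p) u
        us : U x ≗ R′.U x
        us = UV-stable x ux (≤-trans (n≤1+n _) lt)
        t : T ≗ R′.T
        t = T-stable (≢true λ p → true≢false (T⊑U x o p) ux) (λ eq → <⇒≢ (≤-trans (s≤s z≤n) lt) (sym eq))

      join-T : unspanned T o ≡ true → lab′ o ≡ 0 → R′.T o ≡ true
      join-T u z = greedy-insert o okT-sim (∈-allFin o) (λ _ → refl) (unspanned⇒∉ {T} {o} u)
        (λ {R} p → ∧-intro (trans (cong (_≡ᵇ 0) z) refl) (okAll-unspanned {T} {R} {o} T-ind u p))

      -- Earlier windows are unchanged, and until it meets `o` the scan of window `suc x` holds a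
      -- subset of the old `V x`. As `o` is compatible with all of that set, it is accepted.
      join-V : ∀ x → available lab x o ≡ true → lab′ o ≡ suc x → R′.V x o ≡ true
      join-V x a z = greedy-insert o (okV-sim t (suc x) us) (∈-allFin o) (λ _ → refl) vx λ {R} p →
        ∧-intro (trans (cong (_≡ᵇ suc x) z) (≡ᵇ-refl (suc x)))
          (∧-intro (not-false (trans (sym (ind-cong zero (add-cong {S = T} o t))) dep))
            (∧-intro (ind-sub zero (add-mono {S = R} {V x} o p) (∉cl⇒ind zero {V x} {o} (V-ind x) a₂))
              (allF-intro (λ j → ind (suc j) (add (R′.U x ∪ˢ R) o)) λ j →
                ind-sub (suc j) (add-mono {S = R′.U x ∪ˢ R} {U (suc x)} o (∪-mono {S = R′.U x} {R} (≗⇒⊒ us) p))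
                  (∉cl⇒ind (suc j) {U (suc x)} {o} (U-ind (suc x) j) (a₃ j)))))
        where
        a₁ : spanned T zero o ≡ true
        a₁ = ∧-elimˡ (spanned T zero o) a
        a₂ : cl zero (V x) o ≡ false
        a₂ = not-true (∧-elimˡ (not (cl zero (V x) o)) (∧-elimʳ (spanned T zero o) a))
        a₃ : ∀ j → cl (suc j) (U (suc x)) o ≡ false
        a₃ j = not-true (allF-elim (λ j → not (cl (suc j) (U (suc x)) o)) (∧-elimʳ (not (cl zero (V x) o)) (∧-elimʳ (spanned T zero o) a)) j)
        u : U (suc x) o ≡ false
        u = ≢true λ p → true≢false (cl-⊒ (suc zero) (U (suc x)) o p) (a₃ zero)
        ux : U x o ≡ false
        ux = ≢true λ p → true≢false (∨-introˡ _ p) u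
        vx : V x o ≡ false
        vx = ≢true λ p → true≢false (∨-introʳ (U x o) p) u
        tx : T o ≡ false
        tx = ≢true λ p → true≢false (T⊑U x o p) ux
        t : T ≗ R′.T
        t = T-stable tx λ eq → 1+n≢0 (trans (sym z) eq)
        us : U x ≗ R′.U x
        us = UV-stable x ux (≤-reflexive (sym z))
        dep : ind zero (add T o) ≡ false
        dep = ≢true λ p → true≢false (ind∧∈cl⇒∈ zero {T} {o} p (∧-elimʳ (O o) a₁)) tx

      S₀-stable : ∀ ℓ d → U ℓ o ≡ false → ℓ < lab′ o → S₀ ℓ d ≗ R′.S₀ ℓ d
      S₀-stable zero    d u lt = UV-stable zero u lt
      S₀-stable (suc x) d u lt = greedy-cong
        (λ {S} e p → cong₂ _∧_ (V-stable x u lt e) (ind-cong zero (add-cong {S = S} e p))) (allFin m)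
        λ e → cong (_∧ not (d e)) (T-stable (≢true λ p → true≢false (T⊑U (suc x) o p) u) (λ eq → <⇒≢ (≤-trans (s≤s z≤n) lt) (sym eq)) e)

      -- Only elements outside `U ℓ` are moved, since taking away a picked element could change all
      -- that follows. The elements of O inside `U ℓ` are accounted for by `unspanned-split`.
      join-S : ∀ ℓ d → ℓ < k → U ℓ o ≡ false → unspanned (S ℓ d) o ≡ true → k ≤ lab′ o → R′.S ℓ d o ≡ true
      join-S ℓ d ℓ<k u un le = greedy-insert o okF-sim (∈-allFin o) (S₀-stable ℓ d u (≤-trans ℓ<k le)) (unspanned⇒∉ {S ℓ d} {o} un)
        (λ {R} p → ∧-intro (≤ᵇ-intro le) (okAll-unspanned {S ℓ d} {R} {o} (S-ind ℓ d) un p))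

    module _ (lab : Fin m → ℕ) where
      open Run lab

      -- This is the exchange with an unchanged label: `o` would be in `T`, whereas unspanned
      -- elements are not.
      T-maximal : ∀ o → lab o ≡ 0 → unspanned T o ≡ false
      T-maximal o z = ≢true λ u → true≢false (join-T {lab} {lab} o (λ _ _ → refl) u z) (unspanned⇒∉ {T} {o} u)

      V-maximal : ∀ x o → lab o ≡ suc x → available lab x o ≡ false
      V-maximal x o z = ≢true λ a → true≢false (cl-⊒ zero (V x) o (join-V {lab} {lab} o (λ _ _ → refl) x a z))
        (not-true (∧-elimˡ (not (cl zero (V x) o)) (∧-elimʳ (spanned T zero o) a)))

      S-maximal : ∀ ℓ d o → k ≤ lab o → unspanned (S ℓ d) o ≡ false
      S-maximal ℓ d o le = ≢true λ u → true≢false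
        (greedy-max okF okF-anti (∈-allFin o) (∧-intro (≤ᵇ-intro le) (okAll-unspanned {S ℓ d} {S ℓ d} {o} (S-ind ℓ d) u ⊑-refl)))
        (unspanned⇒∉ {S ℓ d} {o} u)

      -- Slots of level x are refilled, so its elements are spanned at the end.
      lost : ℕ → Sub m
      lost zero    = ∅ˢ
      lost (suc x) = U x ∩ˢ O

      unspanned-split : ∀ ℓ d → card (unspanned (S ℓ d)) ≤ card (unspanned (S ℓ d) ∖ˢ U ℓ) + card (lost ℓ)
      unspanned-split ℓ d = card-cover {g = unspanned (S ℓ d) ∖ˢ U ℓ} {lost ℓ} λ e u → go ℓ e u (bool? (U ℓ e))
        where
        go : ∀ ℓ e → unspanned (S ℓ d) e ≡ true → U ℓ e ≡ true ⊎ U ℓ e ≡ false →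
             (unspanned (S ℓ d) ∖ˢ U ℓ) e ≡ true ⊎ lost ℓ e ≡ true
        go ℓ       e u (inj₂ p) = inj₁ (∧-intro u (not-false p))
        go zero    e u (inj₁ p) = true≢false (T⊑S d e p) (unspanned⇒∉ {S 0 d} {e} u)
        go (suc x) e u (inj₁ p) with ∨-elim (U x e) p
        ... | inj₁ r = inj₂ (∧-intro r (∧-elimˡ (O e) u))
        ... | inj₂ r = true≢false (anyF-intro (λ i → cl i (S (suc x) d) e) zero
              (cl-mono zero (S₀⊑S (suc x) d) e (S₀-span x d e r))) (not-true (∧-elimʳ (O e) u))

  -- Averages over labels and coins

  opaque
    sumL : ∀ {A : Set} → List A → (A → ℕ) → ℕ
    sumL []       f = 0
    sumL (x ∷ xs) f = f x + sumL xs f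

    sumL-[] : ∀ {A : Set} (f : A → ℕ) → sumL [] f ≡ 0
    sumL-[] f = refl

    sumL-∷ : ∀ {A : Set} x xs (f : A → ℕ) → sumL (x ∷ xs) f ≡ f x + sumL xs f
    sumL-∷ x xs f = refl

    sumL-mono : ∀ {A : Set} (xs : List A) {f g} → (∀ x → f x ≤ g x) → sumL xs f ≤ sumL xs g
    sumL-mono []       p = z≤n
    sumL-mono (x ∷ xs) p = +-mono-≤ (p x) (sumL-mono xs p)

    sumL-cong : ∀ {A : Set} (xs : List A) {f g} → (∀ x → f x ≡ g x) → sumL xs f ≡ sumL xs g
    sumL-cong []       p = refl
    sumL-cong (x ∷ xs) p = cong₂ _+_ (p x) (sumL-cong xs p)

    sumL-+ : ∀ {A : Set} (xs : List A) f g → sumL xs (λ x → f x + g x) ≡ sumL xs f + sumL xs g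
    sumL-+ []       f g = refl
    sumL-+ (x ∷ xs) f g = trans (cong (f x + g x +_) (sumL-+ xs f g)) (lem (f x) (g x) _ _)
      where
      lem : ∀ a b c d → a + b + (c + d) ≡ a + c + (b + d)
      lem = solve-∀

    sumL-* : ∀ {A : Set} (xs : List A) c f → sumL xs (λ x → c * f x) ≡ c * sumL xs f
    sumL-* []       c f = sym (*-zeroʳ c)
    sumL-* (x ∷ xs) c f = trans (cong (c * f x +_) (sumL-* xs c f)) (sym (*-distribˡ-+ c (f x) _))

    sumL-const : ∀ {A : Set} (xs : List A) c → sumL xs (const c) ≡ length xs * c
    sumL-const []       c = refl
    sumL-const (x ∷ xs) c = cong (c +_) (sumL-const xs c)

    sumL-++ : ∀ {A : Set} (xs ys : List A) f → sumL (xs ++ ys) f ≡ sumL xs f + sumL ys f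
    sumL-++ []       ys f = refl
    sumL-++ (x ∷ xs) ys f = trans (cong (f x +_) (sumL-++ xs ys f)) (sym (+-assoc (f x) _ _))

    sumL-map : ∀ {A B : Set} (g : A → B) xs (f : B → ℕ) → sumL (map g xs) f ≡ sumL xs (f ∘ g)
    sumL-map g []       f = refl
    sumL-map g (x ∷ xs) f = cong (f (g x) +_) (sumL-map g xs f)

    sumL-swap : ∀ {A B : Set} (xs : List A) (ys : List B) (f : A → B → ℕ) →
                sumL xs (λ x → sumL ys (f x)) ≡ sumL ys (λ y → sumL xs (λ x → f x y))
    sumL-swap []       ys f = sym (trans (sumL-const ys 0) (*-zeroʳ (length ys)))
    sumL-swap (x ∷ xs) ys f = trans (cong (sumL ys (f x) +_) (sumL-swap xs ys f)) (sym (sumL-+ ys (f x) (λ y → sumL xs (λ x′ → f x′ y))))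

    sumL-sum : ∀ {A : Set} {n} (xs : List A) (f : A → Fin n → ℕ) →
               sumL xs (λ x → sum (f x)) ≡ sum (λ i → sumL xs (λ x → f x i))
    sumL-sum {n = n} []       f = sym (trans (sum-const n 0) (*-zeroʳ n))
    sumL-sum (x ∷ xs) f = trans (cong (sum (f x) +_) (sumL-sum xs f)) (sym (∑-distrib-+ (f x) _))

    sumL-tabulate : ∀ {A : Set} {n} (g : Fin n → A) f → sumL (tabulate g) f ≡ sum (f ∘ g)
    sumL-tabulate {n = zero}  g f = sym (sum-zero _)
    sumL-tabulate {n = suc n} g f = trans (cong (f (g zero) +_) (sumL-tabulate (g ∘ suc) f)) (sym (sum-suc _))

  sumL-allFin : ∀ {n} (f : Fin n → ℕ) → sumL (allFin n) f ≡ sum f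
  sumL-allFin f = sumL-tabulate id f

  sumL-product : ∀ {A B C : Set} (h : A → B → C) xs ys f →
                 sumL (cartesianProductWith h xs ys) f ≡ sumL xs (λ x → sumL ys (λ y → f (h x y)))
  sumL-product h []       ys f = trans (sumL-[] f) (sym (sumL-[] _))
  sumL-product h (x ∷ xs) ys f = trans (sumL-++ (map (h x) ys) _ f)
    (trans (cong₂ _+_ (sumL-map (h x) ys f) (sumL-product h xs ys f)) (sym (sumL-∷ x xs _)))

  allVec : ∀ {A : Set} → List A → ∀ m → List (Vec A m)
  allVec xs zero    = [] ∷ []
  allVec xs (suc m) = cartesianProductWith _∷_ xs (allVec xs m)

  module _ {A : Set} (xs : List A) where

    sum-allVec : ∀ {m} f → sumL (allVec xs (suc m)) f ≡ sumL xs (λ x → sumL (allVec xs m) (λ v → f (x ∷ v)))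
    sum-allVec {m} f = sumL-product _∷_ xs (allVec xs m) f

    -- Every vector arises by overwriting coordinate `o` from as many vectors as there are values.
    resample : ∀ {m} (o : Fin m) f →
      length xs * sumL (allVec xs m) f ≡ sumL (allVec xs m) (λ v → sumL xs (λ x → f (v [ o ]≔ x)))
    resample {suc m} zero f = begin
      length xs * sumL (allVec xs (suc m)) f                         ≡⟨ cong (length xs *_) (trans (sum-allVec f) (sumL-swap xs (allVec xs m) (λ x v → f (x ∷ v)))) ⟩
      length xs * sumL (allVec xs m) (λ v → sumL xs (λ x → f (x ∷ v))) ≡⟨ sym (sumL-const xs _) ⟩
      sumL xs (λ _ → sumL (allVec xs m) (λ v → sumL xs (λ x → f (x ∷ v)))) ≡⟨ sym (sum-allVec _) ⟩
      sumL (allVec xs (suc m)) (λ v → sumL xs (λ x → f (v [ zero ]≔ x))) ∎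
      where open ≡-Reasoning
    resample {suc m} (suc o) f = begin
      length xs * sumL (allVec xs (suc m)) f                         ≡⟨ cong (length xs *_) (sum-allVec f) ⟩
      length xs * sumL xs (λ y → sumL (allVec xs m) (λ v → f (y ∷ v))) ≡⟨ sym (sumL-* xs (length xs) _) ⟩
      sumL xs (λ y → length xs * sumL (allVec xs m) (λ v → f (y ∷ v))) ≡⟨ sumL-cong xs (λ y → resample o (λ v → f (y ∷ v))) ⟩
      sumL xs (λ y → sumL (allVec xs m) (λ v → sumL xs (λ x → f (y ∷ (v [ o ]≔ x))))) ≡⟨ sym (sum-allVec _) ⟩
      sumL (allVec xs (suc m)) (λ v → sumL xs (λ x → f (v [ suc o ]≔ x))) ∎
      where open ≡-Reasoning

    exchange : ∀ {m} .{{_ : NonZero (length xs)}} (o : Fin m) {c c′ : ℕ} {f g : Vec A m → ℕ} →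
      (∀ v → c * sumL xs (λ x → f (v [ o ]≔ x)) ≤ c′ * sumL xs (λ x → g (v [ o ]≔ x))) →
      c * sumL (allVec xs m) f ≤ c′ * sumL (allVec xs m) g
    exchange {m} o {c} {c′} {f} {g} h = *-cancelˡ-≤ (length xs) (begin
      length xs * (c * sumL (allVec xs m) f)                      ≡⟨ move c f ⟩
      sumL (allVec xs m) (λ v → c * sumL xs (λ x → f (v [ o ]≔ x)))   ≤⟨ sumL-mono (allVec xs m) h ⟩
      sumL (allVec xs m) (λ v → c′ * sumL xs (λ x → g (v [ o ]≔ x)))  ≡⟨ sym (move c′ g) ⟩
      length xs * (c′ * sumL (allVec xs m) g)                     ∎)
      where
      open ≤-Reasoning
      swap : ∀ a b c → a * (b * c) ≡ b * (a * c)
      swap = solve-∀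
      move : ∀ c f → length xs * (c * sumL (allVec xs m) f) ≡ sumL (allVec xs m) (λ v → c * sumL xs (λ x → f (v [ o ]≔ x)))
      move c f = trans (swap (length xs) c _) (trans (cong (c *_) (resample o f)) (sym (sumL-* (allVec xs m) c _)))

  coins : ∀ m → List (Vec Bool m)
  coins = allVec (true ∷ false ∷ [])

  -- Adding a fixed set permutes the coin sets. As these are compared as functions, `F` has to
  -- respect pointwise equality.
  sum-⊕ : ∀ {m} (F : Sub m → ℕ) → (∀ {d d′} → d ≗ d′ → F d ≡ F d′) → ∀ X →
          sumL (coins m) (λ v → F (lookup v ⊕ X)) ≡ sumL (coins m) (F ∘ lookup)
  sum-⊕ {zero}  F c X = sumL-cong (coins 0) λ v → c λ ()
  sum-⊕ {suc m} F c X = trans (sum-allVec bs _) (trans (sumL-cong bs one) (trans (toss (X zero)) (sym (sum-allVec bs _))))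
    where
    bs = true ∷ false ∷ []
    cons : Bool → Sub m → Sub (suc m)
    cons b d zero    = b
    cons b d (suc e) = d e
    G : Bool → ℕ
    G b = sumL (coins m) (λ v → F (lookup (b ∷ v)))
    cons-≗ : ∀ {b d d′} → d ≗ d′ → cons b d ≗ cons b d′
    cons-≗ p zero    = refl
    cons-≗ p (suc e) = p e
    one : ∀ b → sumL (coins m) (λ v → F (lookup (b ∷ v) ⊕ X)) ≡ G (b xor X zero)
    one b = trans (sumL-cong (coins m) λ v → c {lookup (b ∷ v) ⊕ X} {cons (b xor X zero) (lookup v ⊕ (X ∘ suc))} λ { zero → refl ; (suc e) → refl })
      (trans (sum-⊕ (F ∘ cons (b xor X zero)) (c ∘ cons-≗) (X ∘ suc))
             (sumL-cong (coins m) λ v → c λ { zero → refl ; (suc e) → refl }))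
    toss : ∀ x → sumL bs (λ b → G (b xor x)) ≡ sumL bs G
    toss false = sumL-cong bs λ { true → refl ; false → refl }
    toss true  = trans (two _) (trans (+-comm (G false) (G true)) (sym (two G)))
      where
      two : ∀ f → sumL bs f ≡ f true + f false
      two f = trans (sumL-∷ true _ f) (cong (f true +_) (trans (sumL-∷ false [] f) (trans (cong (f false +_) (sumL-[] f)) (+-identityʳ _))))

  -- Waste and exhaustion for fixed labels

  module Core {m q} (Ms : Fin (suc (suc q)) → Mat m) (O : Sub m) (Oind : ∀ i → Mat.ind (Ms i) O ≡ true) (lab : Fin m → ℕ) where

    open Process Ms O Oind
    open Exchange Ms O Oind
    open Run lab
    open Multi Ms O Oind

    -- By `balance`, the gain of level ℓ over |O| / k, apart from unspanned elements.
    waste : ℕ → Sub m → ℕ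
    waste ℓ d = excess (S ℓ d) (assign (S ℓ d))

    S-cong : ∀ ℓ {d d′} → d ≗ d′ → S ℓ d ≗ S ℓ d′
    S-cong ℓ {d} {d′} p = greedy-cong {ok = okF} {okF} (λ {R} e r → cong ((k ≤ᵇ lab e) ∧_) (okAll-cong {R} e r)) (allFin m) (S₀-cong ℓ)
      where
      S₀-cong : ∀ ℓ → S₀ ℓ d ≗ S₀ ℓ d′
      S₀-cong zero    e = refl
      S₀-cong (suc x) = greedy-cong (λ {R} e r → cong (V x e ∧_) (ind-cong zero (add-cong {S = R} e r))) (allFin m)
        λ e → cong (λ b → T e ∧ not b) (p e)

    -- By `balance` the waste is determined by two cardinalities, so the assignments need not be
    -- compared.
    W-cong : ∀ ℓ {d d′} → d ≗ d′ → waste ℓ d ≡ waste ℓ d′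
    W-cong ℓ {d} {d′} p = +-cancelˡ-≡ (card O) _ _ (trans (sym (balance (S-ind ℓ d)))
      (trans (cong₂ (λ a b → k * a + b) (card-cong s) (card-cong λ e → cong (λ b → O e ∧ not b) (anyF-cong λ i → cl-cong i e)))
             (balance (S-ind ℓ d′))))
      where
      s : S ℓ d ≗ S ℓ d′
      s = S-cong ℓ p
      anyF-cong : ∀ {n} {f g : Fin n → Bool} → f ≗ g → anyF f ≡ anyF g
      anyF-cong {zero}  r = refl
      anyF-cong {suc n} r = cong₂ _∨_ (r zero) (anyF-cong (r ∘ suc))
      cl-cong : ∀ i → cl i (S ℓ d) ≗ cl i (S ℓ d′)
      cl-cong i e = iff (cl-mono i (≗⇒⊑ s) e) (cl-mono i (≗⇒⊒ s) e)

    α : ℕ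
    α = card (unspanned T)

    levels : ℕ
    levels = suc q

    -- The solution is taken before the final greedy window, where dropping acts monotonically, but
    -- the assignment is that of the final solution. By `exc-mono` the resulting excess is still at
    -- most the waste.
    module L (x : ℕ) = Level Ms O Oind T (V x) T-ind (V-ind x) (V⊑cl x) (TV-ind x) (TV-disj x)
      (S₀ (suc x)) (S₀-kept x) (S₀-sub x) (S₀-ind₀ x) (S₀-span x) (λ {d} {d′} → S₀-mono x {d} {d′})
      (λ d → assign (S (suc x) d)) (λ d → assign-partial (S (suc x) d))

    s : ℕ → Sub m → ℕ
    s x d = L.Four.s x d

    W4 : ℕ → Sub m → ℕ
    W4 x d = waste (suc x) d + waste (suc x) (d ⊕ L.T₀ x) + (waste (suc x) (d ⊕ L.T₁ x) + waste (suc x) (d ⊕ T))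

    s≤W4 : ∀ x d → s x d ≤ W4 x d
    s≤W4 x d = +-mono-≤ (+-mono-≤ (le _) (le _)) (+-mono-≤ (le _) (le _))
      where
      le : ∀ d → excess (S₀ (suc x) d) (assign (S (suc x) d)) ≤ waste (suc x) d
      le d = sum-mono λ i → exc-mono i (assign (S (suc x) d) i) (S₀⊑S (suc x) d)

    -- `T₀`, `T₁` and `T` depend on the labels only, so for fixed labels the four coin sets have the
    -- same distribution.
    sum-s : ∀ x → sumL (coins m) (s x ∘ lookup) ≤ 4 * sumL (coins m) (waste (suc x) ∘ lookup)
    sum-s x = begin
      sumL cs (s x ∘ lookup)                       ≤⟨ sumL-mono cs (s≤W4 x ∘ lookup) ⟩
      sumL cs (W4 x ∘ lookup)                      ≡⟨ trans (sumL-+ cs _ _) (cong₂ _+_ (sumL-+ cs _ _) (sumL-+ cs _ _)) ⟩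
      sumL cs (w ∘ lookup) + sumL cs (λ v → w (lookup v ⊕ L.T₀ x)) + (sumL cs (λ v → w (lookup v ⊕ L.T₁ x)) + sumL cs (λ v → w (lookup v ⊕ T)))
        ≡⟨ cong₂ _+_ (cong (sumL cs (w ∘ lookup) +_) (inv (L.T₀ x))) (cong₂ _+_ (inv (L.T₁ x)) (inv T)) ⟩
      sumL cs (w ∘ lookup) + sumL cs (w ∘ lookup) + (sumL cs (w ∘ lookup) + sumL cs (w ∘ lookup)) ≡⟨ lem (sumL cs (w ∘ lookup)) ⟩
      4 * sumL cs (w ∘ lookup)                     ∎
      where
      open ≤-Reasoning
      cs = coins m
      w : Sub m → ℕ
      w = waste (suc x)
      inv : ∀ X → sumL cs (λ v → w (lookup v ⊕ X)) ≡ sumL cs (w ∘ lookup)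
      inv = sum-⊕ w (W-cong (suc x))
      lem : ∀ a → a + a + (a + a) ≡ 4 * a
      lem = solve-∀

    V-∩O : ∀ x d → levels * card (V x ∩ˢ O) ≤ 3 * s x d + α
    V-∩O x d = L.Four.level-∩O x d

    U⊑ : ∀ n → U n ⊑ T ∪ˢ ⋃ˢ {n} (V ∘ toℕ)
    U⊑ zero    e p = ∨-introˡ _ p
    U⊑ (suc n) e p with ∨-elim (U n e) p
    ... | inj₂ r = ∨-introʳ (T e) (subst (λ z → ⋃ˢ {suc n} (V ∘ toℕ) z ≡ true) refl
                     (anyF-intro (λ i → V (toℕ i) e) (fromℕ< (n<1+n n)) (subst (λ z → V z e ≡ true) (sym (toℕ-fromℕ< (n<1+n n))) r)))
    ... | inj₁ r with ∨-elim (T e) (U⊑ n e r)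
    ...   | inj₁ t = ∨-introˡ _ t
    ...   | inj₂ t with anyF-elim (λ i → V (toℕ i) e) t
    ...     | i , v = ∨-introʳ (T e) (anyF-intro (λ i → V (toℕ i) e) (fromℕ< (≤-trans (toℕ<n i) (n≤1+n n)))
                        (subst (λ z → V z e ≡ true) (sym (toℕ-fromℕ< (≤-trans (toℕ<n i) (n≤1+n n)))) v))

    sum-last : ∀ n (f : ℕ → ℕ) → sum {suc n} (f ∘ toℕ) ≡ sum {n} (f ∘ toℕ) + f n
    sum-last zero    f = trans (sum-suc _) (trans (cong (f 0 +_) (sum-zero _)) (trans (+-identityʳ _) (cong (_+ f 0) (sym (sum-zero _)))))
    sum-last (suc n) f = trans (sum-suc (f ∘ toℕ)) (trans (cong (f 0 +_) (sum-last n (f ∘ suc)))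
      (trans (sym (+-assoc (f 0) _ _)) (cong (_+ f (suc n)) (sym (sum-suc {n} (f ∘ toℕ))))))

    U-card : ∀ n → card T + sum {n} (λ i → card (V (toℕ i))) ≡ card (U n)
    U-card zero    = trans (cong (card T +_) (sum-zero _)) (+-identityʳ _)
    U-card (suc n) = trans (cong (card T +_) (sum-last n (card ∘ V))) (trans (sym (+-assoc (card T) _ _))
      (trans (cong (_+ card (V n)) (U-card n)) (sym (card-disjoint {f = U n} {V n} λ e → UV-disj n e))))

    Av : ℕ → Sub m
    Av = available lab

    core : ∀ d → card T ≤ 4 * (k * sum {levels} (λ i → s (toℕ i) d)) + (k + k) * k * (deficit T + card (doubly T) + α)
                          + sum {levels} (λ i → card (Av (toℕ i)))
    core d = Levels.exhaustion T (V ∘ toℕ) (U levels) (U⊑ levels) (U-ind levels zero) (≤-reflexive (U-card levels))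
      (λ i → L.Four.H (toℕ i) d) (λ i → L.Four.H⊑O (toℕ i) d) (λ i → s (toℕ i) d)
      (λ i → L.Four.level-excess (toℕ i) d) (λ i → L.Four.H-avoids (toℕ i) d) (Av ∘ toℕ)
      (λ i o p → tri (toℕ i) (toℕ<n i) o p (bool? (cl zero (V (toℕ i)) o)) (bool? (anyF λ j → cl (suc j) (U levels) o)))
      where
      tri : ∀ x → x < levels → ∀ o → spanned T zero o ≡ true →
            cl zero (V x) o ≡ true ⊎ cl zero (V x) o ≡ false →
            (anyF λ j → cl (suc j) (U levels) o) ≡ true ⊎ (anyF λ j → cl (suc j) (U levels) o) ≡ false →
            cl zero (V x) o ≡ true ⊎ (∃[ j ] cl (suc j) (U levels) o ≡ true) ⊎ Av x o ≡ true
      tri x lt o p (inj₁ v) _ = inj₁ v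
      tri x lt o p (inj₂ v) (inj₁ c) = inj₂ (inj₁ (anyF-elim (λ j → cl (suc j) (U levels) o) c))
      tri x lt o p (inj₂ v) (inj₂ c) = inj₂ (inj₂ (∧-intro p (∧-intro (not-false v)
        (allF-intro (λ j → not (cl (suc j) (U (suc x)) o)) λ j → not-false (≢true λ r →
          true≢false (anyF-intro (λ j → cl (suc j) (U levels) o) j (cl-mono (suc j) sub o r)) c)))))
        where
        sub : U (suc x) ⊑ U levels
        sub = subst (λ z → U (suc x) ⊑ U z) (m∸n+n≡m lt) (U-mono {suc x} (levels ∸ suc x))

  -- Totals over all labels and coins

  count< : ∀ k r → sum {k + r} (λ x → bit (toℕ x <ᵇ k)) ≡ k
  count< zero    r = trans (sum-const r 0) (*-zeroʳ r)
  count< (suc k) r = trans (sum-suc {k + r} _) (cong suc (count< k r))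

  count≥ : ∀ k r → sum {k + r} (λ x → bit (k ≤ᵇ toℕ x)) ≡ r
  count≥ zero    r = trans (sum-const r 1) (*-identityʳ r)
  count≥ (suc k) r = trans (sum-suc {k + r} _) (trans (sum-cong-≗ λ x → cong bit (lem k (toℕ x))) (count≥ k r))
    where
    lem : ∀ k x → (k <ᵇ suc x) ≡ (k ≤ᵇ x)
    lem zero    x = refl
    lem (suc k) x = refl

  -- For one element, `f` marks the labels at which it is left out and `g` those at which it is
  -- picked. Failure at any label means success at `a`, where failure is impossible: at most `n`
  -- failures per success.
  sum-slot : ∀ {n} (f g : Fin (suc n) → ℕ) a → f a ≡ 0 → (∀ x → f x ≤ g a) → sum f ≤ n * sum g
  sum-slot {n} f g a z h = ≤-trans (+-cancelʳ-≤ (g a) _ _ (begin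
    sum f + g a                               ≡⟨ cong (sum f +_) (sym (trans (sum-*ˡ (g a) (bit ∘ [ a ]ˢ)) (trans (cong (g a *_) (card-[] a)) (*-identityʳ (g a))))) ⟩
    sum f + sum (λ x → g a * bit ([ a ]ˢ x))  ≡⟨ sym (∑-distrib-+ f (λ x → g a * bit ([ a ]ˢ x))) ⟩
    sum (λ x → f x + g a * bit ([ a ]ˢ x))    ≤⟨ sum-mono point ⟩
    sum {suc n} (const (g a))                 ≡⟨ sum-const (suc n) (g a) ⟩
    g a + n * g a                             ≡⟨ +-comm (g a) _ ⟩
    n * g a + g a                             ∎)) (*-monoʳ-≤ n (sum-term g a))
    where
    open ≤-Reasoning
    point : ∀ x → f x + g a * bit ([ a ]ˢ x) ≤ g a
    point x with bool? ([ a ]ˢ x)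
    ... | inj₂ p rewrite p | *-zeroʳ (g a) | +-identityʳ (f x) = h x
    ... | inj₁ p rewrite p | sym ([]-elim a x p) | z = ≤-reflexive (*-identityʳ (g a))

  -- Failures occur only at the first `k` labels, and a single one makes all `c * k` late labels
  -- successful. Pairs of labels are counted in two ways.
  sum-late : ∀ k .{{_ : NonZero k}} c (f g : Fin (k + c * k) → ℕ) → (∀ x → k ≤ toℕ x → f x ≡ 0) →
             (∀ x y → k ≤ toℕ y → f x ≤ g y) → c * sum f ≤ sum g
  sum-late k c f g z h = *-cancelˡ-≤ k (begin
    k * (c * sum f)                                                 ≡⟨ lem k c (sum f) ⟩
    (c * k) * sum f                                                 ≡⟨ cong (_* sum f) (sym (count≥ k (c * k))) ⟩
    sum late * sum f                                                ≡⟨ sym (sum-*ˡ (sum late) f) ⟩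
    sum (λ x → sum late * f x)                                      ≡⟨ sum-cong-≗ (λ x → trans (*-comm (sum late) (f x)) (sym (sum-*ˡ (f x) late))) ⟩
    sum (λ x → sum (λ y → f x * late y))                            ≤⟨ sum-mono (λ x → sum-mono λ y → point x y) ⟩
    sum (λ x → sum (λ y → early x * g y))                           ≡⟨ sum-cong-≗ (λ x → trans (sum-*ˡ (early x) g) (*-comm (early x) (sum g))) ⟩
    sum (λ x → sum g * early x)                                     ≡⟨ trans (sum-*ˡ (sum g) early) (*-comm (sum g) _) ⟩
    sum early * sum g                                               ≡⟨ cong (_* sum g) (count< k (c * k)) ⟩
    k * sum g                                                       ∎)
    where
    open ≤-Reasoning
    late early : Fin (k + c * k) → ℕ
    late y = bit (k ≤ᵇ toℕ y)
    early x = bit (toℕ x <ᵇ k)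
    lem : ∀ k c s → k * (c * s) ≡ (c * k) * s
    lem = solve-∀
    point : ∀ x y → f x * late y ≤ early x * g y
    point x y with bool? (k ≤ᵇ toℕ y)
    ... | inj₂ p rewrite p | *-zeroʳ (f x) = z≤n
    ... | inj₁ p rewrite p | *-identityʳ (f x) with bool? (toℕ x <ᵇ k)
    ...   | inj₁ r rewrite r = ≤-trans (h x y (≤ᵇ-elim k (toℕ y) p)) (≤-reflexive (sym (+-identityʳ (g y))))
    ...   | inj₂ r = ≤-trans (≤-reflexive (z x (≮⇒≥ λ lt → true≢false (Equivalence.to T-≡ (<⇒<ᵇ lt)) r))) z≤n

  module Totals {m q} (Ms : Fin (suc (suc q)) → Mat m) (O : Sub m) (Oind : ∀ i → Mat.ind (Ms i) O ≡ true) where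

    open Process Ms O Oind hiding (module R)
    open Exchange Ms O Oind hiding (module R′)
    open Multi Ms O Oind using (doubly; doubly-bound)

    -- With 5k late labels, the misses outside `U` are at most a fifth of |S ∩ O|, so they consume
    -- only a small part of the waste.
    n N : ℕ
    n = suc q
    N = k + 5 * k

    N′ : ℕ
    N′ = n + 5 * k

    Labels : Set
    Labels = Vec (Fin N) m

    lab : Labels → Fin m → ℕ
    lab v e = toℕ (lookup v e)

    module C′ (v : Labels) = Core Ms O Oind (lab v)
    module P′ (v : Labels) = Run (lab v)

    Ls : List Labels
    Ls = allVec (allFin N) m

    Cs : List (Vec Bool m)
    Cs = coins m

    Σ₂ : (Labels → Sub m → ℕ) → ℕ
    Σ₂ f = sumL Ls λ v → sumL Cs λ c → f v (lookup c)

    Σ₁ : (Labels → ℕ) → ℕ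
    Σ₁ f = Σ₂ λ v _ → f v

    Σ₂-mono : ∀ {f g} → (∀ v d → f v d ≤ g v d) → Σ₂ f ≤ Σ₂ g
    Σ₂-mono h = sumL-mono Ls λ v → sumL-mono Cs λ c → h v (lookup c)

    Σ₂-cong : ∀ {f g} → (∀ v d → f v d ≡ g v d) → Σ₂ f ≡ Σ₂ g
    Σ₂-cong h = sumL-cong Ls λ v → sumL-cong Cs λ c → h v (lookup c)

    Σ₂-+ : ∀ f g → Σ₂ (λ v d → f v d + g v d) ≡ Σ₂ f + Σ₂ g
    Σ₂-+ f g = trans (sumL-cong Ls λ v → sumL-+ Cs (f v ∘ lookup) (g v ∘ lookup)) (sumL-+ Ls _ _)

    Σ₂-* : ∀ c f → Σ₂ (λ v d → c * f v d) ≡ c * Σ₂ f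
    Σ₂-* c f = trans (sumL-cong Ls λ v → sumL-* Cs c (f v ∘ lookup)) (sumL-* Ls c _)

    Σ₂-sum : ∀ {r} (f : Labels → Sub m → Fin r → ℕ) → Σ₂ (λ v d → sum (f v d)) ≡ sum (λ i → Σ₂ (λ v d → f v d i))
    Σ₂-sum f = trans (sumL-cong Ls λ v → sumL-sum Cs (λ c → f v (lookup c))) (sumL-sum Ls _)

    Σ₂-≤+ : ∀ {f g h} → (∀ v d → f v d ≤ g v d + h v d) → Σ₂ f ≤ Σ₂ g + Σ₂ h
    Σ₂-≤+ {g = g} {h} p = ≤-trans (Σ₂-mono p) (≤-reflexive (Σ₂-+ g h))

    Λ : ℕ
    Λ = Σ₁ (const 1)

    Σ₁-const : ∀ c → Σ₁ (const c) ≡ Λ * c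
    Σ₁-const c = trans (Σ₂-cong (λ _ _ → sym (*-identityʳ c))) (trans (Σ₂-* c (λ _ _ → 1)) (*-comm c Λ))

    w : ℕ → ℕ
    w ℓ = Σ₂ λ v d → C′.waste v ℓ d

    size miss early-miss : ℕ → ℕ
    size ℓ = Σ₂ λ v d → card (P′.S v ℓ d)
    miss ℓ = Σ₂ λ v d → card (unspanned (P′.S v ℓ d))
    early-miss ℓ = Σ₂ λ v d → card (unspanned (P′.S v ℓ d) ∖ˢ P′.U v ℓ)

    tα tT TO tδ : ℕ
    tα = Σ₁ λ v → C′.α v
    tT = Σ₁ λ v → card (P′.T v)
    TO = Σ₁ λ v → card (P′.T v ∩ˢ O)
    tδ = Σ₁ λ v → deficit (P′.T v) + card (doubly (P′.T v))

    VO AV UO : ℕ → ℕ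
    VO x = Σ₁ λ v → card (P′.V v x ∩ˢ O)
    AV x = Σ₁ λ v → card (C′.Av v x)
    UO x = Σ₁ λ v → card (P′.U v x ∩ˢ O)

    size-miss : ∀ ℓ → k * size ℓ + miss ℓ ≡ Λ * card O + w ℓ
    size-miss ℓ = begin
      k * size ℓ + miss ℓ                                    ≡⟨ cong (_+ miss ℓ) (sym (Σ₂-* k (λ v d → card (P′.S v ℓ d)))) ⟩
      Σ₂ (λ v d → k * card (P′.S v ℓ d)) + miss ℓ            ≡⟨ sym (Σ₂-+ (λ v d → k * card (P′.S v ℓ d)) (λ v d → card (unspanned (P′.S v ℓ d)))) ⟩
      Σ₂ (λ v d → k * card (P′.S v ℓ d) + card (unspanned (P′.S v ℓ d))) ≡⟨ Σ₂-cong (λ v d → balance (P′.S-ind v ℓ d)) ⟩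
      Σ₂ (λ v d → card O + C′.waste v ℓ d)                       ≡⟨ Σ₂-+ (λ _ _ → card O) (λ v d → C′.waste v ℓ d) ⟩
      Σ₁ (const (card O)) + w ℓ                              ≡⟨ cong (_+ w ℓ) (Σ₁-const (card O)) ⟩
      Λ * card O + w ℓ                                       ∎
      where open ≡-Reasoning

    S∩O≤ : ∀ ℓ → n * Σ₂ (λ v d → card (P′.S v ℓ d ∩ˢ O)) ≤ w ℓ
    S∩O≤ ℓ = ≤-trans (≤-reflexive (sym (Σ₂-* n (λ v d → card (P′.S v ℓ d ∩ˢ O))))) (Σ₂-mono λ v d → excess-∩O {P′.S v ℓ d} (assign-partial (P′.S v ℓ d)))

    TO≤ : n * TO ≤ w 0
    TO≤ = ≤-trans (*-monoʳ-≤ n (Σ₂-mono λ v d → card-mono λ e p →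
      ∧-intro (P′.T⊑S v d e (∧-elimˡ (P′.T v e) p)) (∧-elimʳ (P′.T v e) p))) (S∩O≤ 0)

    private
      instance
        nz : NonZero (length (allFin N))
        nz = >-nonZero (≤-trans (s≤s z≤n) (≤-reflexive (sym (List.length-tabulate {n = N} id))))

      at-o : ∀ (v : Labels) o x → lab (v [ o ]≔ x) o ≡ toℕ x
      at-o v o x = cong toℕ (lookup∘update o v x)

      off-o : ∀ (v : Labels) o x y e → o ≢ e → lab (v [ o ]≔ x) e ≡ lab (v [ o ]≔ y) e
      off-o v o x y e ne = cong toℕ (trans (lookup∘update′ (ne ∘ sym) v x) (sym (lookup∘update′ (ne ∘ sym) v y)))

      per-element : ∀ c c′ (f g : Labels → Sub m → Sub m) →
        (∀ o d → c * sumL Ls (λ v → bit (f v d o)) ≤ c′ * sumL Ls (λ v → bit (g v d o))) →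
        c * Σ₂ (λ v d → card (f v d)) ≤ c′ * Σ₂ (λ v d → card (g v d))
      per-element c c′ f g h = begin
        c * Σ₂ (λ v d → card (f v d))                                   ≡⟨ norm c f ⟩
        sum (λ o → sumL Cs (λ d → c * sumL Ls (λ v → bit (f v (lookup d) o))))   ≤⟨ sum-mono (λ o → sumL-mono Cs λ d → h o (lookup d)) ⟩
        sum (λ o → sumL Cs (λ d → c′ * sumL Ls (λ v → bit (g v (lookup d) o))))  ≡⟨ sym (norm c′ g) ⟩
        c′ * Σ₂ (λ v d → card (g v d))                                  ∎
        where
        open ≤-Reasoning
        norm : ∀ c f → c * Σ₂ (λ v d → card (f v d)) ≡ sum (λ o → sumL Cs (λ d → c * sumL Ls (λ v → bit (f v (lookup d) o))))
        norm c f = trans (cong (c *_) (Σ₂-sum (λ v d o → bit (f v d o))))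
          (trans (sym (sum-*ˡ c _)) (sum-cong-≗ λ o →
            trans (cong (c *_) (sumL-swap Ls Cs (λ v d → bit (f v (lookup d) o))))
                  (sym (sumL-* Cs c _))))

      slot : ∀ (f g : Labels → Sub m) (a : Fin N) →
        (∀ v o x → lookup v o ≡ a → f v o ≡ false) →
        (∀ v o x → f (v [ o ]≔ x) o ≡ true → g (v [ o ]≔ a) o ≡ true) →
        Σ₁ (λ v → card (f v)) ≤ N′ * Σ₁ (λ v → card (g v))
      slot f g a z h = ≤-trans (≤-reflexive (sym (*-identityˡ _))) (per-element 1 N′ (λ v _ → f v) (λ v _ → g v) λ o _ →
        exchange (allFin N) o {1} {N′} λ v → ≤-trans (≤-reflexive (trans (*-identityˡ _) (sumL-allFin _)))
          (≤-trans (sum-slot _ _ a (cong bit (z (v [ o ]≔ a) o a (lookup∘update o v a))) (λ x → bit-mono (h v o x)))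
                   (≤-reflexive (cong (N′ *_) (sym (sumL-allFin (λ x → bit (g (v [ o ]≔ x) o))))))))

    tα≤ : tα ≤ N′ * TO
    tα≤ = slot (λ v → unspanned (P′.T v)) (λ v → P′.T v ∩ˢ O) zero
      (λ v o _ eq → T-maximal (lab v) o (cong toℕ eq))
      (λ v o x u → ∧-intro (join-T {lab (v [ o ]≔ x)} {lab (v [ o ]≔ zero)} o (off-o v o x zero) u (at-o v o zero)) (∧-elimˡ (O o) u))

    AV≤ : ∀ x → x < n → AV x ≤ N′ * VO x
    AV≤ x lt = slot (λ v → C′.Av v x) (λ v → P′.V v x ∩ˢ O) a
      (λ v o _ eq → V-maximal (lab v) x o (trans (cong toℕ eq) toℕa))
      (λ v o y av → ∧-intro (join-V {lab (v [ o ]≔ y)} {lab (v [ o ]≔ a)} o (off-o v o y a) x av (trans (at-o v o a) toℕa))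
                            (∧-elimˡ (O o) (∧-elimˡ (spanned (P′.T (v [ o ]≔ y)) zero o) av)))
      where
      lt′ : suc x < N
      lt′ = ≤-trans (s≤s lt) (m≤m+n k (5 * k))
      a : Fin N
      a = fromℕ< lt′
      toℕa : toℕ a ≡ suc x
      toℕa = toℕ-fromℕ< lt′

    early-miss≤ : ∀ ℓ → ℓ < k → 5 * early-miss ℓ ≤ Σ₂ (λ v d → card (P′.S v ℓ d ∩ˢ O))
    early-miss≤ ℓ lt = ≤-trans (per-element 5 1 f g λ o d → exchange (allFin N) o {5} {1} λ v →
        ≤-trans (≤-reflexive (cong (5 *_) (sumL-allFin (λ x → bit (f (v [ o ]≔ x) d o)))))
          (≤-trans (sum-late k 5 _ (λ x → bit (g (v [ o ]≔ x) d o)) (late v o d) (dom v o d))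
                   (≤-reflexive (trans (sym (sumL-allFin _)) (sym (*-identityˡ _))))))
      (≤-reflexive (*-identityˡ _))
      where
      f g : Labels → Sub m → Sub m
      f v d = unspanned (P′.S v ℓ d) ∖ˢ P′.U v ℓ
      g v d = P′.S v ℓ d ∩ˢ O
      late : ∀ v o d x → k ≤ toℕ x → bit (f (v [ o ]≔ x) d o) ≡ 0
      late v o d x le = cong bit (≢true λ p → true≢false (∧-elimˡ (unspanned (P′.S (v [ o ]≔ x) ℓ d) o) p)
        (S-maximal (lab (v [ o ]≔ x)) ℓ d o (≤-trans le (≤-reflexive (sym (at-o v o x))))))
      dom : ∀ v o d x y → k ≤ toℕ y → bit (f (v [ o ]≔ x) d o) ≤ bit (g (v [ o ]≔ y) d o)
      dom v o d x y le = bit-mono λ p → ∧-intro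
        (join-S {lab (v [ o ]≔ x)} {lab (v [ o ]≔ y)} o (off-o v o x y) ℓ d lt
          (not-true (∧-elimʳ (unspanned (P′.S (v [ o ]≔ x) ℓ d) o) p))
          (∧-elimˡ (unspanned (P′.S (v [ o ]≔ x) ℓ d) o) p) (≤-trans le (≤-reflexive (sym (at-o v o y)))))
        (∧-elimˡ (O o) (∧-elimˡ (unspanned (P′.S (v [ o ]≔ x) ℓ d) o) p))

    sum-s≤ : ∀ x → Σ₂ (λ v d → C′.s v x d) ≤ 4 * w (suc x)
    sum-s≤ x = ≤-trans (sumL-mono Ls λ v → C′.sum-s v x) (≤-reflexive (sumL-* Ls 4 _))

    VO≤ : ∀ x → n * VO x ≤ 12 * w (suc x) + tα
    VO≤ x = begin
      n * VO x                                          ≡⟨ sym (Σ₂-* n (λ v d → card (P′.V v x ∩ˢ O))) ⟩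
      Σ₂ (λ v d → n * card (P′.V v x ∩ˢ O))             ≤⟨ Σ₂-≤+ {g = λ v d → 3 * C′.s v x d} (λ v d → C′.V-∩O v x d) ⟩
      Σ₂ (λ v d → 3 * C′.s v x d) + tα                  ≡⟨ cong (_+ tα) (Σ₂-* 3 (λ v d → C′.s v x d)) ⟩
      3 * Σ₂ (λ v d → C′.s v x d) + tα                  ≤⟨ +-monoˡ-≤ tα (*-monoʳ-≤ 3 (sum-s≤ x)) ⟩
      3 * (4 * w (suc x)) + tα                          ≡⟨ cong (_+ tα) (sym (*-assoc 3 4 (w (suc x)))) ⟩
      12 * w (suc x) + tα                               ∎
      where open ≤-Reasoning

    tT≤ : tT ≤ 16 * (k * sum {n} (λ i → w (suc (toℕ i)))) + (k + k) * k * (tδ + tα) + sum {n} (λ i → AV (toℕ i))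
    tT≤ = begin
      tT
        ≤⟨ Σ₂-mono (λ v d → C′.core v d) ⟩
      Σ₂ (λ v d → 4 * (k * sum {n} (λ i → C′.s v (toℕ i) d)) + (k + k) * k * (deficit (P′.T v) + card (doubly (P′.T v)) + C′.α v)
            + sum {n} (λ i → card (C′.Av v (toℕ i))))
        ≡⟨ split ⟩
      4 * (k * sum {n} (λ i → Σ₂ (λ v d → C′.s v (toℕ i) d))) + (k + k) * k * (tδ + tα) + sum {n} (λ i → AV (toℕ i))
        ≤⟨ +-monoˡ-≤ (sum {n} (λ i → AV (toℕ i))) (+-monoˡ-≤ ((k + k) * k * (tδ + tα)) (≤-trans
             (*-monoʳ-≤ 4 (*-monoʳ-≤ k (≤-trans (sum-mono {n} λ i → sum-s≤ (toℕ i)) (≤-reflexive (sum-*ˡ 4 (λ i → w (suc (toℕ i))))))))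
             (≤-reflexive (lem k (sum {n} (λ i → w (suc (toℕ i)))))))) ⟩
      16 * (k * sum {n} (λ i → w (suc (toℕ i)))) + (k + k) * k * (tδ + tα) + sum {n} (λ i → AV (toℕ i)) ∎
      where
      open ≤-Reasoning
      f₁ f₂ f₃ : Labels → Sub m → ℕ
      f₁ v d = sum {n} (λ i → C′.s v (toℕ i) d)
      f₂ v d = deficit (P′.T v) + card (doubly (P′.T v)) + C′.α v
      f₃ v d = sum {n} (λ i → card (C′.Av v (toℕ i)))
      split : Σ₂ (λ v d → 4 * (k * f₁ v d) + (k + k) * k * f₂ v d + f₃ v d)
              ≡ 4 * (k * sum {n} (λ i → Σ₂ (λ v d → C′.s v (toℕ i) d))) + (k + k) * k * (tδ + tα) + sum {n} (λ i → AV (toℕ i))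
      split = trans (Σ₂-+ (λ v d → 4 * (k * f₁ v d) + (k + k) * k * f₂ v d) f₃)
        (cong₂ _+_ (trans (Σ₂-+ (λ v d → 4 * (k * f₁ v d)) (λ v d → (k + k) * k * f₂ v d))
          (cong₂ _+_ (trans (Σ₂-* 4 (λ v d → k * f₁ v d)) (cong (4 *_) (trans (Σ₂-* k f₁) (cong (k *_) (Σ₂-sum (λ v d (i : Fin n) → C′.s v (toℕ i) d))))))
            (trans (Σ₂-* ((k + k) * k) f₂) (cong ((k + k) * k *_) (Σ₂-+ (λ v _ → deficit (P′.T v) + card (doubly (P′.T v))) (λ v _ → C′.α v))))))
          (Σ₂-sum (λ v _ (i : Fin n) → card (C′.Av v (toℕ i)))))
      lem : ∀ k s → 4 * (k * (4 * s)) ≡ 16 * (k * s)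
      lem = solve-∀

    tδ≤ : tδ + Λ * card O ≤ k * tT + tα
    tδ≤ = begin
      tδ + Λ * card O                       ≡⟨ cong (tδ +_) (sym (Σ₁-const (card O))) ⟩
      tδ + Σ₁ (const (card O))              ≡⟨ sym (Σ₂-+ (λ v _ → deficit (P′.T v) + card (doubly (P′.T v))) (λ _ _ → card O)) ⟩
      Σ₁ (λ v → deficit (P′.T v) + card (doubly (P′.T v)) + card O) ≤⟨ Σ₂-≤+ {g = λ v _ → k * card (P′.T v)} (λ v _ → doubly-bound (P′.T v)) ⟩
      Σ₁ (λ v → k * card (P′.T v)) + tα     ≡⟨ cong (_+ tα) (Σ₂-* k (λ v _ → card (P′.T v))) ⟩
      k * tT + tα                           ∎
      where open ≤-Reasoning

    tT≤size : tT ≤ size 0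
    tT≤size = Σ₂-mono λ v d → card-mono (P′.T⊑S v d)

    miss≤ : ∀ x → miss (suc x) ≤ early-miss (suc x) + UO x
    miss≤ x = Σ₂-≤+ λ v d → unspanned-split (lab v) (suc x) d

    miss₀≤ : miss 0 ≤ early-miss 0
    miss₀≤ = Σ₂-mono λ v d → ≤-trans (unspanned-split (lab v) 0 d) (≤-reflexive (trans (cong (card (unspanned (P′.S v 0 d) ∖ˢ P′.T v) +_) (card-∅ m)) (+-identityʳ _)))

    UO≤ : ∀ x → UO (suc x) ≤ UO x + VO x
    UO≤ x = Σ₂-≤+ λ v _ → ≤-trans (card-mono λ e p → lem (P′.U v x e) (P′.V v x e) (O e) p) (card-∪≤ (P′.U v x ∩ˢ O) (P′.V v x ∩ˢ O))
      where
      lem : ∀ a b c → (a ∨ b) ∧ c ≡ true → (a ∧ c) ∨ (b ∧ c) ≡ true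
      lem true  b c p = ∨-introˡ _ p
      lem false b c p = p

  -- Weights of the levels

  ∑< : ℕ → (ℕ → ℕ) → ℕ
  ∑< zero    f = 0
  ∑< (suc n) f = ∑< n f + f n

  sum-∑< : ∀ n (f : ℕ → ℕ) → sum {n} (f ∘ toℕ) ≡ ∑< n f
  sum-∑< zero    f = sum-zero _
  sum-∑< (suc n) f = trans (last n f) (cong (_+ f n) (sum-∑< n f))
    where
    last : ∀ n (f : ℕ → ℕ) → sum {suc n} (f ∘ toℕ) ≡ sum {n} (f ∘ toℕ) + f n
    last zero    f = trans (sum-suc _) (trans (cong (f 0 +_) (sum-zero _)) (trans (+-identityʳ _) (cong (_+ f 0) (sym (sum-zero _)))))
    last (suc n) f = trans (sum-suc (f ∘ toℕ)) (trans (cong (f 0 +_) (last n (f ∘ suc)))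
      (trans (sym (+-assoc (f 0) _ _)) (cong (_+ f (suc n)) (sym (sum-suc {n} (f ∘ toℕ))))))

  ∑<-mono : ∀ n {f g : ℕ → ℕ} → (∀ x → x < n → f x ≤ g x) → ∑< n f ≤ ∑< n g
  ∑<-mono zero    h = z≤n
  ∑<-mono (suc n) h = +-mono-≤ (∑<-mono n λ x lt → h x (m<n⇒m<1+n lt)) (h n (n<1+n n))

  ∑<-+ : ∀ n (f g : ℕ → ℕ) → ∑< n (λ x → f x + g x) ≡ ∑< n f + ∑< n g
  ∑<-+ zero    f g = refl
  ∑<-+ (suc n) f g rewrite ∑<-+ n f g = lem (∑< n f) (∑< n g) (f n) (g n)
    where
    lem : ∀ a b c d → a + b + (c + d) ≡ a + c + (b + d)
    lem = solve-∀

  ∑<-* : ∀ n c (f : ℕ → ℕ) → ∑< n (λ x → c * f x) ≡ c * ∑< n f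
  ∑<-* zero    c f = sym (*-zeroʳ c)
  ∑<-* (suc n) c f = trans (cong (_+ c * f n) (∑<-* n c f)) (sym (*-distribˡ-+ c (∑< n f) (f n)))

  ∑<-const : ∀ n c → ∑< n (const c) ≡ n * c
  ∑<-const zero    c = refl
  ∑<-const (suc n) c = trans (cong (_+ c) (∑<-const n c)) (+-comm (n * c) c)

  ∑<-cong : ∀ n {f g : ℕ → ℕ} → (∀ x → f x ≡ g x) → ∑< n f ≡ ∑< n g
  ∑<-cong zero    h = refl
  ∑<-cong (suc n) h = cong₂ _+_ (∑<-cong n h) (h n)

  private
    -- Bernoulli's inequality (1 - 1 / (x + 1)) ^ j ≥ 1 - j / (x + 1) with denominators cleared.
    ratio : ∀ x j r → j + r ≡ suc x → suc x ^ j * r ≤ x ^ j * suc x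
    ratio x zero    r eq = ≤-reflexive (cong (_+ 0) eq)
    ratio x (suc j) r eq = begin
      suc x * suc x ^ j * r         ≡⟨ l1 x (suc x ^ j) r ⟩
      suc x ^ j * (suc x * r)       ≤⟨ *-monoʳ-≤ (suc x ^ j) step ⟩
      suc x ^ j * (x * suc r)       ≡⟨ l2 x (suc x ^ j) r ⟩
      x * (suc x ^ j * suc r)       ≤⟨ *-monoʳ-≤ x (ratio x j (suc r) (trans (+-suc j r) eq)) ⟩
      x * (x ^ j * suc x)           ≡⟨ sym (*-assoc x (x ^ j) (suc x)) ⟩
      x * x ^ j * suc x             ∎
      where
      open ≤-Reasoning
      l1 : ∀ x a r → suc x * a * r ≡ a * (suc x * r)
      l1 = solve-∀
      l2 : ∀ x a r → a * (x * suc r) ≡ x * (a * suc r)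
      l2 = solve-∀
      r≤x : r ≤ x
      r≤x = ≤-trans (m≤n+m r j) (≤-reflexive (cong (_∸ 1) eq))
      step : suc x * r ≤ x * suc r
      step = ≤-trans (+-monoˡ-≤ (x * r) r≤x) (≤-reflexive (sym (*-suc x r)))

    half : ∀ x j → j + j ≤ suc x → suc x ^ j ≤ 2 * x ^ j
    half x j le = *-cancelʳ-≤ (suc x ^ j) (2 * x ^ j) (suc x) (begin
      suc x ^ j * suc x         ≤⟨ *-monoʳ-≤ (suc x ^ j) sx ⟩
      suc x ^ j * (r + r)       ≡⟨ l1 (suc x ^ j) r ⟩
      2 * (suc x ^ j * r)       ≤⟨ *-monoʳ-≤ 2 (ratio x j r jr) ⟩
      2 * (x ^ j * suc x)       ≡⟨ sym (*-assoc 2 (x ^ j) (suc x)) ⟩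
      2 * x ^ j * suc x         ∎)
      where
      open ≤-Reasoning
      r = suc x ∸ j
      jr : j + r ≡ suc x
      jr = m+[n∸m]≡n (≤-trans (m≤m+n j j) le)
      sx : suc x ≤ r + r
      sx = ≤-trans (≤-reflexive (sym jr)) (+-monoˡ-≤ r (+-cancelˡ-≤ j j r (≤-trans le (≤-reflexive (sym jr)))))
      l1 : ∀ a r → a * (r + r) ≡ 2 * (a * r)
      l1 = solve-∀

    -- `half` reaches exponents up to (x + 1) / 2, so `n` is split into two halves, each costing a
    -- factor 2.
    quadruple : ∀ n x → n ≤ x → suc x ^ n ≤ 4 * x ^ n
    quadruple n x le = begin
      suc x ^ n                             ≡⟨ cong (suc x ^_) (sym (⌊n/2⌋+⌈n/2⌉≡n n)) ⟩
      suc x ^ (a + b)                       ≡⟨ ^-distribˡ-+-* (suc x) a b ⟩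
      suc x ^ a * suc x ^ b                 ≤⟨ *-mono-≤ (half x a (≤-trans (+-monoʳ-≤ a (⌊n/2⌋≤⌈n/2⌉ n)) (≤-trans (≤-reflexive (⌊n/2⌋+⌈n/2⌉≡n n)) (≤-trans le (n≤1+n x)))))
                                                       (half x b (≤-trans (+-monoʳ-≤ b (⌊n/2⌋≤⌈n/2⌉ (suc n))) (≤-trans (≤-reflexive (⌊n/2⌋+⌈n/2⌉≡n (suc n))) (s≤s le)))) ⟩
      2 * x ^ a * (2 * x ^ b)               ≡⟨ l1 (x ^ a) (x ^ b) ⟩
      4 * (x ^ a * x ^ b)                   ≡⟨ cong (4 *_) (sym (^-distribˡ-+-* x a b)) ⟩
      4 * x ^ (a + b)                       ≡⟨ cong (λ z → 4 * x ^ z) (⌊n/2⌋+⌈n/2⌉≡n n) ⟩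
      4 * x ^ n                             ∎
      where
      open ≤-Reasoning
      a = ⌊ n /2⌋
      b = ⌈ n /2⌉
      l1 : ∀ a b → 2 * a * (2 * b) ≡ 4 * (a * b)
      l1 = solve-∀

  -- The integer counterpart of (1 + c / n) ^ n ≤ e ^ c: each increase of the base by one costs at
  -- most a factor 4.
  power-bound : ∀ n c → (n + c) ^ n ≤ 4 ^ c * n ^ n
  power-bound n zero    = ≤-reflexive (trans (cong (_^ n) (+-identityʳ n)) (sym (+-identityʳ (n ^ n))))
  power-bound n (suc c) = begin
    (n + suc c) ^ n           ≡⟨ cong (_^ n) (+-suc n c) ⟩
    suc (n + c) ^ n           ≤⟨ quadruple n (n + c) (m≤m+n n c) ⟩
    4 * (n + c) ^ n           ≤⟨ *-monoʳ-≤ 4 (power-bound n c) ⟩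
    4 * (4 ^ c * n ^ n)       ≡⟨ sym (*-assoc 4 (4 ^ c) (n ^ n)) ⟩
    4 * 4 ^ c * n ^ n         ∎
    where open ≤-Reasoning

  -- The levels are weighted so that 24 times the weight of all later levels is
  -- at most n times the weight of the current one, while all weights agree up to 4^24.
  weight : ℕ → ℕ → ℕ
  weight n x = n ^ x * (n + 24) ^ (n ∸ x)

  weight-step : ∀ n x → x < n → (n + 24) * weight n (suc x) ≡ n * weight n x
  weight-step n x lt = trans (l1 (n + 24) n (n ^ x) ((n + 24) ^ (n ∸ suc x)))
    (cong (λ z → n * (n ^ x * (n + 24) ^ z)) (sym (+-∸-assoc 1 lt)))
    where
    l1 : ∀ a n b c → a * (n * b * c) ≡ n * (b * (a * c))
    l1 = solve-∀

  weight≥ : ∀ n x → x ≤ n → n ^ n ≤ weight n x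
  weight≥ n x le = begin
    n ^ n                       ≡⟨ cong (n ^_) (sym (m+[n∸m]≡n le)) ⟩
    n ^ (x + (n ∸ x))           ≡⟨ ^-distribˡ-+-* n x (n ∸ x) ⟩
    n ^ x * n ^ (n ∸ x)         ≤⟨ *-monoʳ-≤ (n ^ x) (^-monoˡ-≤ (n ∸ x) (m≤m+n n 24)) ⟩
    weight n x                  ∎
    where open ≤-Reasoning

  weight≤ : ∀ n x → x ≤ n → weight n x ≤ (n + 24) ^ n
  weight≤ n x le = begin
    weight n x                                 ≤⟨ *-monoˡ-≤ ((n + 24) ^ (n ∸ x)) (^-monoˡ-≤ x (m≤m+n n 24)) ⟩
    (n + 24) ^ x * (n + 24) ^ (n ∸ x)          ≡⟨ sym (^-distribˡ-+-* (n + 24) x (n ∸ x)) ⟩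
    (n + 24) ^ (x + (n ∸ x))                   ≡⟨ cong ((n + 24) ^_) (m+[n∸m]≡n le) ⟩
    (n + 24) ^ n                               ∎
    where open ≤-Reasoning

  -- Summation by parts. By `weight-step`, 24 times a weight is `n` times the drop from its
  -- predecessor, so the weights of later levels telescope; the second term is what remains at the
  -- cutoff `j`.
  weighted-prefix : ∀ n (w : ℕ → ℕ) j → j < n →
    24 * ∑< (suc j) (λ x → weight n x * ∑< x w) + n * (weight n j * ∑< (suc j) w) ≡ n * ∑< (suc j) (λ x → weight n x * w x)
  weighted-prefix n w zero    lt = trans (cong (λ z → 24 * z + n * (weight n 0 * w 0)) (*-zeroʳ (weight n 0))) refl
  weighted-prefix n w (suc j) lt = begin
    24 * (a + y * b) + n * (y * (b + c))       ≡⟨ l1 n a y b c ⟩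
    24 * a + (n + 24) * y * b + n * (y * c)    ≡⟨ cong (λ z → 24 * a + z * b + n * (y * c)) (weight-step n j (≤-trans (n≤1+n _) lt)) ⟩
    24 * a + n * u * b + n * (y * c)           ≡⟨ cong (λ z → 24 * a + z + n * (y * c)) (*-assoc n u b) ⟩
    24 * a + n * (u * b) + n * (y * c)         ≡⟨ cong (_+ n * (y * c)) (weighted-prefix n w j (≤-trans (n≤1+n _) lt)) ⟩
    n * B + n * (y * c)                        ≡⟨ sym (*-distribˡ-+ n B (y * c)) ⟩
    n * (B + y * c)                            ∎
    where
    open ≡-Reasoning
    a = ∑< (suc j) (λ x → weight n x * ∑< x w)
    b = ∑< (suc j) w
    c = w (suc j)
    y = weight n (suc j)
    u = weight n j
    B = ∑< (suc j) (λ x → weight n x * w x)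
    l1 : ∀ n a y b c → 24 * (a + y * b) + n * (y * (b + c)) ≡ 24 * a + (n + 24) * y * b + n * (y * c)
    l1 = solve-∀

  private
    constant : ∀ c → Σ[ K ∈ ℕ ] 1 ≤ K × (∀ n → (n + c) ^ n ≤ K * n ^ n)
    constant c = 4 ^ c , m^n>0 4 c , λ n → power-bound n c

  opaque
    -- 4 ^ 24, a bound on the ratio of any two weights; opaque, so that only the two properties
    -- below are ever used.
    K : ℕ
    K = proj₁ (constant 24)

    1≤K : 1 ≤ K
    1≤K = proj₁ (proj₂ (constant 24))

    power≤K : ∀ n → (n + 24) ^ n ≤ K * n ^ n
    power≤K = proj₂ (proj₂ (constant 24))

  -- 41 is the total weight of all strategies in units of `X`, 128 comes from `Z≤`, 10 is the
  -- scaling of `gain`, and `K` enters through `spread`.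
  D₀ : ℕ
  D₀ = 41 * (128 * (10 * K))

  -- Gains against losses, weighted over the levels

  module Combine (q : ℕ) (w size miss early VO AV UO : ℕ → ℕ) (TO tα tT tδ Z : ℕ)
    (size-miss : ∀ ℓ → suc (suc q) * size ℓ + miss ℓ ≡ Z + w ℓ)
    (TO≤ : suc q * TO ≤ w 0)
    (tα≤ : tα ≤ (suc q + 5 * suc (suc q)) * TO)
    (AV≤ : ∀ x → x < suc q → AV x ≤ (suc q + 5 * suc (suc q)) * VO x)
    (early≤ : ∀ ℓ → ℓ < suc (suc q) → suc q * (5 * early ℓ) ≤ w ℓ)
    (VO≤ : ∀ x → suc q * VO x ≤ 12 * w (suc x) + tα)
    (tT≤ : tT ≤ 16 * (suc (suc q) * ∑< (suc q) (w ∘ suc)) + (suc (suc q) + suc (suc q)) * suc (suc q) * (tδ + tα) + ∑< (suc q) AV)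
    (tδ≤ : tδ + Z ≤ suc (suc q) * tT + tα)
    (tT≤size : tT ≤ size 0)
    (miss≤ : ∀ x → miss (suc x) ≤ early (suc x) + UO x)
    (miss₀≤ : miss 0 ≤ early 0)
    (UO₀ : UO 0 ≤ TO)
    (UO≤ : ∀ x → UO (suc x) ≤ UO x + VO x)
    where

    n k N′ : ℕ
    n = suc q
    k = suc n
    N′ = n + 5 * k

    open ≤-Reasoning

    w₀ S X B : ℕ
    w₀ = w 0
    S  = ∑< n (w ∘ suc)
    X  = ∑< n (weight n)
    B  = ∑< n (λ x → weight n x * w (suc x))

    N′≤ : N′ ≤ 11 * n
    N′≤ = ≤-trans (≤-reflexive (l q)) (≤-trans (m≤m+n _ (5 * q)) (≤-reflexive (l′ q)))
      where
      l : ∀ q → suc q + 5 * suc (suc q) ≡ 11 + 6 * q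
      l = solve-∀
      l′ : ∀ q → 11 + 6 * q + 5 * q ≡ 11 * suc q
      l′ = solve-∀

    slot : ∀ a b c → a ≤ N′ * b → n * b ≤ c → a ≤ 11 * c
    slot a b c p r = begin
      a             ≤⟨ p ⟩
      N′ * b        ≤⟨ *-monoˡ-≤ b N′≤ ⟩
      11 * n * b    ≡⟨ *-assoc 11 n b ⟩
      11 * (n * b)  ≤⟨ *-monoʳ-≤ 11 r ⟩
      11 * c        ∎

    α≤ : tα ≤ 11 * w₀
    α≤ = slot tα TO w₀ tα≤ TO≤

    ktT≤ : k * tT ≤ Z + w₀
    ktT≤ = ≤-trans (*-monoʳ-≤ k tT≤size) (≤-trans (m≤m+n _ (miss 0)) (≤-reflexive (size-miss 0)))

    δ≤ : tδ ≤ 12 * w₀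
    δ≤ = +-cancelʳ-≤ Z _ _ (begin
      tδ + Z                ≤⟨ tδ≤ ⟩
      k * tT + tα           ≤⟨ +-mono-≤ ktT≤ α≤ ⟩
      Z + w₀ + 11 * w₀      ≡⟨ l Z w₀ ⟩
      12 * w₀ + Z           ∎)
      where
      l : ∀ z w → z + w + 11 * w ≡ 12 * w + z
      l = solve-∀

    nVO≤ : ∀ x → n * VO x ≤ 12 * w (suc x) + 11 * w₀
    nVO≤ x = ≤-trans (VO≤ x) (+-monoʳ-≤ (12 * w (suc x)) α≤)

    sumAV : ∑< n AV ≤ 132 * S + n * (121 * w₀)
    sumAV = begin
      ∑< n AV                                           ≤⟨ ∑<-mono n (λ x lt → ≤-trans (slot (AV x) (VO x) _ (AV≤ x lt) (nVO≤ x)) (≤-reflexive (l (w (suc x)) w₀))) ⟩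
      ∑< n (λ x → 132 * w (suc x) + 121 * w₀)           ≡⟨ ∑<-+ n (λ x → 132 * w (suc x)) (const (121 * w₀)) ⟩
      ∑< n (λ x → 132 * w (suc x)) + ∑< n (const (121 * w₀)) ≡⟨ cong₂ _+_ (∑<-* n 132 (w ∘ suc)) (∑<-const n (121 * w₀)) ⟩
      132 * S + n * (121 * w₀)                          ∎
      where
      l : ∀ a b → 11 * (12 * a + 11 * b) ≡ 132 * a + 121 * b
      l = solve-∀

    -- By `tδ≤`, `Z` is at most about k |T|, and exhaustion bounds |T| by the wastes. The errors
    -- `tδ` and `tα` are of order `w₀` themselves, since k |T| cannot exceed `Z + w₀`.
    Z≤ : Z ≤ 128 * (k * k) * (S + k * w₀)
    Z≤ = begin
      Z                                                             ≤⟨ m≤n+m Z tδ ⟩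
      tδ + Z                                                        ≤⟨ tδ≤ ⟩
      k * tT + tα                                                   ≤⟨ +-mono-≤ (*-monoʳ-≤ k (≤-trans tT≤ (+-mono-≤ (+-monoʳ-≤ (16 * (k * S)) (*-monoʳ-≤ ((k + k) * k) (+-mono-≤ δ≤ α≤))) sumAV))) α≤ ⟩
      k * (16 * (k * S) + (k + k) * k * (12 * w₀ + 11 * w₀) + (132 * S + n * (121 * w₀))) + 11 * w₀  ≤⟨ m≤m+n _ ((112 * q + 92) * k * S + (82 * (q * q * q) + 371 * (q * q) + 621 * q + 403) * w₀) ⟩
      k * (16 * (k * S) + (k + k) * k * (12 * w₀ + 11 * w₀) + (132 * S + n * (121 * w₀))) + 11 * w₀
        + ((112 * q + 92) * k * S + (82 * (q * q * q) + 371 * (q * q) + 621 * q + 403) * w₀)    ≡⟨ l q S w₀ ⟩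
      128 * (k * k) * (S + k * w₀)                                  ∎
      where
      l : ∀ q s w → suc (suc q) * (16 * (suc (suc q) * s) + (suc (suc q) + suc (suc q)) * suc (suc q) * (12 * w + 11 * w) + (132 * s + suc q * (121 * w))) + 11 * w
        + ((112 * q + 92) * suc (suc q) * s + (82 * (q * q * q) + 371 * (q * q) + 621 * q + 403) * w)
        ≡ 128 * (suc (suc q) * suc (suc q)) * (s + suc (suc q) * w)
      l = solve-∀

    nUO≤ : ∀ x → n * UO x ≤ w₀ + 12 * ∑< x (w ∘ suc) + x * (11 * w₀)
    nUO≤ zero    = ≤-trans (*-monoʳ-≤ n UO₀) (≤-trans TO≤ (≤-reflexive (l w₀)))
      where
      l : ∀ a → a ≡ a + 12 * 0 + 0
      l = solve-∀
    nUO≤ (suc x) = begin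
      n * UO (suc x)                    ≤⟨ *-monoʳ-≤ n (UO≤ x) ⟩
      n * (UO x + VO x)                 ≡⟨ *-distribˡ-+ n (UO x) (VO x) ⟩
      n * UO x + n * VO x               ≤⟨ +-mono-≤ (nUO≤ x) (nVO≤ x) ⟩
      w₀ + 12 * ∑< x (w ∘ suc) + x * (11 * w₀) + (12 * w (suc x) + 11 * w₀) ≡⟨ l w₀ (∑< x (w ∘ suc)) (x * (11 * w₀)) (w (suc x)) ⟩
      w₀ + 12 * (∑< x (w ∘ suc) + w (suc x)) + (11 * w₀ + x * (11 * w₀))   ∎
      where
      l : ∀ a b c d → a + 12 * b + c + (12 * d + 11 * a) ≡ a + 12 * (b + d) + (11 * a + c)
      l = solve-∀

    -- Besides its early misses, a level misses elements of O picked in earlier windows. These cost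
    -- 12 / n of the waste of each earlier level; the 24 in `weight` is twice that, so that at most
    -- half of `B` is lost in this way.
    miss-level : ∀ x → x < n → 5 * n * miss (suc x) ≤ w (suc x) + 60 * ∑< x (w ∘ suc) + 60 * n * w₀
    miss-level x lt = begin
      5 * n * miss (suc x)                     ≤⟨ *-monoʳ-≤ (5 * n) (miss≤ x) ⟩
      5 * n * (early (suc x) + UO x)           ≡⟨ l1 n (early (suc x)) (UO x) ⟩
      n * (5 * early (suc x)) + 5 * (n * UO x) ≤⟨ +-mono-≤ (early≤ (suc x) (s≤s lt)) (*-monoʳ-≤ 5 (nUO≤ x)) ⟩
      w (suc x) + 5 * (w₀ + 12 * p + x * (11 * w₀))   ≤⟨ +-monoʳ-≤ (w (suc x)) (*-monoʳ-≤ 5 (+-mono-≤ (+-monoˡ-≤ (12 * p) (m≤m+n w₀ (q * w₀))) (*-monoˡ-≤ (11 * w₀) (<⇒≤ lt)))) ⟩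
      w (suc x) + 5 * (n * w₀ + 12 * p + n * (11 * w₀)) ≡⟨ l2 (w (suc x)) n w₀ p ⟩
      w (suc x) + 60 * p + 60 * n * w₀         ∎
      where
      p = ∑< x (w ∘ suc)
      l1 : ∀ n a b → 5 * n * (a + b) ≡ n * (5 * a) + 5 * (n * b)
      l1 = solve-∀
      l2 : ∀ a n b p → a + 5 * (n * b + 12 * p + n * (11 * b)) ≡ a + 60 * p + 60 * n * b
      l2 = solve-∀

    M : ℕ
    M = ∑< n (λ x → weight n x * miss (suc x))

    M≤ : 10 * M ≤ 7 * B + 120 * (X * w₀)
    M≤ = *-cancelˡ-≤ n (begin
      n * (10 * M)                                             ≡⟨ trans (l0 n M) (cong (2 *_) (sym (∑<-* n (5 * n) (λ x → weight n x * miss (suc x))))) ⟩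
      2 * ∑< n (λ x → 5 * n * (weight n x * miss (suc x)))      ≤⟨ *-monoʳ-≤ 2 (∑<-mono n λ x lt → ≤-trans (≤-reflexive (l1 (5 * n) (weight n x) (miss (suc x))))
                                                                     (≤-trans (*-monoʳ-≤ (weight n x) (miss-level x lt)) (≤-reflexive (l2 (weight n x) (w (suc x)) (∑< x (w ∘ suc)) (60 * n * w₀))))) ⟩
      2 * ∑< n (λ x → weight n x * w (suc x) + 60 * (weight n x * ∑< x (w ∘ suc)) + 60 * n * w₀ * weight n x)
        ≡⟨ cong (2 *_) (trans (∑<-+ n (λ x → weight n x * w (suc x) + 60 * (weight n x * ∑< x (w ∘ suc))) (λ x → 60 * n * w₀ * weight n x))
             (cong₂ _+_ (trans (∑<-+ n (λ x → weight n x * w (suc x)) (λ x → 60 * (weight n x * ∑< x (w ∘ suc)))) (cong (B +_) (∑<-* n 60 (λ x → weight n x * ∑< x (w ∘ suc)))))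
                        (∑<-* n (60 * n * w₀) (weight n)))) ⟩
      2 * (B + 60 * A + 60 * n * w₀ * X)                       ≡⟨ l3 B A n w₀ X ⟩
      2 * B + 5 * (24 * A) + n * (120 * (X * w₀))              ≤⟨ +-monoˡ-≤ _ (+-mono-≤ (≤-trans (*-monoʳ-≤ 2 (m≤m+n B (q * B))) ≤-refl) (*-monoʳ-≤ 5 A≤)) ⟩
      2 * (n * B) + 5 * (n * B) + n * (120 * (X * w₀))         ≡⟨ l4 n B (X * w₀) ⟩
      n * (7 * B + 120 * (X * w₀))                             ∎)
      where
      A : ℕ
      A = ∑< n (λ x → weight n x * ∑< x (w ∘ suc))
      A≤ : 24 * A ≤ n * B
      A≤ = ≤-trans (m≤m+n (24 * A) _) (≤-reflexive (weighted-prefix n (w ∘ suc) q (n<1+n q)))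
      l0 : ∀ n m → n * (10 * m) ≡ 2 * (5 * n * m)
      l0 = solve-∀
      l1 : ∀ a b c → a * (b * c) ≡ b * (a * c)
      l1 = solve-∀
      l2 : ∀ a b c d → a * (b + 60 * c + d) ≡ a * b + 60 * (a * c) + d * a
      l2 = solve-∀
      l3 : ∀ b a n w x → 2 * (b + 60 * a + 60 * n * w * x) ≡ 2 * b + 5 * (24 * a) + n * (120 * (x * w))
      l3 = solve-∀
      l4 : ∀ n b y → 2 * (n * b) + 5 * (n * b) + n * (120 * y) ≡ n * (7 * b + 120 * y)
      l4 = solve-∀

    miss-zero : 5 * miss 0 ≤ w₀
    miss-zero = begin
      5 * miss 0          ≤⟨ *-monoʳ-≤ 5 miss₀≤ ⟩
      5 * early 0         ≤⟨ m≤m+n _ (q * (5 * early 0)) ⟩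
      n * (5 * early 0)   ≤⟨ early≤ 0 (s≤s z≤n) ⟩
      w₀                  ∎

    total : ℕ
    total = ∑< n (λ x → weight n x * size (suc x)) + 40 * X * size 0

    -- By `size-miss` every level gains its waste minus its misses. The misses of the levels from 1
    -- on take at most 7/10 of `B` and 12 copies of `X * w₀`; level 0, with weight `40 * X`, misses
    -- at most a fifth of its waste. So 40 - 8 - 12 = 20 copies of `X * w₀` are left; all is scaled
    -- by 10.
    gain : 410 * (X * Z) + (3 * B + 200 * (X * w₀)) ≤ 10 * (k * total)
    gain = +-cancelʳ-≤ (7 * B + 120 * (X * w₀) + 80 * (X * w₀)) _ _ (begin
      410 * (X * Z) + (3 * B + 200 * (X * w₀)) + (7 * B + 120 * (X * w₀) + 80 * (X * w₀))  ≡⟨ l1 (X * Z) B (X * w₀) ⟩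
      10 * (X * Z + B + 40 * (X * Z + X * w₀))                     ≡⟨ cong (λ z → 10 * (z + 40 * (X * Z + X * w₀))) (sym levels-sum) ⟩
      10 * (k * Σs + M + 40 * (X * Z + X * w₀))                    ≡⟨ cong (λ z → 10 * (k * Σs + M + 40 * z)) (trans (sym (*-distribˡ-+ X Z w₀)) (cong (X *_) (sym (size-miss 0)))) ⟩
      10 * (k * Σs + M + 40 * (X * (k * size 0 + miss 0)))         ≡⟨ l2 k Σs M X (size 0) (miss 0) ⟩
      10 * (k * total) + (10 * M + 80 * (X * (5 * miss 0)))        ≤⟨ +-monoʳ-≤ (10 * (k * total)) (+-mono-≤ M≤ (*-monoʳ-≤ 80 (*-monoʳ-≤ X miss-zero))) ⟩
      10 * (k * total) + (7 * B + 120 * (X * w₀) + 80 * (X * w₀))  ∎)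
      where
      Σs : ℕ
      Σs = ∑< n (λ x → weight n x * size (suc x))
      levels-sum : k * Σs + M ≡ X * Z + B
      levels-sum = trans (trans (cong (_+ M) (sym (∑<-* n k (λ x → weight n x * size (suc x))))) (sym (∑<-+ n (λ x → k * (weight n x * size (suc x))) (λ x → weight n x * miss (suc x)))))
        (trans (∑<-cong n λ x → trans (l3 k (weight n x) (size (suc x)) (miss (suc x))) (trans (cong (weight n x *_) (size-miss (suc x))) (l4 (weight n x) Z (w (suc x)))))
          (trans (∑<-+ n (λ x → Z * weight n x) (λ x → weight n x * w (suc x))) (cong (_+ B) (trans (∑<-* n Z (weight n)) (*-comm Z X)))))
        where
        l3 : ∀ k a s m → k * (a * s) + a * m ≡ a * (k * s + m)
        l3 = solve-∀
        l4 : ∀ a z w → a * (z + w) ≡ z * a + a * w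
        l4 = solve-∀
      l1 : ∀ a b c → 410 * a + (3 * b + 200 * c) + (7 * b + 120 * c + 80 * c) ≡ 10 * (a + b + 40 * (a + c))
      l1 = solve-∀
      l2 : ∀ k s m x a b → 10 * (k * s + m + 40 * (x * (k * a + b))) ≡ 10 * (k * (s + 40 * x * a)) + (10 * m + 80 * (x * (5 * b)))
      l2 = solve-∀

    -- Passes from the plain sum of wastes in `Z≤` to the weighted one in `gain`: `X` is a sum of
    -- `n` weights, each at most `K` times any other.
    spread : X * (S + k * w₀) ≤ n * K * (3 * B + 200 * (X * w₀))
    spread = begin
      X * (S + k * w₀)                        ≡⟨ l1 X S k w₀ ⟩
      X * S + k * (X * w₀)                    ≤⟨ +-mono-≤ XS k≤ ⟩
      n * K * B + n * K * (2 * (X * w₀))      ≡⟨ sym (*-distribˡ-+ (n * K) B _) ⟩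
      n * K * (B + 2 * (X * w₀))              ≤⟨ *-monoʳ-≤ (n * K) (+-mono-≤ (m≤m+n B (2 * B)) (*-monoˡ-≤ (X * w₀) (s≤s (s≤s (z≤n {198}))))) ⟩
      n * K * (3 * B + 200 * (X * w₀))        ∎
      where
      l1 : ∀ x s k w → x * (s + k * w) ≡ x * s + k * (x * w)
      l1 = solve-∀
      X≤ : X ≤ n * (K * n ^ n)
      X≤ = ≤-trans (∑<-mono n λ x lt → ≤-trans (weight≤ n x (<⇒≤ lt)) (power≤K n)) (≤-reflexive (∑<-const n (K * n ^ n)))
      nS : n ^ n * S ≤ B
      nS = ≤-trans (≤-reflexive (sym (∑<-* n (n ^ n) (w ∘ suc)))) (∑<-mono n λ x lt → *-monoˡ-≤ (w (suc x)) (weight≥ n x (<⇒≤ lt)))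
      XS : X * S ≤ n * K * B
      XS = ≤-trans (*-monoˡ-≤ S X≤) (≤-trans (≤-reflexive (l2 n K (n ^ n) S)) (*-monoʳ-≤ (n * K) nS))
        where
        l2 : ∀ n a b s → n * (a * b) * s ≡ n * a * (b * s)
        l2 = solve-∀
      k≤ : k * (X * w₀) ≤ n * K * (2 * (X * w₀))
      k≤ = ≤-trans (*-monoˡ-≤ (X * w₀) {k} {n * K * 2} (≤-trans k≤2n (*-monoˡ-≤ 2 (≤-trans (≤-reflexive (sym (*-identityʳ n))) (*-monoʳ-≤ n 1≤K))))) (≤-reflexive (*-assoc (n * K) 2 (X * w₀)))
        where
        k≤2n : k ≤ n * 2
        k≤2n = ≤-trans (m≤m+n k q) (≤-reflexive (l3 q))
          where
          l3 : ∀ q → suc (suc q) + q ≡ suc q * 2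
          l3 = solve-∀

    combined : (D₀ * k ^ 3 + 1) * (41 * X * Z) ≤ D₀ * k ^ 4 * total
    combined = *-cancelˡ-≤ n (begin
      -- The factor `n` clears the `n * K` of `spread`; rounding the single `n` up to `k` then makes
      -- the gain a pure power of `k`.
      n * ((D₀ * k ^ 3 + 1) * (41 * X * Z))                 ≤⟨ ≤-trans (≤-reflexive (l5 n (D₀ * k ^ 3) (41 * X * Z))) (≤-trans (*-monoˡ-≤ (41 * X * Z) (+-monoʳ-≤ (D₀ * k ^ 3 * n) (n≤1+n n))) ≤-refl) ⟩
      (D₀ * k ^ 3 * n + k) * (41 * X * Z)                   ≡⟨ l1 K k n X Z ⟩
      41 * k * (128 * (k * k) * (n * K) * (410 * (X * Z)) + X * Z)   ≤⟨ *-monoʳ-≤ (41 * k) core ⟩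
      41 * k * (128 * (k * k) * (n * K) * (10 * (k * total)))        ≡⟨ l4 K k n total ⟩
      n * (D₀ * k ^ 4 * total)                              ∎)
      where
      core : 128 * (k * k) * (n * K) * (410 * (X * Z)) + X * Z ≤ 128 * (k * k) * (n * K) * (10 * (k * total))
      core = begin
        128 * (k * k) * (n * K) * (410 * (X * Z)) + X * Z     ≤⟨ +-monoʳ-≤ G (≤-trans (*-monoʳ-≤ X Z≤) (≤-reflexive (l2 X (128 * (k * k)) (S + k * w₀)))) ⟩
        128 * (k * k) * (n * K) * (410 * (X * Z)) + 128 * (k * k) * (X * (S + k * w₀))  ≤⟨ +-monoʳ-≤ G (*-monoʳ-≤ (128 * (k * k)) spread) ⟩
        128 * (k * k) * (n * K) * (410 * (X * Z)) + 128 * (k * k) * (n * K * (3 * B + 200 * (X * w₀)))  ≡⟨ l3 (128 * (k * k)) (n * K) (410 * (X * Z)) (3 * B + 200 * (X * w₀)) ⟩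
        128 * (k * k) * (n * K) * (410 * (X * Z) + (3 * B + 200 * (X * w₀)))   ≤⟨ *-monoʳ-≤ (128 * (k * k) * (n * K)) gain ⟩
        128 * (k * k) * (n * K) * (10 * (k * total))          ∎
        where
        G : ℕ
        G = 128 * (k * k) * (n * K) * (410 * (X * Z))
        l2 : ∀ x a s → x * (a * s) ≡ a * (x * s)
        l2 = solve-∀
        l3 : ∀ a b c d → a * b * c + a * (b * d) ≡ a * b * (c + d)
        l3 = solve-∀
      l5 : ∀ n a z → n * ((a + 1) * z) ≡ (a * n + n) * z
      l5 = solve-∀
      l1 : ∀ K k n x z → (41 * (128 * (10 * K)) * (k * (k * (k * 1))) * n + k) * (41 * x * z) ≡ 41 * k * (128 * (k * k) * (n * K) * (410 * (x * z)) + x * z)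
      l1 = solve-∀
      l4 : ∀ K k n t → 41 * k * (128 * (k * k) * (n * K) * (10 * (k * t))) ≡ n * (41 * (128 * (10 * K)) * (k * (k * (k * (k * 1)))) * t)
      l4 = solve-∀

  -- A strategy is the level that is really used, each repeated as often as its weight.
  levelStrategies : ℕ → ℕ → List ℕ
  levelStrategies n zero    = []
  levelStrategies n (suc x) = levelStrategies n x ++ replicate (weight n x) (suc x)

  strategies : ℕ → List ℕ
  strategies n = levelStrategies n n ++ replicate (40 * ∑< n (weight n)) 0

  sumL-replicate : ∀ c (a : ℕ) f → sumL (replicate c a) f ≡ c * f a
  sumL-replicate zero    a f = sumL-[] f
  sumL-replicate (suc c) a f = trans (sumL-∷ a _ f) (cong (f a +_) (sumL-replicate c a f))

  sum-strategies : ∀ n f → sumL (strategies n) f ≡ ∑< n (λ x → weight n x * f (suc x)) + 40 * ∑< n (weight n) * f 0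
  sum-strategies n f = trans (sumL-++ (levelStrategies n n) _ f) (cong₂ _+_ (go n) (sumL-replicate (40 * ∑< n (weight n)) 0 f))
    where
    go : ∀ x → sumL (levelStrategies n x) f ≡ ∑< x (λ x → weight n x * f (suc x))
    go zero    = sumL-[] f
    go (suc x) = trans (sumL-++ (levelStrategies n x) _ f) (cong₂ _+_ (go x) (sumL-replicate (weight n x) (suc x) f))

  length-strategies : ∀ n → length (strategies n) ≡ 41 * ∑< n (weight n)
  length-strategies n = begin
    length (strategies n)                 ≡⟨ sym (trans (sumL-const (strategies n) 1) (*-identityʳ _)) ⟩
    sumL (strategies n) (const 1)         ≡⟨ sum-strategies n (const 1) ⟩
    ∑< n (λ x → weight n x * 1) + 40 * X * 1 ≡⟨ cong (_+ 40 * X * 1) (∑<-cong n λ x → *-identityʳ (weight n x)) ⟩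
    X + 40 * X * 1                        ≡⟨ l X ⟩
    41 * X                                ∎
    where
    open ≡-Reasoning
    X : ℕ
    X = ∑< n (weight n)
    l : ∀ x → x + 40 * x * 1 ≡ 41 * x
    l = solve-∀

  module _ {m q} (Ms : Fin (suc (suc q)) → Mat m) (O : Sub m) (Oind : ∀ i → Mat.ind (Ms i) O ≡ true) where
    open Totals Ms O Oind
    open Process Ms O Oind using (k)

    private
      module Cb = Combine q w size miss early-miss VO AV UO TO tα tT tδ (Λ * card O)
        size-miss TO≤ tα≤ AV≤
        (λ ℓ lt → ≤-trans (*-monoʳ-≤ n (early-miss≤ ℓ lt)) (S∩O≤ ℓ))
        VO≤ (subst₂ (λ a b → tT ≤ 16 * (k * a) + (k + k) * k * (tδ + tα) + b) (sum-∑< n (w ∘ suc)) (sum-∑< n AV) tT≤)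
        tδ≤ tT≤size miss≤ miss₀≤ ≤-refl UO≤

    offline : (D₀ * k ^ 3 + 1) * (length (strategies n) * (Λ * card O)) ≤ D₀ * k ^ 4 * sumL (strategies n) size
    offline = subst₂ (λ a b → (D₀ * k ^ 3 + 1) * a ≤ D₀ * k ^ 4 * b)
      (cong (_* (Λ * card O)) (sym (length-strategies n)))
      (sym (sum-strategies n size)) Cb.combined

  -- Locality of decisions

  split-tabulate : ∀ {A : Set} {n} (f : Fin n → A) (t : Fin n) → ∃[ pre ] ∃[ post ] tabulate f ≡ pre ++ post ×
                   (∀ {x} → x ∈ pre → ∃[ j ] toℕ j ≤ toℕ t × x ≡ f j) × (∀ {x} → x ∈ post → ∃[ j ] toℕ t < toℕ j × x ≡ f j)
  split-tabulate f zero = f zero ∷ [] , tabulate (f ∘ suc) , refl ,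
    (λ { (here refl) → zero , z≤n , refl }) , λ i → let j , eq = ∈-tabulate⁻ i in suc j , s≤s z≤n , eq
  split-tabulate f (suc t) with split-tabulate (f ∘ suc) t
  ... | pre , post , eq , a , b = f zero ∷ pre , post , cong (f zero ∷_) eq ,
    (λ { (here refl) → zero , z≤n , refl ; (there i) → let j , le , eq = a i in suc j , s≤s le , eq }) ,
    λ i → let j , lt , eq = b i in suc j , s≤s lt , eq

  module _ {m} {ok : Sub m → Fin m → Bool} where

    greedy-++ : ∀ xs ys S → greedy ok (xs ++ ys) S ≡ greedy ok ys (greedy ok xs S)
    greedy-++ []       ys S = refl
    greedy-++ (x ∷ xs) ys S = greedy-++ xs ys _

    greedy-∉ : ∀ {e} xs S → e ∉ xs → greedy ok xs S e ≡ S e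
    greedy-∉ []       S p = refl
    greedy-∉ {e} (x ∷ xs) S p with ok S x
    ... | true  = trans (greedy-∉ xs _ (p ∘ there)) (add-≢ S {x} {e} λ { refl → p (here refl) })
    ... | false = greedy-∉ xs S (p ∘ there)

    greedy-rejected : ∀ {e} → (∀ S → ok S e ≡ false) → ∀ xs S → greedy ok xs S e ≡ S e
    greedy-rejected rej []       S = refl
    greedy-rejected {e} rej (x ∷ xs) S with ok S x in eq
    ... | true  = trans (greedy-rejected rej xs _) (add-≢ S {x} {e} λ { refl → true≢false eq (rej S) })
    ... | false = greedy-rejected rej xs S

  module _ {m} {ok ok′ : Sub m → Fin m → Bool} (P : Sub m) where

    greedy-agree : ∀ xs → (∀ {f} → f ∈ xs → ∀ S → S ⊑ P → ok S f ≡ ok′ S f) →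
                   (∀ {f} → f ∈ xs → ∀ S → ok S f ≡ true → P f ≡ true) →
                   ∀ S → S ⊑ P → greedy ok xs S ≡ greedy ok′ xs S
    greedy-agree []       h₁ h₂ S p = refl
    greedy-agree (x ∷ xs) h₁ h₂ S p rewrite sym (h₁ (here refl) S p) with ok S x in eq
    ... | true  = greedy-agree xs (h₁ ∘ there) (h₂ ∘ there) _ (add-⊑ {S = S} {P} {x} p (h₂ (here refl) S eq))
    ... | false = greedy-agree xs (h₁ ∘ there) (h₂ ∘ there) S p

    -- The scan runs by number, and no step after `e` changes whether `e` is in the set. So only the
    -- tests up to `e` matter, and until then the set stays inside `P`.
    greedy-prefix : ∀ e → (∀ f → toℕ f ≤ toℕ e → ∀ S → S ⊑ P → ok S f ≡ ok′ S f) →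
                    (∀ f → toℕ f ≤ toℕ e → ∀ S → ok S f ≡ true → P f ≡ true) →
                    ∀ S → S ⊑ P → greedy ok (allFin m) S e ≡ greedy ok′ (allFin m) S e
    greedy-prefix e h₁ h₂ S p with split-tabulate {n = m} (λ i → i) e
    ... | pre , post , eq , a , b rewrite eq | greedy-++ {ok = ok} pre post S | greedy-++ {ok = ok′} pre post S =
      trans (greedy-∉ post (greedy ok pre S) late) (trans (cong (λ S → S e)
        (greedy-agree pre (λ i → let j , le , q = a i in λ S → subst (λ f → S ⊑ P → ok S f ≡ ok′ S f) (sym q) (h₁ j le S))
                          (λ i → let j , le , q = a i in λ S → subst (λ f → ok S f ≡ true → P f ≡ true) (sym q) (h₂ j le S)) S p))
        (sym (greedy-∉ post (greedy ok′ pre S) late)))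
      where
      late : e ∉ post
      late i with b i
      ... | j , lt , refl = <-irrefl refl lt

  ∧-cong-true : ∀ a {b c} → (a ≡ true → b ≡ c) → a ∧ b ≡ a ∧ c
  ∧-cong-true true  h = h refl
  ∧-cong-true false h = refl

  module Locality {m q} (orc orc′ : Fin (suc (suc q)) → Sub m → Bool) (lab : Fin m → ℕ) (seen : Sub m)
    (agree : ∀ i X → X ⊑ seen → orc i X ≡ orc′ i X) where

    k : ℕ
    k = suc (suc q)

    open Online.Pass orc lab
    open Online orc using (okAll)
    module O′ = Online orc′
    module P′ = Online.Pass orc′ lab

    okAll-agree : ∀ {f} → seen f ≡ true → ∀ S → S ⊑ seen → okAll S f ≡ O′.okAll S f
    okAll-agree {f} sf S p = allF-cong λ i → agree i (add S f) (add-⊑ {S = S} {seen} {f} p sf)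

    -- The label is tested before the oracles, so an element of another window is rejected whatever
    -- they answer.
    okT-agree : ∀ {f} → (lab f ≡ 0 → seen f ≡ true) → ∀ S → S ⊑ seen → okT S f ≡ P′.okT S f
    okT-agree {f} sf S p = ∧-cong-true (lab f ≡ᵇ 0) λ z → okAll-agree (sf (≡ᵇ-elim (lab f) 0 z)) S p

    okF-agree : ∀ {f} → (k ≤ lab f → seen f ≡ true) → ∀ S → S ⊑ seen → okF S f ≡ P′.okF S f
    okF-agree {f} sf S p = ∧-cong-true (k ≤ᵇ lab f) λ z → okAll-agree (sf (≤ᵇ-elim k (lab f) z)) S p

    okV-agree : ∀ {f U} x → U ⊑ seen → T ⊑ seen → T ≡ P′.T → (lab f ≡ x → seen f ≡ true) →
                ∀ S → S ⊑ seen → okV U x S f ≡ P′.okV U x S f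
    okV-agree {f} {U} x Us Ts eq sf S p = ∧-cong-true (lab f ≡ᵇ x) λ z → let s = sf (≡ᵇ-elim (lab f) x z) in
      cong₂ _∧_ (cong not (trans (agree zero (add T f) (add-⊑ {S = T} {seen} {f} Ts s)) (cong (λ T → orc′ zero (add T f)) eq)))
        (cong₂ _∧_ (agree zero (add S f) (add-⊑ {S = S} {seen} {f} p s))
          (allF-cong λ j → agree (suc j) (add (U ∪ˢ S) f) (add-⊑ {S = U ∪ˢ S} {seen} {f} (∪-⊑ {S = U} {S} Us p) s)))

    T-seen : (∀ f → lab f ≡ 0 → seen f ≡ true) → T ⊑ seen
    T-seen h = greedy-inv okT (_⊑ seen)
      (λ S f p r → add-⊑ {S = S} {seen} {f} p (h f (≡ᵇ-elim (lab f) 0 (∧-elimˡ (lab f ≡ᵇ 0) r)))) (allFin m) ∅ˢ (λ _ ())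

    V-seen : ∀ x → (∀ f → lab f ≡ suc x → seen f ≡ true) → V x ⊑ seen
    V-seen x h = greedy-inv (okV (U x) (suc x)) (_⊑ seen)
      (λ S f p r → add-⊑ {S = S} {seen} {f} p (h f (≡ᵇ-elim (lab f) (suc x) (∧-elimˡ (lab f ≡ᵇ suc x) r)))) (allFin m) ∅ˢ (λ _ ())

    U-seen : ∀ x → (∀ f → lab f ≤ x → seen f ≡ true) → U x ⊑ seen
    U-seen zero    h = T-seen λ f z → h f (≤-reflexive z)
    U-seen (suc x) h = ∪-⊑ {S = U x} {V x} (U-seen x λ f le → h f (m≤n⇒m≤1+n le)) (V-seen x λ f z → h f (≤-reflexive z))

    T-agree : (∀ f → lab f ≡ 0 → seen f ≡ true) → T ≡ P′.T
    T-agree h = greedy-agree seen (allFin m) (λ {f} _ → okT-agree (h f))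
      (λ {f} _ S r → h f (≡ᵇ-elim (lab f) 0 (∧-elimˡ (lab f ≡ᵇ 0) r))) ∅ˢ (λ _ ())

    U-agree : ∀ x → (∀ f → lab f ≤ x → seen f ≡ true) → U x ≡ P′.U x
    V-agree : ∀ x → (∀ f → lab f ≤ suc x → seen f ≡ true) → V x ≡ P′.V x
    U-agree zero    h = T-agree λ f z → h f (≤-reflexive z)
    U-agree (suc x) h = cong₂ _∪ˢ_ (U-agree x λ f le → h f (m≤n⇒m≤1+n le)) (V-agree x h)
    V-agree x h = trans
      (greedy-agree seen (allFin m)
        (λ {f} _ → okV-agree (suc x) (U-seen x h′) (T-seen h₀) (T-agree h₀) (λ z → h f (≤-reflexive z)))
        (λ {f} _ S r → h f (≤-reflexive (≡ᵇ-elim (lab f) (suc x) (∧-elimˡ (lab f ≡ᵇ suc x) r)))) ∅ˢ (λ _ ()))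
      (cong (λ U → greedy (P′.okV U (suc x)) (allFin m) ∅ˢ) (U-agree x h′))
      where
      h′ : ∀ f → lab f ≤ x → seen f ≡ true
      h′ f le = h f (m≤n⇒m≤1+n le)
      h₀ : ∀ f → lab f ≡ 0 → seen f ≡ true
      h₀ f z = h f (≤-trans (≤-reflexive z) z≤n)

    S₀-agree : ∀ ℓ d → (∀ f → lab f ≤ ℓ → seen f ≡ true) → S₀ ℓ d ≡ P′.S₀ ℓ d
    S₀-agree zero    d h = T-agree λ f z → h f (≤-reflexive z)
    S₀-agree (suc x) d h = trans
      (greedy-agree seen (allFin m)
        (λ {f} _ S p → trans (∧-cong-true (V x f) λ v → agree zero (add S f) (add-⊑ {S = S} {seen} {f} p (V⊑ f v)))
                             (cong (λ V → V f ∧ orc′ zero (add S f)) (V-agree x h)))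
        (λ {f} _ S r → V⊑ f (∧-elimˡ (V x f) r)) (T ∖ˢ d) (⊑-trans (∖-l {S = T} {d}) (T-seen h₀)))
      (cong (λ T → greedy (P′.okR x) (allFin m) (T ∖ˢ d)) (T-agree h₀))
      where
      h₀ : ∀ f → lab f ≡ 0 → seen f ≡ true
      h₀ f z = h f (≤-trans (≤-reflexive z) z≤n)
      V⊑ : V x ⊑ seen
      V⊑ = V-seen x λ f z → h f (≤-reflexive z)

    S₀-seen : ∀ ℓ d → (∀ f → lab f ≤ ℓ → seen f ≡ true) → S₀ ℓ d ⊑ seen
    S₀-seen zero    d h = T-seen λ f z → h f (≤-reflexive z)
    S₀-seen (suc x) d h = greedy-inv (okR x) (_⊑ seen)
      (λ S f p r → add-⊑ {S = S} {seen} {f} p (V-seen x (λ f z → h f (≤-reflexive z)) f (∧-elimˡ (V x f) r))) (allFin m) (T ∖ˢ d)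
      (⊑-trans (∖-l {S = T} {d}) (T-seen λ f z → h f (≤-trans (≤-reflexive z) z≤n)))

  module Parts {m q} (orc : Fin (suc (suc q)) → Sub m → Bool) (lab : Fin m → ℕ) where

    open Online.Pass orc lab

    S-early : ∀ {e} ℓ d → lab e < suc (suc q) → S ℓ d e ≡ S₀ ℓ d e
    S-early {e} ℓ d lt = greedy-rejected {ok = okF} (λ S → cong (_∧ Online.okAll orc S e) (≤ᵇ-≰ lt)) (allFin m) (S₀ ℓ d)

    T-other : ∀ {e} → lab e ≢ 0 → T e ≡ false
    T-other {e} ne = greedy-rejected {ok = okT} (λ S → cong (_∧ Online.okAll orc S e) (≡ᵇ-≢ ne)) (allFin m) ∅ˢ

    V-other : ∀ {e} x → lab e ≢ suc x → V x e ≡ false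
    V-other {e} x ne = greedy-rejected {ok = okV (U x) (suc x)} (λ S → cong (_∧ (not (orc zero (add T e)) ∧ (orc zero (add S e) ∧ allF λ j → orc (suc j) (add (U x ∪ˢ S) e)))) (≡ᵇ-≢ ne)) (allFin m) ∅ˢ

    S₀-other : ∀ {e} x d → lab e ≢ suc x → S₀ (suc x) d e ≡ (T ∖ˢ d) e
    S₀-other {e} x d ne = greedy-rejected {ok = okR x} (λ S → cong (_∧ orc zero (add S e)) (V-other x ne)) (allFin m) (T ∖ˢ d)

  -- `seen` has to contain the windows before that of `e` and the window of `e` up to `e` itself,
  -- where all labels from k on count as one window scanned by number. This is what the schedule
  -- provides.
  module _ {m q} (orc orc′ : Fin (suc (suc q)) → Sub m → Bool) (lab : Fin m → ℕ) (seen : Sub m)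
    (agree : ∀ i X → X ⊑ seen → orc i X ≡ orc′ i X) (e : Fin m)
    (lower : ∀ f → lab f < lab e → lab f < suc (suc q) → seen f ≡ true)
    (same  : ∀ f → lab f ≡ lab e → toℕ f ≤ toℕ e → seen f ≡ true)
    (late  : ∀ f → suc (suc q) ≤ lab f → suc (suc q) ≤ lab e → toℕ f ≤ toℕ e → seen f ≡ true) where

    open Online.Pass orc lab
    open Locality orc orc′ lab seen agree
    module Q = Parts orc lab
    module Q′ = Parts orc′ lab

    private
      T-local : lab e < k → T e ≡ P′.T e
      T-local lt with lab e ≟ℕ 0
      ... | yes eq = greedy-prefix {ok = okT} {P′.okT} seen e
        (λ f le → okT-agree λ z → same f (trans z (sym eq)) le)
        (λ f le S r → same f (trans (≡ᵇ-elim (lab f) 0 (∧-elimˡ (lab f ≡ᵇ 0) r)) (sym eq)) le) ∅ˢ (λ _ ())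
      ... | no ne = trans (Q.T-other ne) (sym (Q′.T-other ne))

      early : ∀ x → lab e ≡ suc x → suc x < k → ∀ f → lab f ≤ x → seen f ≡ true
      early x eq lt f le = lower f (≤-trans (s≤s le) (≤-reflexive (sym eq))) (≤-trans (s≤s le) (≤-trans (n≤1+n _) lt))

      V-local : ∀ x → lab e ≡ suc x → suc x < k → ∀ f → toℕ f ≤ toℕ e → V x f ≡ P′.V x f
      V-local x eq lt f f≤e = trans (greedy-prefix {ok = okV (U x) (suc x)} {P′.okV (U x) (suc x)} seen f
        (λ g le → okV-agree (suc x) (U-seen x ear) (T-seen ear₀) (T-agree ear₀) λ z → same g (trans z (sym eq)) (≤-trans le f≤e))
        (λ g le S r → same g (trans (≡ᵇ-elim (lab g) (suc x) (∧-elimˡ (lab g ≡ᵇ suc x) r)) (sym eq)) (≤-trans le f≤e)) ∅ˢ (λ _ ()))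
        (cong (λ U → greedy (P′.okV U (suc x)) (allFin m) ∅ˢ f) (U-agree x ear))
        where
        ear : ∀ f → lab f ≤ x → seen f ≡ true
        ear = early x eq lt
        ear₀ : ∀ f → lab f ≡ 0 → seen f ≡ true
        ear₀ f z = ear f (≤-trans (≤-reflexive z) z≤n)

      R-local : ∀ x d → lab e ≡ suc x → suc x < k → S₀ (suc x) d e ≡ P′.S₀ (suc x) d e
      R-local x d eq lt = trans (greedy-prefix {ok = okR x} {P′.okR x} seen e
          (λ f le S p → trans (∧-cong-true (V x f) λ v → agree zero (add S f) (add-⊑ {S = S} {seen} {f} p (Vs f le v)))
                              (cong (_∧ orc′ zero (add S f)) (V-local x eq lt f le)))
          (λ f le S r → Vs f le (∧-elimˡ (V x f) r)) (T ∖ˢ d) (⊑-trans (∖-l {S = T} {d}) (T-seen ear₀)))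
        (cong (λ T → greedy (P′.okR x) (allFin m) (T ∖ˢ d) e) (T-agree ear₀))
        where
        ear₀ : ∀ f → lab f ≡ 0 → seen f ≡ true
        ear₀ f z = early x eq lt f (≤-trans (≤-reflexive z) z≤n)
        Vs : ∀ f → toℕ f ≤ toℕ e → V x f ≡ true → seen f ≡ true
        Vs f le v with lab f ≟ℕ suc x
        ... | yes z = same f (trans z (sym eq)) le
        ... | no ne = true≢false v (Q.V-other x ne)

      S₀-local : ∀ ℓ d → lab e < k → S₀ ℓ d e ≡ P′.S₀ ℓ d e
      S₀-local zero    d lt = T-local lt
      S₀-local (suc x) d lt with lab e ≟ℕ suc x
      ... | yes z = R-local x d z (≤-trans (s≤s (≤-reflexive (sym z))) lt)
      -- Outside its own window the level only keeps or drops elements of `T`. The coin for that is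
      -- drawn in advance, so the decision can be taken on arrival.
      ... | no ne = trans (Q.S₀-other x d ne) (trans (cong (_∧ not (d e)) (T-local lt)) (sym (Q′.S₀-other x d ne)))

    S-local : ∀ ℓ d → ℓ < k → S ℓ d e ≡ P′.S ℓ d e
    S-local ℓ d ℓ<k with <-≤-connex (lab e) k
    ... | inj₁ lt = trans (Q.S-early ℓ d lt) (trans (S₀-local ℓ d lt) (sym (Q′.S-early ℓ d lt)))
    ... | inj₂ ge = trans (greedy-prefix {ok = okF} {P′.okF} seen e
        (λ f le → okF-agree λ z → late f z ge le)
        (λ f le S r → late f (≤ᵇ-elim k (lab f) (∧-elimˡ (k ≤ᵇ lab f) r)) ge le) (S₀ ℓ d) (S₀-seen ℓ d ear))
      (cong (λ S → greedy P′.okF (allFin m) S e) (S₀-agree ℓ d ear))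
      where
      ear : ∀ f → lab f ≤ ℓ → seen f ≡ true
      ear f le = lower f (≤-trans (s≤s le) (≤-trans ℓ<k ge)) (≤-trans (s≤s le) ℓ<k)

  -- Arrival orders

  module _ {m} (f : Fin m → Fin m) (f-injective : ∀ {x y} → f x ≡ f y → x ≡ y) where

    private
      onto : ∀ {m} (f : Fin m → Fin m) → (∀ {x y} → f x ≡ f y → x ≡ y) → ∀ y → ∃[ x ] f x ≡ y
      onto {suc m} f inj y with any? (λ x → f x ≟ y)
      ... | yes p = p
      -- Punching out a missed value `y` would give an injection into a smaller set.
      ... | no np = ⊥-elim (<⇒notInjective {f = λ x → punchOut {i = y} {f x} (missed x)} ≤-refl
                              λ {x} {x′} eq → inj (punchOut-injective (missed x) (missed x′) eq))
        where
        missed : ∀ x → y ≢ f x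
        missed x eq = np (x , sym eq)

    injective⇒permutation : Permutation′ m
    injective⇒permutation = permutation f (proj₁ ∘ onto f f-injective) (proj₂ ∘ onto f f-injective)
      (λ x → f-injective (proj₂ (onto f f-injective (f x))))

  <ᵇ-intro : ∀ {x y} → x < y → (x <ᵇ y) ≡ true
  <ᵇ-intro p = Equivalence.to T-≡ (<⇒<ᵇ p)

  <ᵇ-elim : ∀ x y → (x <ᵇ y) ≡ true → x < y
  <ᵇ-elim x y p = <ᵇ⇒< x y (Equivalence.from T-≡ p)

  module Ranking {m} (key : Fin m → ℕ) (key-injective : ∀ {e f} → key e ≡ key f → e ≡ f) where

    below : Fin m → Sub m
    below e f = key f <ᵇ key e

    below-irrefl : ∀ e → below e e ≡ false
    below-irrefl e = ≢true λ p → ⊥-elim (<-irrefl refl (<ᵇ-elim (key e) (key e) p))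

    rank : Fin m → ℕ
    rank e = card (below e)

    rank< : ∀ e → rank e < m
    rank< e = ≤-trans (≤-reflexive (sym (card-add (below e) e (below-irrefl e))))
      (≤-trans (card-mono {g = const true} (λ _ _ → refl)) (≤-reflexive (trans (sum-const m 1) (*-identityʳ m))))

    rank-mono : ∀ {f e} → key f < key e → rank f < rank e
    rank-mono {f} {e} lt = ≤-trans (≤-reflexive (sym (card-add (below f) f (below-irrefl f))))
      (card-mono (add-⊑ {S = below f} {below e} {f} (λ x p → <ᵇ-intro (<-trans (<ᵇ-elim (key x) (key f) p) lt)) (<ᵇ-intro lt)))

    rank-injective : ∀ {e f} → rank e ≡ rank f → e ≡ f
    rank-injective {e} {f} eq with <-cmp (key e) (key f)
    ... | tri< lt _ _ = ⊥-elim (<⇒≢ (rank-mono lt) eq)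
    ... | tri≈ _ ke _ = key-injective ke
    ... | tri> _ _ gt = ⊥-elim (<⇒≢ (rank-mono gt) (sym eq))

    ranking : Permutation′ m
    ranking = injective⇒permutation (λ e → fromℕ< (rank< e)) λ {e} {f} eq → rank-injective (fromℕ<-injective (rank e) (rank f) (rank< e) (rank< f) eq)

    ranking-mono : ∀ {f e} → key f ≤ key e → toℕ (ranking ⟨$⟩ʳ f) ≤ toℕ (ranking ⟨$⟩ʳ e)
    ranking-mono {f} {e} le with m≤n⇒m<n∨m≡n le
    ... | inj₁ lt = subst₂ _≤_ (sym (toℕ-fromℕ< (rank< f))) (sym (toℕ-fromℕ< (rank< e))) (<⇒≤ (rank-mono lt))
    ... | inj₂ eq = ≤-reflexive (cong (λ e → toℕ (ranking ⟨$⟩ʳ e)) (key-injective eq))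

  -- Windows in the order of the labels, where all labels from k on form a single one.
  module Schedule {m} (k : ℕ) (lab : Fin m → ℕ) where

    -- Lexicographic order by window and number, as every number is below `m`.
    key : Fin m → ℕ
    key e = (lab e ⊓ k) * m + toℕ e

    key-lower : ∀ {f e} → lab f ⊓ k < lab e ⊓ k → key f < key e
    key-lower {f} {e} lt = begin-strict
      (lab f ⊓ k) * m + toℕ f <⟨ +-monoʳ-< _ (toℕ<n f) ⟩
      (lab f ⊓ k) * m + m     ≡⟨ +-comm _ m ⟩
      suc (lab f ⊓ k) * m     ≤⟨ *-monoˡ-≤ m lt ⟩
      (lab e ⊓ k) * m         ≤⟨ m≤m+n _ (toℕ e) ⟩
      key e                   ∎
      where open ≤-Reasoning

    key-injective : ∀ {e f} → key e ≡ key f → e ≡ f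
    key-injective {e} {f} eq with <-cmp (lab e ⊓ k) (lab f ⊓ k)
    ... | tri< lt _ _ = ⊥-elim (<⇒≢ (key-lower {e} {f} lt) eq)
    ... | tri≈ _ ke _ = toℕ-injective (+-cancelˡ-≡ ((lab f ⊓ k) * m) (toℕ e) (toℕ f) (trans (cong (λ c → c * m + toℕ e) (sym ke)) eq))
    ... | tri> _ _ gt = ⊥-elim (<⇒≢ (key-lower {f} {e} gt) (sym eq))

    open Ranking key key-injective using (ranking; ranking-mono) public

    same-class : ∀ {f e} → lab f ⊓ k ≡ lab e ⊓ k → toℕ f ≤ toℕ e → toℕ (ranking ⟨$⟩ʳ f) ≤ toℕ (ranking ⟨$⟩ʳ e)
    same-class {f} {e} eq le = ranking-mono {f} {e} (+-mono-≤ (*-monoˡ-≤ m (≤-reflexive eq)) le)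

    lower-class : ∀ {f e} → lab f < lab e → lab f < k → toℕ (ranking ⟨$⟩ʳ f) ≤ toℕ (ranking ⟨$⟩ʳ e)
    lower-class {f} {e} lt lt′ = ranking-mono {f} {e} (<⇒≤ (key-lower {f} {e} (subst (_< lab e ⊓ k) (sym (m≤n⇒m⊓n≡m (<⇒≤ lt′))) (⊓-pres-m< lt lt′))))

  module _ {A : Set} {_~_ : A → A → Set} (~-sym : ∀ {x y} → x ~ y → y ~ x) (~-trans : ∀ {x y z} → x ~ y → y ~ z → x ~ z)
           (H : A → ℕ) (H-cong : ∀ {x y} → x ~ y → H x ≡ H y) where

    private
      sumL-─ : ∀ {y xs} (p : Any (y ~_) xs) → sumL xs H ≡ H y + sumL (xs ─ p) H
      sumL-─ (here {xs = xs} eq) = trans (sumL-∷ _ xs H) (cong (_+ sumL xs H) (sym (H-cong eq)))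
      sumL-─ {y} (there {x} {xs} p) = begin
        sumL (x ∷ xs) H               ≡⟨ sumL-∷ x xs H ⟩
        H x + sumL xs H               ≡⟨ cong (H x +_) (sumL-─ p) ⟩
        H x + (H y + sumL (xs ─ p) H) ≡⟨ lem (H x) (H y) _ ⟩
        H y + (H x + sumL (xs ─ p) H) ≡⟨ cong (H y +_) (sym (sumL-∷ x (xs ─ p) H)) ⟩
        H y + sumL (x ∷ (xs ─ p)) H   ∎
        where
        open ≡-Reasoning
        lem : ∀ a b c → a + (b + c) ≡ b + (a + c)
        lem = solve-∀

      survives : ∀ {y z xs} (p : Any (y ~_) xs) → ¬ y ~ z → Any (z ~_) xs → Any (z ~_) (xs ─ p)
      survives (here eq) ne (here eq′) = ⊥-elim (ne (~-trans eq (~-sym eq′)))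
      survives (here eq) ne (there i)  = i
      survives (there p) ne (here eq′) = here eq′
      survives (there p) ne (there i)  = there (survives p ne i)

    -- Remove the entries of `ys` from `xs` one after another; the remaining ones still occur, since
    -- no two of them are related.
    sumL-⊆ : ∀ {ys} xs → AllPairs (λ x y → ¬ x ~ y) ys → All (λ y → Any (y ~_) xs) ys → sumL ys H ≤ sumL xs H
    sumL-⊆ xs [] [] = ≤-trans (≤-reflexive (sumL-[] H)) z≤n
    sumL-⊆ {y ∷ ys} xs (u ∷ us) (i ∷ is) = begin
      sumL (y ∷ ys) H        ≡⟨ sumL-∷ y ys H ⟩
      H y + sumL ys H        ≤⟨ +-monoʳ-≤ (H y) (sumL-⊆ (xs ─ i) us (All.zipWith (λ (ne , j) → survives i ne j) (u , is))) ⟩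
      H y + sumL (xs ─ i) H  ≡⟨ sym (sumL-─ i) ⟩
      sumL xs H              ∎
      where open ≤-Reasoning

  -- Oracles under relabelling

  T⇒≡ : ∀ {b} → Bool.T b → b ≡ true
  T⇒≡ = Equivalence.to T-≡

  ≡⇒T : ∀ {b} → b ≡ true → Bool.T b
  ≡⇒T = Equivalence.from T-≡

  ∣∣≡card : ∀ {m} (S : Subset m) → ∣ S ∣ ≡ card (Vec.lookup S)
  ∣∣≡card []          = sym (sum-zero _)
  ∣∣≡card (true  ∷ S) = trans (cong suc (∣∣≡card S)) (sym (sum-suc _))
  ∣∣≡card (false ∷ S) = trans (∣∣≡card S) (sym (sum-suc _))

  ∈⇒lookup : ∀ {m} {S : Subset m} {x} → x ∈ˢ S → Vec.lookup S x ≡ true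
  ∈⇒lookup = Vec.[]=⇒lookup

  lookup⇒∈ : ∀ {m} {S : Subset m} {x} → Vec.lookup S x ≡ true → x ∈ˢ S
  lookup⇒∈ = Vec.lookup⇒[]= _ _

  -- ι maps elements to the names under which X lists them.
  pull : ∀ {m} → Order m → Sub m → Subset m
  pull ι X = Vec.tabulate λ x → X (ι ⟨$⟩ʳ x)

  module _ {m} (ι : Order m) where

    pull-∈ : ∀ {X x} → x ∈ˢ pull ι X → X (ι ⟨$⟩ʳ x) ≡ true
    pull-∈ {X} {x} p = trans (sym (Vec.lookup∘tabulate (λ x → X (ι ⟨$⟩ʳ x)) x)) (∈⇒lookup p)

    ∈-pull : ∀ {X x} → X (ι ⟨$⟩ʳ x) ≡ true → x ∈ˢ pull ι X
    ∈-pull {X} {x} p = lookup⇒∈ (trans (Vec.lookup∘tabulate (λ x → X (ι ⟨$⟩ʳ x)) x) p)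

    pull-⊆ : ∀ {X Y} → X ⊑ Y → pull ι X ⊆ pull ι Y
    pull-⊆ {X} {Y} p i = ∈-pull {Y} (p _ (pull-∈ {X} i))

    ∣pull∣ : ∀ X → ∣ pull ι X ∣ ≡ card X
    ∣pull∣ X = trans (∣∣≡card (pull ι X)) (trans (card-cong (Vec.lookup∘tabulate λ x → X (ι ⟨$⟩ʳ x))) (sym (sum-permute (bit ∘ X) ι)))

    relabel : Matroid m → Mat m
    relabel M = record
      { ind     = λ X → indep M (pull ι X)
      ; ind-∅   = T⇒≡ (Matroid.hereditary M (λ i → ⊥-elim (absurd (pull-∈ {∅ˢ} i))) (Matroid.⊥-independent M))
      ; ind-sub = λ p i → T⇒≡ (Matroid.hereditary M (pull-⊆ p) (≡⇒T i))
      ; ind-aug = λ {S} {R} iS iR lt →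
          let e , e∈ , e∉ , i = Matroid.augmentation M (≡⇒T iS) (≡⇒T iR) (subst₂ _<_ (sym (∣pull∣ S)) (sym (∣pull∣ R)) lt)
          in ι ⟨$⟩ʳ e , pull-∈ {R} e∈ , ≢true (λ p → ⊥-elim (e∉ (∈-pull {S} p))) ,
             T⇒≡ (Matroid.hereditary M (grow S e) i)
      }
      where
      absurd : false ≢ true
      absurd ()
      grow : ∀ S e → pull ι (add S (ι ⟨$⟩ʳ e)) ⊆ pull ι S ∪ ⁅ e ⁆
      grow S e {x} i with add-elim S (ι ⟨$⟩ʳ e) (ι ⟨$⟩ʳ x) (pull-∈ {add S (ι ⟨$⟩ʳ e)} i)
      ... | inj₁ p  = x∈p∪q⁺ (inj₁ (∈-pull {S} p))
      ... | inj₂ eq = x∈p∪q⁺ (inj₂ (subst (_∈ˢ ⁅ e ⁆) (trans (sym (inverseˡ ι)) (trans (cong (ι ⟨$⟩ˡ_) eq) (inverseˡ ι))) (x∈⁅x⁆ e)))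

  oracle : ∀ {k m} → Instance k m → Order m → Fin k → Sub m → Bool
  oracle I ι i X = indep (I i) (pull ι X)

  -- The process works with names, and `τ` schedules them. A query is silently cut down to the
  -- arrived names, so the whole process can be rerun at any time; by `S-local` the wrong answers to
  -- other queries do not affect the decision.
  viewOracle : ∀ {k m} → Order m → (t : Fin m) → View k (suc (toℕ t)) → Fin k → Sub m → Bool
  viewOracle τ t vw i X = vw i (Vec.tabulate λ j → X (τ ⟨$⟩ˡ inject≤ j (toℕ<n t)))

  module _ {m} (τ : Order m) (t : Fin m) where

    arrived : Sub m
    arrived e = toℕ (τ ⟨$⟩ʳ e) ≤ᵇ toℕ t

    -- The permutation sends an element to its arrival time and this time to the name scheduled for
    -- it. Labels thus belong to names and can be drawn before anything arrives.
    view-oracle : ∀ {k} (I : Instance k m) (σ : Order m) i X → X ⊑ arrived →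
                  viewOracle τ t (view I σ t) i X ≡ oracle I (flip σ ∘ₚ flip τ) i X
    view-oracle I σ i X X⊑ = cong (indep (I i)) (Vec.tabulate-cong λ x → iff (to x) (from x))
      where
      at : Fin (suc (toℕ t)) → Fin m
      at j = inject≤ j (toℕ<n t)
      Y : Subset (suc (toℕ t))
      Y = Vec.tabulate λ j → X (τ ⟨$⟩ˡ at j)
      hit : ∀ x → Dec (∃[ j ] j ∈ˢ Y × σ ⟨$⟩ʳ at j ≡ x)
      hit x = any? λ j → (j ∈? Y) ×-dec (σ ⟨$⟩ʳ at j ≟ x)
      to : ∀ x → does (hit x) ≡ true → X (τ ⟨$⟩ˡ (σ ⟨$⟩ˡ x)) ≡ true
      to x p with does-elim (hit x) p
      ... | j , j∈ , refl = subst (λ u → X (τ ⟨$⟩ˡ u) ≡ true) (sym (inverseˡ σ))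
        (trans (sym (Vec.lookup∘tabulate (λ j → X (τ ⟨$⟩ˡ at j)) j)) (∈⇒lookup j∈))
      from : ∀ x → X (τ ⟨$⟩ˡ (σ ⟨$⟩ˡ x)) ≡ true → does (hit x) ≡ true
      from x p = dec-true (hit x) (j , lookup⇒∈ (trans (Vec.lookup∘tabulate (λ j → X (τ ⟨$⟩ˡ at j)) j) (trans (cong (λ u → X (τ ⟨$⟩ˡ u)) at-j) p)) ,
                                   trans (cong (σ ⟨$⟩ʳ_) at-j) (inverseʳ σ))
        where
        u : Fin m
        u = σ ⟨$⟩ˡ x
        u≤t : toℕ u < suc (toℕ t)
        u≤t = s≤s (subst (λ u → toℕ u ≤ toℕ t) (inverseʳ τ) (≤ᵇ-elim _ (toℕ t) (X⊑ _ p)))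
        j : Fin (suc (toℕ t))
        j = fromℕ< u≤t
        at-j : at j ≡ u
        at-j = toℕ-injective (trans (toℕ-inject≤ j (toℕ<n t)) (toℕ-fromℕ< u≤t))

  module _ {m} {q : ℕ} (lab : Fin m → ℕ) (ℓ : ℕ) (d : Sub m) where

    private
      k : ℕ
      k = suc (suc q)

    schedule : Order m
    schedule = Schedule.ranking k lab

    decision : (t : Fin m) → View k (suc (toℕ t)) → Bool
    decision t vw = Online.Pass.S (viewOracle schedule t vw) lab ℓ d (schedule ⟨$⟩ˡ t)

    final : Instance k m → Order m → Sub m
    final I ι = Online.Pass.S (oracle I ι) lab ℓ d

    final-independent : ∀ I ι → CommonIndependent I (pull ι (final I ι))
    -- The algorithm has to be feasible without knowing O, so the analysis is instantiated with the
    -- empty set.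
    final-independent I ι i = ≡⇒T (Process.Run.S-ind (λ i → relabel ι (I i)) ∅ˢ (λ i → Mat.ind-∅ (relabel ι (I i))) lab ℓ d i)

    module _ (ℓ<k : ℓ < k) (I : Instance k m) (σ : Order m) where

      ι : Order m
      ι = flip σ ∘ₚ flip schedule

      decision-final : ∀ t → decision t (view I σ t) ≡ final I ι (schedule ⟨$⟩ˡ t)
      decision-final t = S-local (viewOracle schedule t (view I σ t)) (oracle I ι) lab (arrived schedule t)
        (view-oracle schedule t I σ) (schedule ⟨$⟩ˡ t)
        (λ f lt lt′ → early f (Schedule.lower-class k lab {f} {schedule ⟨$⟩ˡ t} lt lt′))
        (λ f eq le → early f (Schedule.same-class k lab {f} {schedule ⟨$⟩ˡ t} (cong (_⊓ k) eq) le))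
        (λ f k≤f k≤e le → early f (Schedule.same-class k lab {f} {schedule ⟨$⟩ˡ t} (trans (m≥n⇒m⊓n≡n k≤f) (sym (m≥n⇒m⊓n≡n k≤e))) le))
        ℓ d ℓ<k
        where
        early : ∀ f → toℕ (schedule ⟨$⟩ʳ f) ≤ toℕ (schedule ⟨$⟩ʳ (schedule ⟨$⟩ˡ t)) → arrived schedule t f ≡ true
        early f le = ≤ᵇ-intro (≤-trans le (≤-reflexive (cong toℕ (inverseʳ schedule))))

      module _ {seeds} (decide : Strategy k m seeds) (s : Fin seeds) (decide-s : ∀ t vw → decide s t vw ≡ decision t vw) where

        private
          decide≡ : ∀ x → decide s (σ ⟨$⟩ˡ x) (view I σ (σ ⟨$⟩ˡ x)) ≡ final I ι (ι ⟨$⟩ʳ x)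
          decide≡ x = trans (decide-s (σ ⟨$⟩ˡ x) (view I σ (σ ⟨$⟩ˡ x))) (decision-final (σ ⟨$⟩ˡ x))

        picked⊆ : ∀ n → picked decide I σ s n ⊆ pull ι (final I ι)
        picked⊆ n {x} p = ∈-pull ι {final I ι} (trans (sym (decide≡ x)) (∧-elimʳ (toℕ (σ ⟨$⟩ˡ x) <ᵇ n)
          (trans (sym (Vec.lookup∘tabulate (λ x → (toℕ (σ ⟨$⟩ˡ x) <ᵇ n) ∧ decide s (σ ⟨$⟩ˡ x) (view I σ (σ ⟨$⟩ˡ x))) x)) (∈⇒lookup p))))

        ∣picked∣ : ∣ picked decide I σ s m ∣ ≡ card (final I ι)
        ∣picked∣ = trans (cong ∣_∣ (Vec.tabulate-cong λ x →
          trans (cong (_∧ decide s (σ ⟨$⟩ˡ x) (view I σ (σ ⟨$⟩ˡ x))) (<ᵇ-intro (toℕ<n (σ ⟨$⟩ˡ x)))) (decide≡ x))) (∣pull∣ ι (final I ι))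

    -- Namings that agree pointwise need not be equal as permutations; `S-local` with everything
    -- seen covers the change of oracle.
    final-cong : ∀ I {ι ι′ : Order m} → (∀ x → ι ⟨$⟩ʳ x ≡ ι′ ⟨$⟩ʳ x) → ℓ < k → ∀ e → final I ι e ≡ final I ι′ e
    final-cong I {ι} {ι′} eq ℓ<k e = S-local (oracle I ι) (oracle I ι′) lab (const true)
      (λ i X _ → cong (indep (I i)) (Vec.tabulate-cong λ x → cong X (eq x))) e
      (λ _ _ _ → refl) (λ _ _ _ → refl) (λ _ _ _ _ → refl) ℓ d ℓ<k

  strategies< : ∀ n → All (_< suc n) (strategies n)
  strategies< n = All.++⁺ (go n ≤-refl) (All.replicate⁺ (40 * ∑< n (weight n)) (s≤s z≤n))
    where
    go : ∀ x → x ≤ n → All (_< suc n) (levelStrategies n x)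
    go zero    le = []
    go (suc x) le = All.++⁺ (go x (≤-trans (n≤1+n x) le)) (All.replicate⁺ (weight n x) (s≤s le))

  length-allVec : ∀ {A : Set} (xs : List A) → .{{NonZero (length xs)}} → ∀ m → NonZero (length (allVec xs m))
  length-allVec xs zero    = _
  length-allVec xs (suc m) = subst NonZero (sym (length-cartesianProductWith Vec._∷_ xs (allVec xs m)))
    (m*n≢0 (length xs) (length (allVec xs m)) {{it}} {{length-allVec xs m}})

  -- The online algorithm and its guarantee

  module Algorithm (q m : ℕ) where

    k n N : ℕ
    k = suc (suc q)
    n = suc q
    N = k + 5 * k

    Coin : Set
    Coin = ℕ × Vec (Fin N) m × Vec Bool m

    Ls : List (Vec (Fin N) m)
    Ls = allVec (allFin N) m

    coinList : List Coin
    coinList = cartesianProduct (strategies n) (cartesianProduct Ls (coins m))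

    label : Coin → Fin m → ℕ
    label (ℓ , v , c) e = toℕ (Vec.lookup v e)

    level : Coin → ℕ
    level (ℓ , v , c) = ℓ

    drop : Coin → Sub m
    drop (ℓ , v , c) = Vec.lookup c

    level< : ∀ s → level (List.lookup coinList s) < k
    level< s with List.lookup coinList s | ∈-lookup {xs = coinList} s
    ... | ℓ , v , c | i = All.lookup (strategies< n) (proj₁ (∈-cartesianProduct⁻ (strategies n) (cartesianProduct Ls (coins m)) i))

    strategies≢0 : NonZero (length (strategies n))
    strategies≢0 = subst NonZero (sym (length-strategies n))
      (m*n≢0 41 (∑< n (weight n)) {{_}} {{>-nonZero (≤-trans (>-nonZero⁻¹ (weight n q) {{weight≢0}}) (m≤n+m (weight n q) (∑< q (weight n))))}})
      where
      weight≢0 : NonZero (weight n q)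
      weight≢0 = m*n≢0 (n ^ q) ((n + 24) ^ (n ∸ q)) {{m^n≢0 n q}} {{m^n≢0 (n + 24) (n ∸ q)}}

    coinList≢0 : NonZero (length coinList)
    coinList≢0 = subst NonZero (sym (length-cartesianProductWith _,_ (strategies n) (cartesianProduct Ls (coins m))))
      (m*n≢0 (length (strategies n)) (length (cartesianProduct Ls (coins m))) {{strategies≢0}}
        {{subst NonZero (sym (length-cartesianProductWith _,_ Ls (coins m)))
          (m*n≢0 (length Ls) (length (coins m)) {{length-allVec (allFin N) m}} {{length-allVec (true ∷ false ∷ []) m}})}})

    decide : Strategy k m (length coinList)
    decide s = let c = List.lookup coinList s in decision (label c) (level c) (drop c)

    times : Coin → Order m
    times c = schedule {q = q} (label c) (level c) (drop c)

    names : Coin → Order m → Order m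
    names c σ = flip σ ∘ₚ flip (times c)

    algorithm : OnlineAlgorithm k m
    algorithm = record
      { seeds    = length coinList
      ; seeds≢0  = coinList≢0
      ; decide   = decide
      ; feasible = λ I σ s n i → let c = List.lookup coinList s in
          Matroid.hereditary (I i) (picked⊆ (label c) (level c) (drop c) (level< s) I σ decide s (λ _ _ → refl) n)
            (final-independent (label c) (level c) (drop c) I (names c σ) i)
      }

    Λ : ℕ
    Λ = sumL Ls λ _ → sumL (coins m) (const 1)

    seeds≡ : length coinList ≡ length (strategies n) * Λ
    seeds≡ = trans (length-cartesianProductWith _,_ (strategies n) (cartesianProduct Ls (coins m)))
      (cong (length (strategies n) *_) (trans (length-cartesianProductWith _,_ Ls (coins m))
        (sym (trans (sumL-const Ls (sumL (coins m) (const 1))) (cong (length Ls *_) (trans (sumL-const (coins m) 1) (*-identityʳ _)))))))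

    picks : Instance k m → ℕ
    picks I = ℕ.sum (map (λ (σ , s) → ∣ picked decide I σ s m ∣) (cartesianProduct (orders m) (allFin (length coinList))))

    value : Instance k m → Order m → Coin → ℕ
    value I ι c = card (final (label c) (level c) (drop c) I ι)

    ℕ-sum : ∀ {A : Set} (f : A → ℕ) xs → ℕ.sum (map f xs) ≡ sumL xs f
    ℕ-sum f []       = sym (sumL-[] f)
    ℕ-sum f (x ∷ xs) = trans (cong (f x +_) (ℕ-sum f xs)) (sym (sumL-∷ x xs f))

    sumL-lookup : ∀ {A : Set} (f : A → ℕ) xs → sumL (allFin (length xs)) (f ∘ List.lookup xs) ≡ sumL xs f
    sumL-lookup f xs = trans (sym (sumL-map (List.lookup xs) (allFin (length xs)) f))
      (cong (λ ys → sumL ys f) (trans (List.map-tabulate id (List.lookup xs)) (List.tabulate-lookup xs)))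

    picks≡ : ∀ I → picks I ≡ sumL coinList λ c → sumL (orders m) λ σ → value I (names c σ) c
    picks≡ I = trans (ℕ-sum (λ (σ , s) → ∣ picked decide I σ s m ∣) (cartesianProduct (orders m) (allFin (length coinList))))
      (trans (sumL-product _,_ (orders m) (allFin (length coinList)) λ (σ , s) → ∣ picked decide I σ s m ∣)
      (trans (sumL-cong (orders m) λ σ → trans (sumL-cong (allFin (length coinList)) λ s → let c = List.lookup coinList s in
          ∣picked∣ (label c) (level c) (drop c) (level< s) I σ decide s (λ _ _ → refl))
          (sumL-lookup (λ c → value I (names c σ) c) coinList))
        (sumL-swap (orders m) coinList λ σ c → value I (names c σ) c)))

    inverse-cong : ∀ {σ τ : Order m} → σ ≈ τ → ∀ x → σ ⟨$⟩ˡ x ≡ τ ⟨$⟩ˡ x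
    inverse-cong {σ} {τ} eq x = trans (sym (inverseˡ τ)) (trans (cong (τ ⟨$⟩ˡ_) (sym (eq (σ ⟨$⟩ˡ x)))) (cong (τ ⟨$⟩ˡ_) (inverseʳ σ)))

    -- Every order is the shift of another, so shifting cannot lose anything.
    shift-sum : ∀ I c → level c < k → sumL (orders m) (λ σ → value I (flip σ) c) ≤
                sumL (orders m) (λ σ → value I (names c σ) c)
    shift-sum I c lt = ≤-trans
      (sumL-⊆ {_~_ = _≈_} (λ p x → sym (p x)) (λ p r x → trans (p x) (r x)) (λ σ → value I (flip σ) c)
        (λ {σ} {τ} p → card-cong (final-cong (label c) (level c) (drop c) I {flip σ} {flip τ} (inverse-cong {σ} {τ} p) lt))
        (map (times c ∘ₚ_) (orders m)) (orders-unique m) (All.universal hits (orders m)))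
      (≤-reflexive (sumL-map (times c ∘ₚ_) (orders m) (λ σ → value I (flip σ) c)))
      where
      τ : Order m
      τ = times c
      hits : ∀ σ → Any (σ ≈_) (map (times c ∘ₚ_) (orders m))
      hits σ = Any.map⁺ (Any.map (λ {π} p x → trans (cong (σ ⟨$⟩ʳ_) (sym (inverseˡ τ))) (p (τ ⟨$⟩ʳ x))) (orders-complete m (flip τ ∘ₚ σ)))

    module _ (I : Instance k m) (O : Subset m) (Oind : CommonIndependent I O) where

      private
        named : Order m → Sub m
        named ι y = Vec.lookup O (ι ⟨$⟩ˡ y)

        pull-named : ∀ ι → pull ι (named ι) ≡ O
        pull-named ι = trans (Vec.tabulate-cong λ x → cong (Vec.lookup O) (inverseˡ ι)) (Vec.tabulate∘lookup O)

        card-named : ∀ ι → card (named ι) ≡ ∣ O ∣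
        card-named ι = trans (sym (∣pull∣ ι (named ι))) (cong ∣_∣ (pull-named ι))

        named-ind : ∀ ι i → Mat.ind (relabel ι (I i)) (named ι) ≡ true
        named-ind ι i = trans (cong (indep (I i)) (pull-named ι)) (T⇒≡ (Oind i))

      -- For a fixed naming the coins alone yield the bound. In a real run the naming `names c σ`
      -- depends on the coins; averaging over all arrival orders makes it uniform for each outcome
      -- of the coins.
      every-order : ∀ ι → (D₀ * k ^ 3 + 1) * (length coinList * ∣ O ∣) ≤ D₀ * k ^ 4 * sumL coinList (value I ι)
      every-order ι = subst₂ (λ a b → (D₀ * k ^ 3 + 1) * a ≤ D₀ * k ^ 4 * b)
        (trans (sym (*-assoc (length (strategies n)) Λ _)) (cong₂ _*_ (sym seeds≡) (card-named ι)))
        (sym (trans (sumL-product _,_ (strategies n) (cartesianProduct Ls (coins m)) (value I ι))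
          (sumL-cong (strategies n) λ ℓ → sumL-product _,_ Ls (coins m) (λ (v , c) → value I ι (ℓ , v , c)))))
        (offline (λ i → relabel ι (I i)) (named ι) (named-ind ι))

      guarantee : (D₀ * k ^ 3 + 1) * ∣ O ∣ * (m ! * length coinList) ≤ D₀ * k ^ 4 * picks I
      guarantee = begin
        (D₀ * k ^ 3 + 1) * ∣ O ∣ * (m ! * length coinList)
          ≡⟨ lem (D₀ * k ^ 3 + 1) ∣ O ∣ (m !) (length coinList) ⟩
        m ! * ((D₀ * k ^ 3 + 1) * (length coinList * ∣ O ∣))
          ≡⟨ trans (cong (_* ((D₀ * k ^ 3 + 1) * (length coinList * ∣ O ∣))) (sym (length-orders m))) (sym (sumL-const (orders m) _)) ⟩
        sumL (orders m) (λ _ → (D₀ * k ^ 3 + 1) * (length coinList * ∣ O ∣))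
          ≤⟨ sumL-mono (orders m) (λ σ → every-order (flip σ)) ⟩
        sumL (orders m) (λ σ → D₀ * k ^ 4 * sumL coinList (value I (flip σ)))
          ≡⟨ sumL-* (orders m) (D₀ * k ^ 4) _ ⟩
        D₀ * k ^ 4 * sumL (orders m) (λ σ → sumL coinList (value I (flip σ)))
          ≡⟨ cong (D₀ * k ^ 4 *_) (sumL-swap (orders m) coinList (λ σ → value I (flip σ))) ⟩
        D₀ * k ^ 4 * sumL coinList (λ c → sumL (orders m) (λ σ → value I (flip σ) c))
          ≤⟨ *-monoʳ-≤ (D₀ * k ^ 4) shift-all ⟩
        D₀ * k ^ 4 * sumL coinList (λ c → sumL (orders m) (λ σ → value I (names c σ) c))
          ≡⟨ cong (D₀ * k ^ 4 *_) (sym (picks≡ I)) ⟩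
        D₀ * k ^ 4 * picks I ∎
        where
        open ≤-Reasoning
        lem : ∀ a b c d → a * b * (c * d) ≡ c * (a * (d * b))
        lem = solve-∀
        shift-all : sumL coinList (λ c → sumL (orders m) (λ σ → value I (flip σ) c)) ≤
                    sumL coinList (λ c → sumL (orders m) (λ σ → value I (names c σ) c))
        -- The bound on the level is known only for entries of `coinList`, hence the detour through
        -- the indices.
        shift-all = subst₂ _≤_ (sumL-lookup _ coinList) (sumL-lookup _ coinList)
          (sumL-mono (allFin (length coinList)) λ s → shift-sum I (List.lookup coinList s) (level< s))

open Development using (module Algorithm; D₀; K; 1≤K)

open import Data.Integer using (+_)
open import Data.Nat using (ℕ; NonZero; _≤_; _^_)
open import Data.Nat.Properties using (m^n≢0)
open import Data.Product using (Σ-syntax; _×_)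
open import Data.Rational using (ℚ; 0ℚ; _/_; _+_; _*_; _<_)

open import Data.Fin.Subset using (∣_∣)
import Data.Integer as ℤ
import Data.Integer.Properties as ℤ
open import Data.Nat as ℕ using (suc; s≤s)
import Data.Nat.Properties as ℕ
open import Data.Nat.Properties using (_!≢0; m*n≢0)
open import Data.Nat.Tactic.RingSolver using (solve-∀)
open import Data.Product using (_,_; proj₁)
open import Data.Rational as ℚ using (toℚᵘ)
import Data.Rational.Properties as ℚ
open import Data.Rational.Unnormalised as ℚᵘ using (mkℚᵘ; *≤*)
import Data.Rational.Unnormalised.Properties as ℚᵘ
open import Relation.Binary.PropositionalEquality using (_≡_; sym; trans; cong; cong₂; subst₂)

-- From natural to rational numbers

toℚᵘ-/ : ∀ n d .{{_ : NonZero d}} → toℚᵘ (n / d) ℚᵘ.≃ n ℚᵘ./ d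
toℚᵘ-/ n (suc d) = ℚ.toℚᵘ-fromℚᵘ (mkℚᵘ n d)

-- Unnormalised fractions are compared by cross-multiplication, which turns the claim into the
-- hypothesis.
ratio-≤ : ∀ k D c a t s .{{_ : NonZero k}} .{{_ : NonZero D}} .{{_ : NonZero c}} .{{_ : NonZero s}} →
          (D ℕ.* c ℕ.+ k) ℕ.* a ℕ.* s ≤ t ℕ.* (k ℕ.* (D ℕ.* c)) →
          (+ 1 / k + + 1 / D * (+ 1 / c)) * (+ a / 1) ℚ.≤ + t / s
ratio-≤ k@(suc _) D@(suc _) c@(suc _) a t s@(suc _) h = ℚ.toℚᵘ-cancel-≤ (begin
  toℚᵘ ((+ 1 / k + + 1 / D * (+ 1 / c)) * (+ a / 1))
    ≃⟨ ℚ.toℚᵘ-homo-* (+ 1 / k + + 1 / D * (+ 1 / c)) (+ a / 1) ⟩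
  toℚᵘ (+ 1 / k + + 1 / D * (+ 1 / c)) ℚᵘ.* toℚᵘ (+ a / 1)
    ≃⟨ ℚᵘ.*-cong (ℚᵘ.≃-trans (ℚ.toℚᵘ-homo-+ (+ 1 / k) (+ 1 / D * (+ 1 / c))) (ℚᵘ.+-cong (toℚᵘ-/ (+ 1) k)
         (ℚᵘ.≃-trans (ℚ.toℚᵘ-homo-* (+ 1 / D) (+ 1 / c)) (ℚᵘ.*-cong (toℚᵘ-/ (+ 1) D) (toℚᵘ-/ (+ 1) c))))) (toℚᵘ-/ (+ a) 1) ⟩
  (+ 1 ℚᵘ./ k ℚᵘ.+ + 1 ℚᵘ./ D ℚᵘ.* (+ 1 ℚᵘ./ c)) ℚᵘ.* (+ a ℚᵘ./ 1)
    ≤⟨ *≤* (subst₂ ℤ._≤_ (sym lhs) (sym rhs) (ℤ.+≤+ h)) ⟩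
  + t ℚᵘ./ s
    ≃⟨ ℚᵘ.≃-sym (toℚᵘ-/ (+ t) s) ⟩
  toℚᵘ (+ t / s) ∎)
  where
  open ℚᵘ.≤-Reasoning
  lhs : ((+ 1 ℤ.* + (D ℕ.* c) ℤ.+ (+ 1 ℤ.* + 1) ℤ.* + k) ℤ.* + a) ℤ.* + s ≡ + ((D ℕ.* c ℕ.+ k) ℕ.* a ℕ.* s)
  lhs = trans (cong (λ x → x ℤ.* + a ℤ.* + s) (cong₂ ℤ._+_ (ℤ.*-identityˡ (+ (D ℕ.* c))) (ℤ.*-identityˡ (+ k))))
    (trans (cong (ℤ._* + s) (sym (ℤ.pos-* (D ℕ.* c ℕ.+ k) a))) (sym (ℤ.pos-* ((D ℕ.* c ℕ.+ k) ℕ.* a) s)))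
  rhs : + t ℤ.* + (k ℕ.* (D ℕ.* c) ℕ.* 1) ≡ + (t ℕ.* (k ℕ.* (D ℕ.* c)))
  rhs = trans (cong (λ x → + t ℤ.* + x) (ℕ.*-identityʳ (k ℕ.* (D ℕ.* c)))) (sym (ℤ.pos-* t (k ℕ.* (D ℕ.* c))))

-- Here `p` is `k ^ 3`, so that `k * p` is `k ^ 4` by definition; both sides are multiplied by `k`.
clear-denominators : ∀ D k p a s t → (D ℕ.* p ℕ.+ 1) ℕ.* a ℕ.* s ≤ D ℕ.* (k ℕ.* p) ℕ.* t →
                     (D ℕ.* (k ℕ.* p) ℕ.+ k) ℕ.* a ℕ.* s ≤ t ℕ.* (k ℕ.* (D ℕ.* (k ℕ.* p)))
clear-denominators D k p a s t h = subst₂ _≤_ (l D k p a s) (r D k p t) (ℕ.*-monoʳ-≤ k h)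
  where
  l : ∀ D k p a s → k ℕ.* ((D ℕ.* p ℕ.+ 1) ℕ.* a ℕ.* s) ≡ (D ℕ.* (k ℕ.* p) ℕ.+ k) ℕ.* a ℕ.* s
  l = solve-∀
  r : ∀ D k p t → k ℕ.* (D ℕ.* (k ℕ.* p) ℕ.* t) ≡ t ℕ.* (k ℕ.* (D ℕ.* (k ℕ.* p)))
  r = solve-∀

D₀≢0 : NonZero D₀
D₀≢0 = m*n≢0 41 (128 ℕ.* (10 ℕ.* K)) {{_}} {{m*n≢0 128 (10 ℕ.* K) {{_}} {{m*n≢0 10 K {{_}} {{ℕ.>-nonZero 1≤K}}}}}}

theorem3 :
    Σ[ δ ∈ ℚ ] 0ℚ < δ ×
      (∀ (k : ℕ) .{{k≢0 : NonZero k}} → 2 ≤ k →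
        Σ[ A ∈ (∀ m → OnlineAlgorithm k m) ] Competitive (+ 1 / k + δ * ((+ 1 / (k ^ 4)) {{m^n≢0 k 4}})) A)
theorem3 = δ , δ>0 , algorithms
  where
  instance
    _ = D₀≢0
  δ : ℚ
  δ = + 1 / D₀
  δ>0 : 0ℚ < δ
  δ>0 = ℚ.positive⁻¹ δ {{ℚ.normalize-pos 1 D₀}}
  algorithms : ∀ (k : ℕ) .{{k≢0 : NonZero k}} → 2 ≤ k →
    Σ[ A ∈ (∀ m → OnlineAlgorithm k m) ] Competitive (+ 1 / k + δ * ((+ 1 / (k ^ 4)) {{m^n≢0 k 4}})) A
  algorithms k@(suc (suc q)) (s≤s (s≤s _)) = Algorithm.algorithm q , λ {m} I O opt →
    ratio-≤ k D₀ (k ^ 4) _ (Algorithm.picks q m I) (m ℕ.! ℕ.* OnlineAlgorithm.seeds (Algorithm.algorithm q m))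
      {{_}} {{D₀≢0}} {{m^n≢0 k 4}} {{m*n≢0 (m ℕ.!) (OnlineAlgorithm.seeds (Algorithm.algorithm q m)) {{m !≢0}} {{Algorithm.coinList≢0 q m}}}}
      (clear-denominators D₀ k (k ^ 3) ∣ O ∣ _ (Algorithm.picks q m I) (Algorithm.guarantee q m I O (proj₁ opt)))
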